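{- A smallest (i.e. of minimum order) primitive pure alternance graph different from the white one-point graph and from the graphs in the parity class of the white pentagon must be prime.
   Context: All graphs are simple. A bicoloured graph is a simple graph with a {black, white}-colouring of its vertices. The (local) complement Gu of a bicoloured graph G at a vertex u has the same vertex set, edge set $E(G)\,\Delta\, E(K_{N_G(u)})$ (the adjacencies inside the neighbourhood $N_G(u)$ are complemented), and the same colouring as G if u is black, while if u is white the colours of the vertices of $N_G(u)$ are reversed. This is extended to words: $Gsu=(Gs)u$; the symbol $[uv]$ stands for the word $uvu$. The set $W^\circ(G)$ of parity words is the smallest set of words containing the empty word and such that if $s\in W^\circ(G)$ then $su\in W^\circ(G)$ for every white vertex u of Gs, and $s[uv],s[vu]\in W^\circ(G)$ for every pair of adjacent black vertices u,v of Gs. The parity class of G is $[G]=\{Gs \mid s\in W^\circ(G)\}$. An anticlique is a maximal independent set of vertices; G (and $[G]$) is pure if no graph in $[G]$ has an anticlique consisting only of black vertices. An alternance graph is the graph of a double occurrence word (each letter occurring exactly twice), two letters being adjacent iff they alternate in the word. A split of a graph is a partition $V=V_1\cup V_2$ with $|V_1|,|V_2|\ge 2$ such that every vertex of $N(V_1)\cap V_2$ is adjacent to every vertex of $N(V_2)\cap V_1$; a graph with no split is prime. A rooted bicoloured graph $(G,z)$ has a bicolouring defined on $V(G)\setminus\{z\}$. From it: $rw(G)$ colours z white; $rb(G)$ colours z black; $rc(G)$ is obtained by complementing at z as if z were white and colouring z black; $lw(G)=G-z$; $lb(G)$ is obtained by complementing at z as if z were white and then removing z; for v adjacent to z, $lc_v(G)=G'\{z,v\}-z$,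 where $G'$ is G with z coloured black and, for a black vertex u and a neighbour v, $H\{u,v\}=Hvu$ if v is white and $H\{u,v\}=H[vu]$ if v is black. A split $V_1\cup V_2$ of a bicoloured graph G induces rooted graphs $(G_1,z_1)$ (identify $V_2$ to a new vertex $z_1$, removing loops) and $(G_2,z_2)$ (identify $V_1$ to $z_2$). An essential decomposition of G along the split is a pair $\{rw(G_i),lw(G_j)\}$, $\{rb(G_i),lb(G_j)\}$ or $\{rc(G_i),lc_v(G_j)\}$ with $\{i,j\}=\{1,2\}$ and v adjacent to $z_j$. Restricting to parity classes of bicoloured alternance graphs: a family $\mathcal F$ of such parity classes is closed if, for every bicoloured alternance graph G, whenever G admits an essential decomposition $\{H_1,H_2\}$ with $[H_1],[H_2]\in\mathcal F$, or G has a connected component $G_1$ with $[G_1]\in\mathcal F$, then $[G]\in\mathcal F$; the closure $\overline{\mathcal F}$ is the smallest closed family containing $\mathcal F$. A pure alternance graph G is primitive if for every family $\mathcal F$ of pure alternance parity classes, $[G]\in\overline{\mathcal F}$ implies $[G]\in\mathcal F$. The white one-point graph and the white pentagon ($C_5$ with all vertices white) are pure. -}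

module Defs where

open import Data.Nat using (ℕ; zero; suc; _≤_; _+_)
open import Data.Fin using (Fin; zero; suc; _<_; _≟_)
open import Data.Fin.Permutation using (Permutation; _⟨$⟩ˡ_; _⟨$⟩ʳ_)
open import Data.Bool using (Bool; true; false; not; _∧_; _xor_; if_then_else_)
open import Data.Bool.Properties using (∧-comm)
open import Data.List using (List; []; _∷_; _++_; length; lookup; filter; foldl)
open import Data.Product using (Σ; ∃; ∃-syntax; _×_; _,_; proj₁)
open import Data.Sum using (_⊎_)
open import Relation.Nullary using (¬_; yes; no)
open import Relation.Nullary.Decidable using (⌊_⌋)
open import Relation.Binary.PropositionalEquality using (_≡_; refl; sym; cong; cong₂)
open import Relation.Binary.Construct.Closure.ReflexiveTransitive using (Star)
open import Function.Definitions using (Injective)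

data Colour : Set where
  black white : Colour

record BGraph (n : ℕ) : Set where
  field
    adj     : Fin n → Fin n → Bool
    adj-sym : ∀ u v → adj u v ≡ adj v u
    adj-irr : ∀ u → adj u u ≡ false
    colour  : Fin n → Colour
open BGraph public

Graph : Set
Graph = Σ ℕ BGraph

flipC : Colour → Colour
flipC black = white
flipC white = black

_≈G_ : ∀ {n} → BGraph n → BGraph n → Set
G ≈G H = (∀ u v → adj G u v ≡ adj H u v) × (∀ u → colour G u ≡ colour H u)

eqb : ∀ {n} → Fin n → Fin n → Bool
eqb x y = ⌊ x ≟ y ⌋

private
  eqb-refl : ∀ {n} (x : Fin n) → eqb x x ≡ true
  eqb-refl x with x ≟ x
  ... | yes _ = refl
  ... | no ¬p = Data.Empty.⊥-elim (¬p refl)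
    where import Data.Empty

  eqb-sym : ∀ {n} (x y : Fin n) → eqb x y ≡ eqb y x
  eqb-sym x y with x ≟ y | y ≟ x
  ... | yes _ | yes _ = refl
  ... | no _  | no _  = refl
  ... | yes p | no ¬q = Data.Empty.⊥-elim (¬q (sym p))
    where import Data.Empty
  ... | no ¬p | yes q = Data.Empty.⊥-elim (¬p (sym q))
    where import Data.Empty

  ite-false : ∀ (b : Bool) (x : Bool) → b ≡ true → (if b then false else x) ≡ false
  ite-false .true x refl = refl

lcAdj : ∀ {n} → BGraph n → Fin n → Fin n → Fin n → Bool
lcAdj G u x y = if eqb x y then false else (adj G x y xor (adj G u x ∧ adj G u y))

lcColour : ∀ {n} → BGraph n → Fin n → Fin n → Colour
lcColour G u x with colour G u | adj G u x
... | white | true  = flipC (colour G x)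
... | _     | _     = colour G x

lc : ∀ {n} → BGraph n → Fin n → BGraph n
lc G u = record
  { adj     = lcAdj G u
  ; adj-sym = λ x y → cong₂ (λ b c → if b then false else c) (eqb-sym x y)
                        (cong₂ _xor_ (adj-sym G x y) (∧-comm (adj G u x) (adj G u y)))
  ; adj-irr = λ x → ite-false (eqb x x) _ (eqb-refl x)
  ; colour  = lcColour G u
  }

applyW : ∀ {n} → BGraph n → List (Fin n) → BGraph n
applyW G s = foldl lc G s

data ParityWord {n} (G : BGraph n) : List (Fin n) → Set where
  empty : ParityWord G []
  whiteStep : ∀ {s} u → ParityWord G s → colour (applyW G s) u ≡ white
            → ParityWord G (s ++ u ∷ [])
  pivotUV : ∀ {s} u v → ParityWord G s
          → colour (applyW G s) u ≡ black → colour (applyW G s) v ≡ black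
          → adj (applyW G s) u v ≡ true
          → ParityWord G (s ++ u ∷ v ∷ u ∷ [])
  pivotVU : ∀ {s} u v → ParityWord G s
          → colour (applyW G s) u ≡ black → colour (applyW G s) v ≡ black
          → adj (applyW G s) u v ≡ true
          → ParityWord G (s ++ v ∷ u ∷ v ∷ [])

_∈[_] : ∀ {n} → BGraph n → BGraph n → Set
K ∈[ G ] = Σ (List _) λ s → ParityWord G s × (applyW G s ≈G K)

relabel : ∀ {n m} → Permutation n m → BGraph n → BGraph m
relabel π G = record
  { adj     = λ i j → adj G (π ⟨$⟩ˡ i) (π ⟨$⟩ˡ j)
  ; adj-sym = λ i j → adj-sym G _ _
  ; adj-irr = λ i → adj-irr G _
  ; colour  = λ i → colour G (π ⟨$⟩ˡ i)
  }

Isomorphic : ∀ {n m} → BGraph n → BGraph m → Set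
Isomorphic {n} {m} G H = Σ (Permutation n m) λ π → relabel π G ≈G H

SameClass : ∀ {n m} → BGraph n → BGraph m → Set
SameClass {n} {m} G H = Σ (Permutation n m) λ π →
  (∀ K → K ∈[ G ] → relabel π K ∈[ H ]) ×
  (∀ K → K ∈[ H ] → relabel (Data.Fin.Permutation.flip π) K ∈[ G ])

-- [G] ∈ F, for a family F of parity classes given by representatives
_∈Fam_ : ∀ {n} → BGraph n → (Graph → Set) → Set
G ∈Fam F = Σ Graph λ H → F H × SameClass G (proj₂' H)
  where
  proj₂' : (H : Graph) → BGraph (Data.Product.proj₁ H)
  proj₂' (_ , H) = H

Independent : ∀ {n} → BGraph n → (Fin n → Bool) → Set
Independent G S = ∀ u v → S u ≡ true → S v ≡ true → adj G u v ≡ false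

Anticlique : ∀ {n} → BGraph n → (Fin n → Bool) → Set
Anticlique G S = Independent G S ×
  (∀ T → Independent G T → (∀ u → S u ≡ true → T u ≡ true) → ∀ u → T u ≡ true → S u ≡ true)

Pure : ∀ {n} → BGraph n → Set
Pure G = ∀ K → K ∈[ G ] → ∀ S → Anticlique K S →
  ¬ (∀ u → S u ≡ true → colour K u ≡ black)

occurrences : ∀ {n} → List (Fin n) → Fin n → ℕ
occurrences w u = length (filter (_≟ u) w)

AltUV : ∀ {n} → List (Fin n) → Fin n → Fin n → Set
AltUV w u v = Σ (Fin (length w)) λ i → Σ (Fin (length w)) λ j →
              Σ (Fin (length w)) λ k → Σ (Fin (length w)) λ l →
  i < j × j < k × k < l ×
  lookup w i ≡ u × lookup w j ≡ v × lookup w k ≡ u × lookup w l ≡ v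

IsDoubleOccurrence : ∀ {n} → List (Fin n) → Set
IsDoubleOccurrence w = ∀ u → occurrences w u ≡ 2

Alternance : ∀ {n} → BGraph n → Set
Alternance {n} G = Σ (List (Fin n)) λ w → IsDoubleOccurrence w ×
  (∀ u v → (adj G u v ≡ true → AltUV w u v ⊎ AltUV w v u) ×
           (AltUV w u v ⊎ AltUV w v u → adj G u v ≡ true))

anyFin : ∀ {k} → (Fin k → Bool) → Bool
anyFin {zero}  f = false
anyFin {suc k} f = f zero Data.Bool.∨ anyFin (λ i → f (suc i))

record Split {n} (G : BGraph n) : Set where
  field
    k₁ k₂ : ℕ
    e₁ : Fin k₁ → Fin n
    e₂ : Fin k₂ → Fin n
    e₁-inj : Injective _≡_ _≡_ e₁
    e₂-inj : Injective _≡_ _≡_ e₂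
    disjoint : ∀ a b → ¬ (e₁ a ≡ e₂ b)
    cover : ∀ x → (∃[ a ] e₁ a ≡ x) ⊎ (∃[ b ] e₂ b ≡ x)
    size₁ : 2 ≤ k₁
    size₂ : 2 ≤ k₂
    split : ∀ a b → (∃[ b' ] adj G (e₂ b) (e₁ b') ≡ true)
                  → (∃[ a' ] adj G (e₁ a) (e₂ a') ≡ true)
                  → adj G (e₁ a) (e₂ b) ≡ true
open Split public

Prime : ∀ {n} → BGraph n → Set
Prime G = ¬ Split G

-- Rooted graphs: graphs on Fin (suc k), the root z being zero.
-- The colour of the root is irrelevant (every operation resets or removes it).

-- identify the vertices outside the image of e₁ (the image of e₂) to the root
quotientAdj : ∀ {n k₁ k₂} → BGraph n → (Fin k₁ → Fin n) → (Fin k₂ → Fin n)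
            → Fin (suc k₁) → Fin (suc k₁) → Bool
quotientAdj G e₁ e₂ zero    zero    = false
quotientAdj G e₁ e₂ zero    (suc j) = anyFin (λ b → adj G (e₁ j) (e₂ b))
quotientAdj G e₁ e₂ (suc i) zero    = anyFin (λ b → adj G (e₁ i) (e₂ b))
quotientAdj G e₁ e₂ (suc i) (suc j) = adj G (e₁ i) (e₁ j)

private
  quotientSym : ∀ {n k₁ k₂} (G : BGraph n) e₁ (e₂ : Fin k₂ → Fin n) (x y : Fin (suc k₁))
              → quotientAdj G e₁ e₂ x y ≡ quotientAdj G e₁ e₂ y x
  quotientSym G e₁ e₂ zero zero = refl
  quotientSym G e₁ e₂ zero (suc j) = refl
  quotientSym G e₁ e₂ (suc i) zero = refl
  quotientSym G e₁ e₂ (suc i) (suc j) = adj-sym G _ _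

  quotientIrr : ∀ {n k₁ k₂} (G : BGraph n) e₁ (e₂ : Fin k₂ → Fin n) (x : Fin (suc k₁))
              → quotientAdj G e₁ e₂ x x ≡ false
  quotientIrr G e₁ e₂ zero = refl
  quotientIrr G e₁ e₂ (suc i) = adj-irr G _

quotient : ∀ {n k₁ k₂} → BGraph n → (Fin k₁ → Fin n) → (Fin k₂ → Fin n) → BGraph (suc k₁)
quotient G e₁ e₂ = record
  { adj     = quotientAdj G e₁ e₂
  ; adj-sym = quotientSym G e₁ e₂
  ; adj-irr = quotientIrr G e₁ e₂
  ; colour  = λ { zero → white ; (suc i) → colour G (e₁ i) }
  }

setRootColour : ∀ {k} → Colour → BGraph (suc k) → BGraph (suc k)
setRootColour c G = record
  { adj = adj G ; adj-sym = adj-sym G ; adj-irr = adj-irr G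
  ; colour = λ { zero → c ; (suc i) → colour G (suc i) } }

deleteRoot : ∀ {k} → BGraph (suc k) → BGraph k
deleteRoot G = record
  { adj = λ i j → adj G (suc i) (suc j)
  ; adj-sym = λ i j → adj-sym G (suc i) (suc j)
  ; adj-irr = λ i → adj-irr G (suc i)
  ; colour = λ i → colour G (suc i) }

-- H{u,v} for a black vertex u and a neighbour v
brace : ∀ {n} → BGraph n → Fin n → Fin n → BGraph n
brace H u v with colour H v
... | white = lc (lc H v) u
... | black = lc (lc (lc H v) u) v

rw rb rc : ∀ {k} → BGraph (suc k) → BGraph (suc k)
rw G = setRootColour white G
rb G = setRootColour black G
rc G = setRootColour black (lc (setRootColour white G) zero)

lw lb : ∀ {k} → BGraph (suc k) → BGraph k
lw G = deleteRoot G
lb G = deleteRoot (lc (setRootColour white G) zero)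

lcv : ∀ {k} → Fin (suc k) → BGraph (suc k) → BGraph k
lcv v G = deleteRoot (brace (setRootColour black G) zero v)

EssPair : (∀ {m} → BGraph m → Set) → ∀ {k l} → BGraph (suc k) → BGraph (suc l) → Set
EssPair P Gi Gj =
  (P (rw Gi) × P (lw Gj)) ⊎
  (P (rb Gi) × P (lb Gj)) ⊎
  (Σ (Fin _) λ v → adj Gj zero v ≡ true × P (rc Gi) × P (lcv v Gj))

EssDecomp : (∀ {m} → BGraph m → Set) → ∀ {n} → BGraph n → Set
EssDecomp P G = Σ (Split G) λ s →
  EssPair P (quotient G (e₁ s) (e₂ s)) (quotient G (e₂ s) (e₁ s)) ⊎
  EssPair P (quotient G (e₂ s) (e₁ s)) (quotient G (e₁ s) (e₂ s))

Adj : ∀ {n} → BGraph n → Fin n → Fin n → Set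
Adj G u v = adj G u v ≡ true

induced : ∀ {n k} → BGraph n → (Fin k → Fin n) → BGraph k
induced G e = record
  { adj = λ i j → adj G (e i) (e j)
  ; adj-sym = λ i j → adj-sym G _ _
  ; adj-irr = λ i → adj-irr G _
  ; colour = λ i → colour G (e i) }

record Component {n} (G : BGraph n) : Set where
  field
    size : ℕ
    emb : Fin (suc size) → Fin n
    emb-inj : Injective _≡_ _≡_ emb
    closed : ∀ i x → adj G (emb i) x ≡ true → ∃[ j ] emb j ≡ x
    connected : ∀ i j → Star (Adj G) (emb i) (emb j)
open Component public

componentGraph : ∀ {n} {G : BGraph n} → (c : Component G) → BGraph (suc (size c))
componentGraph {G = G} c = induced G (emb c)

data Closure (F : Graph → Set) : ∀ {n} → BGraph n → Set where
  base : ∀ {n} {G : BGraph n} → G ∈Fam F → Closure F G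
  decomp : ∀ {n} {G : BGraph n} → Alternance G → EssDecomp (Closure F) G → Closure F G
  component : ∀ {n} {G : BGraph n} → Alternance G
            → (c : Component G) → Closure F (componentGraph c) → Closure F G
  sameClass : ∀ {n m} {G : BGraph n} {H : BGraph m} → SameClass G H
            → Closure F H → Closure F G

PureAlternance : ∀ {n} → BGraph n → Set
PureAlternance G = Alternance G × Pure G

Primitive : ∀ {n} → BGraph n → Set₁
Primitive G = PureAlternance G ×
  (∀ (F : Graph → Set) → (∀ H → F H → PureAlternance (proj₂ H)) → Closure F G → G ∈Fam F)
  where open Data.Product using (proj₂)

WhiteOnePoint : ∀ {n} → BGraph n → Set
WhiteOnePoint {n} G = n ≡ 1 × (∀ u → colour G u ≡ white)

pentAdjN : ℕ → ℕ → Bool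
pentAdjN 0 1 = true
pentAdjN 1 2 = true
pentAdjN 2 3 = true
pentAdjN 3 4 = true
pentAdjN 0 4 = true
pentAdjN _ _ = false

pentAdj : Fin 5 → Fin 5 → Bool
pentAdj i j = pentAdjN (Data.Fin.toℕ i) (Data.Fin.toℕ j) Data.Bool.∨ pentAdjN (Data.Fin.toℕ j) (Data.Fin.toℕ i)

private
  pentSym : ∀ i j → pentAdj i j ≡ pentAdj j i
  pentSym i j = Data.Bool.Properties.∨-comm (pentAdjN (Data.Fin.toℕ i) (Data.Fin.toℕ j)) (pentAdjN (Data.Fin.toℕ j) (Data.Fin.toℕ i))
    where import Data.Bool.Properties

  pentIrr : ∀ i → pentAdj i i ≡ false
  pentIrr zero = refl
  pentIrr (suc zero) = refl
  pentIrr (suc (suc zero)) = refl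
  pentIrr (suc (suc (suc zero))) = refl
  pentIrr (suc (suc (suc (suc zero)))) = refl

whitePentagon : BGraph 5
whitePentagon = record
  { adj = pentAdj ; adj-sym = pentSym ; adj-irr = pentIrr ; colour = λ _ → white }

InPentagonClass : ∀ {n} → BGraph n → Set
InPentagonClass G = Σ (BGraph 5) λ K → K ∈[ whitePentagon ] × Isomorphic K G

Candidate : ∀ {n} → BGraph n → Set₁
Candidate G = Primitive G × ¬ WhiteOnePoint G × ¬ InPentagonClass G

{-# OPTIONS --safe #-}

-- A bicoloured graph G spans an isotropic system over the Klein group K, and a colour is a
-- forbidden transition at a vertex. Since local complementation only permutes the nonzero
-- elements of K at each vertex, G is impure iff there is a choice c of an allowed
-- transition at each vertex such that every vertex is in the support of a vector with
-- values in {0, c}. A split presents the isotropic system of G as a gluing of those of the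
-- two rooted graphs, and a choice c on one side does two things: it pairs the four
-- half-edges at the marker according to some transition (Through), or even by two disjoint
-- paths (Inside). Purity of G, and of each of the six pieces of a rooted graph, depends only
-- on which transitions occur and on whether disjoint paths occur. If no essential
-- decomposition of a pure G along the split has two pure pieces, then one side is tight
-- (some rw, rb or rc piece H of it is pure, and H is not the pentagon) and the other is
-- loose (all six of its pieces are impure). By minimality H is not primitive, so a graph in
-- its class has a split with pure pieces; the side of it avoiding the marker yields a
-- split of G whose new side is not loose, hence is tight and smaller. This descent is infinite.

module Submission where

open import Defs
open import Algebra.Bundles using (CommutativeRing)
open import Data.Bool as Bool using (Bool; true; false; not; T; _∧_; _∨_; _xor_; if_then_else_)
open import Data.Bool.Properties using (xor-∧-commutativeRing; xor-same; xor-comm; xor-assoc; xor-identityʳ; ∧-comm; ∧-assoc; ∧-zeroʳ; ∧-identityʳ; T-∧)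
open import Data.Empty using (⊥; ⊥-elim)
open import Data.Fin as Fin using (Fin; zero; suc; _≟_; toℕ; splitAt; _↑ˡ_; _↑ʳ_)
open import Data.Fin.Permutation using (Permutation; _⟨$⟩ˡ_; _⟨$⟩ʳ_; flip; permutation; inverseˡ; inverseʳ; _∘ₚ_; ↔⇒≡)
open import Data.Fin.Properties as Fin using (any?; all?; ¬∀⟶∃¬; splitAt-↑ˡ; splitAt-↑ʳ; splitAt⁻¹-↑ˡ; splitAt⁻¹-↑ʳ)
open import Data.List using (List; []; _∷_; _++_; map; reverse; length; lookup; filter; drop)
open import Data.List.Properties using (foldl-++; map-++; unfold-reverse; filter-++; length-++)
open import Data.List.Relation.Binary.Sublist.Propositional using (_⊆_; []; _∷_; _∷ʳ_; ⊆-refl; ⊆-trans; minimum)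
open import Data.Maybe using (Maybe; just; nothing)
open import Data.Maybe.Properties using (just-injective; ≡-dec)
open import Data.Nat using (ℕ; zero; suc; _≤_; _<_; _+_; _∸_; z≤n; s≤s)
open import Data.Nat.DivMod using (_mod_)
open import Data.Nat.Induction using (<-wellFounded)
open import Data.Nat.Properties as ℕ using (≤-refl; ≤-trans; ≤-reflexive; <-irrefl; +-comm; suc-injective)
open import Data.Product using (Σ; ∃; ∃-syntax; _×_; _,_; proj₁; proj₂)
open import Data.Sum as Sum using (_⊎_; inj₁; inj₂)
open import Data.Unit using (tt)
open import Data.Vec.Functional using () renaming (_∷_ to _◂_)
open import Function using (_∘_; _↔_; mk↔ₛ′; Inverse; Equivalence)
open import Function.Construct.Composition using (_↔-∘_)
open import Function.Construct.Identity using (↔-id)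
open import Function.Construct.Symmetry using (↔-sym)
open import Function.Definitions using (Injective)
open import Induction.WellFounded using (Acc; acc)
open import Relation.Binary.Construct.Closure.ReflexiveTransitive using (ε)
open import Relation.Binary.PropositionalEquality using (_≡_; _≢_; refl; sym; trans; cong; cong₂; subst; subst₂; module ≡-Reasoning)
open import Relation.Nullary using (¬_; Dec; yes; no)
open import Relation.Nullary.Decidable using (_×-dec_; _⊎-dec_; _→-dec_; ¬?; ¬¬-excluded-middle; from-yes)
open import Algebra.Properties.Semiring.Sum (CommutativeRing.semiring xor-∧-commutativeRing)
  using (sum; sum-cong-≗; ∑-distrib-+; ∑-comm; *-distribˡ-sum; sum-permute)

-- Parities of finite sums, and the isotropic system of a graph

-- Whether a cover exists is never decided. Purity and primality are negations, so the case
-- distinctions can be made under double negation. The argument can keep returning to `G` because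
-- passing from a piece to another graph of its class only performs local complementations. These
-- preserve the rank of every cut and also the looseness of a vertex set, once looseness is phrased
-- by pairings of vectors instead of values at a marker (`LooseOn`). Only vertex sets without the
-- marker pull back, since the marker is no vertex of `G`. Two obstacles shape the rest. Minimality
-- says nothing against a piece in the class of the pentagon. At each vertex the pentagon has both
-- disjoint paths and some transition, while the tight sides left over by the case analysis never
-- have both, so this exclusion is made part of `Tight`. Moreover closures admit components, so that
-- `G`, and with it every graph in the class of the piece, has to be shown connected; this reduces
-- to excluding isolated vertices of `G`.

BoolFun : ℕ → Set
BoolFun zero    = Bool
BoolFun (suc n) = Bool → BoolFun n

Identity : ∀ n → BoolFun n → BoolFun n → Set
Identity zero    f g = f ≡ g
Identity (suc n) f g = ∀ b → Identity n (f b) (g b)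

agree : ∀ n → BoolFun n → BoolFun n → Bool
agree zero    f g = not (f xor g)
agree (suc n) f g = agree n (f true) (g true) ∧ agree n (f false) (g false)

-- Boolean identities by reflection: for concrete `f` and `g` the premise evaluates to the unit
-- type, so callers pass `tt`.
truthTable : ∀ n (f g : BoolFun n) → T (agree n f g) → Identity n f g
truthTable zero    true  true  _ = refl
truthTable zero    false false _ = refl
truthTable (suc n) f g p true  = truthTable n (f true) (g true) (proj₁ (Equivalence.to (T-∧ {agree n (f true) (g true)}) p))
truthTable (suc n) f g p false = truthTable n (f false) (g false) (proj₂ (Equivalence.to (T-∧ {agree n (f true) (g true)}) p))

≢true⇒≡false : ∀ {b} → b ≢ true → b ≡ false
≢true⇒≡false {true}  ne = ⊥-elim (ne refl)
≢true⇒≡false {false} ne = refl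

∧-true⁻ : ∀ {a b} → a ∧ b ≡ true → a ≡ true × b ≡ true
∧-true⁻ {true} {true} p = refl , refl

true≢false : ∀ {b} → b ≡ true → b ≡ false → ⊥
true≢false refl ()

eqb-true⁻ : ∀ {n} {x y : Fin n} → eqb x y ≡ true → x ≡ y
eqb-true⁻ {x = x} {y} p with x ≟ y
... | yes q = q

eqb-refl′ : ∀ {n} (x : Fin n) → eqb x x ≡ true
eqb-refl′ x with x ≟ x
... | yes _ = refl
... | no ne = ⊥-elim (ne refl)

eqb-≢ : ∀ {n} {x y : Fin n} → x ≢ y → eqb x y ≡ false
eqb-≢ {x = x} {y} ne with x ≟ y
... | yes q = ⊥-elim (ne q)
... | no _  = refl

sum-false : ∀ {n} (f : Fin n → Bool) → (∀ i → f i ≡ false) → sum f ≡ false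
sum-false {zero}  f p = refl
sum-false {suc n} f p = cong₂ _xor_ (p zero) (sum-false (f ∘ suc) (p ∘ suc))

sum-delta : ∀ {n} (f : Fin n → Bool) u → (∀ w → w ≢ u → f w ≡ false) → sum f ≡ f u
sum-delta {suc n} f zero    p = trans (cong (f zero xor_) (sum-false (f ∘ suc) (λ i → p (suc i) λ ()))) (xor-identityʳ (f zero))
sum-delta {suc n} f (suc u) p = cong₂ _xor_ (p zero λ ()) (sum-delta (f ∘ suc) u (λ w ne → p (suc w) λ { refl → ne refl }))

sum-true⁻ : ∀ {n} (f : Fin n → Bool) → sum f ≡ true → ∃ λ i → f i ≡ true
sum-true⁻ {suc n} f p with f zero in eq
... | true  = zero , eq
... | false = let (i , q) = sum-true⁻ (f ∘ suc) p in suc i , q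

anyFin⁺ : ∀ {n} (f : Fin n → Bool) i → f i ≡ true → anyFin f ≡ true
anyFin⁺ f zero    p rewrite p = refl
anyFin⁺ f (suc i) p with f zero
... | true  = refl
... | false = anyFin⁺ (f ∘ suc) i p

anyFin⁻ : ∀ {n} (f : Fin n → Bool) → anyFin f ≡ true → ∃ λ i → f i ≡ true
anyFin⁻ {suc n} f p with f zero in eq
... | true  = zero , eq
... | false = let (i , q) = anyFin⁻ (f ∘ suc) p in suc i , q

-- The three transitions at a vertex, read as the nonzero elements of the Klein group
-- K; a vector over V(G) with values in K belongs to the isotropic system of G iff it
-- is a sum of the vectors having tb at a vertex v and ta at the neighbours of v.
data Transition : Set where
  ta tb tc : Transition

K : Set
K = Maybe Transition

-- Coordinates over the two-element field in the basis `ta`, `tb`, with `tc` as the sum of the two.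
α β : K → Bool
α nothing   = false
α (just ta) = true
α (just tb) = false
α (just tc) = true
β nothing   = false
β (just ta) = false
β (just tb) = true
β (just tc) = true

fromBits : Bool → Bool → K
fromBits false false = nothing
fromBits true  false = just ta
fromBits false true  = just tb
fromBits true  true  = just tc

α-fromBits : ∀ a b → α (fromBits a b) ≡ a
α-fromBits false false = refl
α-fromBits true  false = refl
α-fromBits false true  = refl
α-fromBits true  true  = refl

β-fromBits : ∀ a b → β (fromBits a b) ≡ b
β-fromBits false false = refl
β-fromBits true  false = refl
β-fromBits false true  = refl
β-fromBits true  true  = refl

fromBits-αβ : ∀ k → fromBits (α k) (β k) ≡ k
fromBits-αβ nothing   = refl
fromBits-αβ (just ta) = refl
fromBits-αβ (just tb) = refl
fromBits-αβ (just tc) = refl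

bits-injective : ∀ {k l} → α k ≡ α l → β k ≡ β l → k ≡ l
bits-injective {k} {l} p q = trans (sym (fromBits-αβ k)) (trans (cong₂ fromBits p q) (fromBits-αβ l))

swapAB swapAC swapBC : Transition → Transition
swapAB ta = tb
swapAB tb = ta
swapAB tc = tc
swapAC ta = tc
swapAC tb = tb
swapAC tc = ta
swapBC ta = ta
swapBC tb = tc
swapBC tc = tb

swapAB-involutive : ∀ c → swapAB (swapAB c) ≡ c
swapAB-involutive ta = refl
swapAB-involutive tb = refl
swapAB-involutive tc = refl

swapAC-involutive : ∀ c → swapAC (swapAC c) ≡ c
swapAC-involutive ta = refl
swapAC-involutive tb = refl
swapAC-involutive tc = refl

swapBC-involutive : ∀ c → swapBC (swapBC c) ≡ c
swapBC-involutive ta = refl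
swapBC-involutive tb = refl
swapBC-involutive tc = refl

Perm : Set
Perm = Transition ↔ Transition

to from : Perm → Transition → Transition
to   = Inverse.to
from = Inverse.from

to-from : ∀ (ψ : Perm) c → to ψ (from ψ c) ≡ c
to-from ψ c = Inverse.inverseˡ ψ refl

from-to : ∀ (ψ : Perm) c → from ψ (to ψ c) ≡ c
from-to ψ c = Inverse.inverseʳ ψ refl

to-injective : ∀ (ψ : Perm) {c d} → to ψ c ≡ to ψ d → c ≡ d
to-injective ψ {c} {d} p = trans (sym (from-to ψ c)) (trans (cong (from ψ) p) (from-to ψ d))

permAC permBC : Perm
permAC = mk↔ₛ′ swapAC swapAC swapAC-involutive swapAC-involutive
permBC = mk↔ₛ′ swapBC swapBC swapBC-involutive swapBC-involutive

act : (Transition → Transition) → K → K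
act f nothing  = nothing
act f (just c) = just (f c)

act-id : ∀ k → act (λ c → c) k ≡ k
act-id nothing  = refl
act-id (just c) = refl

act-nonzero : ∀ {f} k → k ≢ nothing → act f k ≢ nothing
act-nonzero nothing  ne = ne
act-nonzero (just c) ne = λ ()

α-swapAB : ∀ k → α (act swapAB k) ≡ β k
α-swapAB nothing   = refl
α-swapAB (just ta) = refl
α-swapAB (just tb) = refl
α-swapAB (just tc) = refl

β-swapAB : ∀ k → β (act swapAB k) ≡ α k
β-swapAB nothing   = refl
β-swapAB (just ta) = refl
β-swapAB (just tb) = refl
β-swapAB (just tc) = refl

α-swapAC : ∀ k → α (act swapAC k) ≡ α k
α-swapAC nothing   = refl
α-swapAC (just ta) = refl
α-swapAC (just tb) = refl
α-swapAC (just tc) = refl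

β-swapAC : ∀ k → β (act swapAC k) ≡ β k xor α k
β-swapAC nothing   = refl
β-swapAC (just ta) = refl
β-swapAC (just tb) = refl
β-swapAC (just tc) = refl

α-swapBC : ∀ k → α (act swapBC k) ≡ α k xor β k
α-swapBC nothing   = refl
α-swapBC (just ta) = refl
α-swapBC (just tb) = refl
α-swapBC (just tc) = refl

β-swapBC : ∀ k → β (act swapBC k) ≡ β k
β-swapBC nothing   = refl
β-swapBC (just ta) = refl
β-swapBC (just tb) = refl
β-swapBC (just tc) = refl

infix 4 _⊨_

-- The vector α of `x` is the adjacency matrix applied to β of `x`, so β can be prescribed freely
-- and determines `x`. A record, so that unification recovers `G` and `x` from the type.
record _⊨_ {n} (G : BGraph n) (x : Fin n → K) : Set where
  constructor rows
  field row : ∀ v → α (x v) ≡ sum (λ w → adj G v w ∧ β (x w))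
open _⊨_

⊨-cong : ∀ {n} {G H : BGraph n} {x y : Fin n → K} → (∀ u v → adj G u v ≡ adj H u v) →
         (∀ v → x v ≡ y v) → G ⊨ x → H ⊨ y
⊨-cong p q Gx .row v = trans (cong α (sym (q v))) (trans (row Gx v)
  (sum-cong-≗ λ w → cong₂ _∧_ (p v w) (cong β (q w))))

⊨-zero : ∀ {n} (G : BGraph n) → G ⊨ λ _ → nothing
⊨-zero G .row v = sym (sum-false _ (λ w → ∧-zeroʳ (adj G v w)))

-- The permutation of the nonzero elements of `K` at `v` that carries the isotropic system of `G` to
-- that of `lc G u`.
localPerm : ∀ {n} → BGraph n → Fin n → Fin n → Perm
localPerm G u v = if eqb v u then permAC else if adj G u v then permBC else ↔-id _

data LocalView {n} (G : BGraph n) (u : Fin n) : Fin n → Set where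
  atCentre : LocalView G u u
  atNeighbour : ∀ {v} → v ≢ u → adj G u v ≡ true → localPerm G u v ≡ permBC → LocalView G u v
  elsewhere : ∀ {v} → v ≢ u → adj G u v ≡ false → localPerm G u v ≡ ↔-id _ → LocalView G u v

localPerm-centre : ∀ {n} (G : BGraph n) u → localPerm G u u ≡ permAC
localPerm-centre G u rewrite eqb-refl′ u = refl

localView : ∀ {n} (G : BGraph n) u v → LocalView G u v
localView G u v with v ≟ u
... | yes refl = atCentre
... | no ne with adj G u v in eq
...   | true  = atNeighbour ne eq (trans (cong (λ b → if b then permAC else if adj G u v then permBC else ↔-id _) (eqb-≢ ne)) (cong (λ b → if b then permBC else ↔-id _) eq))
...   | false = elsewhere ne eq (trans (cong (λ b → if b then permAC else if adj G u v then permBC else ↔-id _) (eqb-≢ ne)) (cong (λ b → if b then permBC else ↔-id _) eq))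

lcAdj-off : ∀ {n} (G : BGraph n) u {x y} → x ≢ y → lcAdj G u x y ≡ adj G x y xor (adj G u x ∧ adj G u y)
lcAdj-off G u ne rewrite eqb-≢ ne = refl

-- The last term cancels the loop that complementing the neighbourhood would create. Without a
-- conditional, a row of the new matrix is a sum of three vectors and row sums split linearly.
lcAdj-diag : ∀ {n} (G : BGraph n) u x y →
  lcAdj G u x y ≡ (adj G x y xor (adj G u x ∧ adj G u y)) xor (eqb x y ∧ adj G u x)
lcAdj-diag G u x y with x ≟ y
... | yes refl rewrite adj-irr G x = sym (lem (adj G u x))
  where lem : ∀ b → (b ∧ b) xor b ≡ false
        lem true = refl
        lem false = refl
... | no _ = sym (xor-identityʳ _)

lcAdj-centre : ∀ {n} (G : BGraph n) u v → lcAdj G u u v ≡ adj G u v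
lcAdj-centre G u v with u ≟ v
... | yes refl = sym (adj-irr G u)
... | no _ rewrite adj-irr G u = xor-identityʳ _

lcAdj-involutive : ∀ {n} (G : BGraph n) u x y → lcAdj (lc G u) u x y ≡ adj G x y
lcAdj-involutive G u x y with x ≟ y
... | yes refl = sym (adj-irr G x)
... | no ne rewrite lcAdj-centre G u x | lcAdj-centre G u y =
  truthTable 3 (λ a b c → (a xor (b ∧ c)) xor (b ∧ c)) (λ a b c → a) tt (adj G x y) (adj G u x) (adj G u y)

localPerm-lc : ∀ {n} (G : BGraph n) u v → localPerm (lc G u) u v ≡ localPerm G u v
localPerm-lc G u v rewrite lcAdj-centre G u v = refl

localPerm-from : ∀ {n} (G : BGraph n) u v c → from (localPerm G u v) c ≡ to (localPerm G u v) c
localPerm-from G u v c with eqb v u | adj G u v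
... | true  | _     = refl
... | false | true  = refl
... | false | false = refl

α-local : ∀ {n} (G : BGraph n) u v k →
  α (act (to (localPerm G u v)) k) ≡ α k xor (adj G u v ∧ β k)
α-local G u v k with localView G u v
... | atCentre rewrite localPerm-centre G u | adj-irr G u = trans (α-swapAC k) (sym (xor-identityʳ _))
... | atNeighbour _ e p rewrite p | e = α-swapBC k
... | elsewhere _ e p rewrite p | e = trans (cong α (act-id k)) (sym (xor-identityʳ _))

β-local : ∀ {n} (G : BGraph n) u v k →
  β (act (to (localPerm G u v)) k) ≡ β k xor (eqb v u ∧ α k)
β-local G u v k with localView G u v
... | atCentre rewrite localPerm-centre G u | eqb-refl′ u = β-swapAC k
... | atNeighbour ne e p rewrite p | eqb-≢ ne = trans (β-swapBC k) (sym (xor-identityʳ _))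
... | elsewhere ne e p rewrite p | eqb-≢ ne = trans (cong β (act-id k)) (sym (xor-identityʳ _))

-- By `lcAdj-diag`, row `v` of the new matrix is the old row `v` plus, when `v` is adjacent to `u`,
-- the old row `u` and the unit vector at `v`. As β changes only at `u`, where it gains α, the first
-- two sums share the term coming from α at `u`; it cancels, and what remains is the new α at `v`.
⊨-lc : ∀ {n} (G : BGraph n) u {x} → G ⊨ x → lc G u ⊨ λ v → act (to (localPerm G u v)) (x v)
⊨-lc {n} G u {x} Gx .row v = begin
  α (act (to (localPerm G u v)) (x v))      ≡⟨ α-local G u v (x v) ⟩
  α (x v) xor (adj G u v ∧ β (x v))         ≡⟨ cong (α (x v) xor_) local ⟩
  α (x v) xor (s₂ xor (uv ∧ β′ v) xor (uv ∧ α (x u)))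
    ≡⟨ truthTable 4 (λ a b c d → a xor (b xor c xor d)) (λ a b c d → (a xor d) xor (b xor c)) tt (α (x v)) s₂ (uv ∧ β′ v) (uv ∧ α (x u)) ⟩
  (α (x v) xor (uv ∧ α (x u))) xor (s₂ xor (uv ∧ β′ v))
    ≡⟨ sym (cong₂ (λ a b → a xor (s₂ xor b)) s₁≡ s₃≡) ⟩
  s₁ xor (s₂ xor s₃)
    ≡⟨ truthTable 3 (λ a b c → a xor (b xor c)) (λ a b c → (a xor b) xor c) tt s₁ s₂ s₃ ⟩
  (s₁ xor s₂) xor s₃
    ≡⟨ cong (_xor s₃) (sym (∑-distrib-+ (λ w → adj G v w ∧ β′ w) (λ w → (uv ∧ adj G u w) ∧ β′ w))) ⟩
  sum (λ w → (adj G v w ∧ β′ w) xor ((uv ∧ adj G u w) ∧ β′ w)) xor s₃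
    ≡⟨ sym (∑-distrib-+ (λ w → (adj G v w ∧ β′ w) xor ((uv ∧ adj G u w) ∧ β′ w)) (λ w → (eqb v w ∧ uv) ∧ β′ w)) ⟩
  sum (λ w → ((adj G v w ∧ β′ w) xor ((uv ∧ adj G u w) ∧ β′ w)) xor ((eqb v w ∧ uv) ∧ β′ w))
    ≡⟨ sum-cong-≗ (λ w → trans
         (truthTable 4 (λ a b c d → ((a ∧ d) xor (b ∧ d)) xor (c ∧ d)) (λ a b c d → ((a xor b) xor c) ∧ d) tt (adj G v w) (uv ∧ adj G u w) (eqb v w ∧ uv) (β′ w))
         (cong (_∧ β′ w) (sym (lcAdj-diag G u v w)))) ⟩
  sum (λ w → lcAdj G u v w ∧ β′ w) ∎
  where
  open ≡-Reasoning
  uv : Bool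
  uv = adj G u v
  β′ : Fin n → Bool
  β′ w = β (act (to (localPerm G u w)) (x w))
  s₁ s₂ s₃ : Bool
  s₁ = sum (λ w → adj G v w ∧ β′ w)
  s₂ = sum (λ w → (uv ∧ adj G u w) ∧ β′ w)
  s₃ = sum (λ w → (eqb v w ∧ uv) ∧ β′ w)
  row′ : ∀ v → sum (λ w → adj G v w ∧ β′ w) ≡ α (x v) xor (adj G v u ∧ α (x u))
  row′ v = begin
    sum (λ w → adj G v w ∧ β′ w)
      ≡⟨ sum-cong-≗ (λ w → trans (cong (adj G v w ∧_) (β-local G u w (x w)))
           (truthTable 3 (λ a b c → a ∧ (b xor c)) (λ a b c → (a ∧ b) xor (a ∧ c)) tt (adj G v w) (β (x w)) (eqb w u ∧ α (x w)))) ⟩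
    sum (λ w → (adj G v w ∧ β (x w)) xor (adj G v w ∧ (eqb w u ∧ α (x w))))
      ≡⟨ ∑-distrib-+ (λ w → adj G v w ∧ β (x w)) (λ w → adj G v w ∧ (eqb w u ∧ α (x w))) ⟩
    sum (λ w → adj G v w ∧ β (x w)) xor sum (λ w → adj G v w ∧ (eqb w u ∧ α (x w)))
      ≡⟨ cong₂ _xor_ (sym (row Gx v)) (trans (sum-delta _ u (λ w ne → trans (cong (λ b → adj G v w ∧ (b ∧ α (x w))) (eqb-≢ ne)) (∧-zeroʳ (adj G v w))))
           (cong (λ b → adj G v u ∧ (b ∧ α (x u))) (eqb-refl′ u))) ⟩
    α (x v) xor (adj G v u ∧ α (x u)) ∎
  s₁≡ : s₁ ≡ α (x v) xor (uv ∧ α (x u))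
  s₁≡ = trans (row′ v) (cong (λ b → α (x v) xor (b ∧ α (x u))) (adj-sym G v u))
  s₂≡ : s₂ ≡ uv ∧ α (x u)
  s₂≡ = begin
    s₂ ≡⟨ sum-cong-≗ (λ w → ∧-assoc uv (adj G u w) (β′ w)) ⟩
    sum (λ w → uv ∧ (adj G u w ∧ β′ w)) ≡⟨ sym (*-distribˡ-sum uv (λ w → adj G u w ∧ β′ w)) ⟩
    uv ∧ sum (λ w → adj G u w ∧ β′ w) ≡⟨ cong (uv ∧_) (row′ u) ⟩
    uv ∧ (α (x u) xor (adj G u u ∧ α (x u))) ≡⟨ cong (λ b → uv ∧ (α (x u) xor (b ∧ α (x u)))) (adj-irr G u) ⟩
    uv ∧ (α (x u) xor false) ≡⟨ cong (uv ∧_) (xor-identityʳ _) ⟩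
    uv ∧ α (x u) ∎
  s₃≡ : s₃ ≡ uv ∧ β′ v
  s₃≡ = trans (sum-delta _ v (λ w ne → cong (λ b → (b ∧ uv) ∧ β′ w) (eqb-≢ (ne ∘ sym))))
              (cong (λ b → (b ∧ uv) ∧ β′ v) (eqb-refl′ v))
  unmoved : uv ∧ β′ v ≡ uv ∧ β (x v)
  unmoved = trans (cong (uv ∧_) (β-local G u v (x v))) aux
    where
    aux : uv ∧ (β (x v) xor (eqb v u ∧ α (x v))) ≡ uv ∧ β (x v)
    aux with v ≟ u
    ... | yes refl rewrite adj-irr G u = refl
    ... | no _ = cong (uv ∧_) (xor-identityʳ _)
  local : adj G u v ∧ β (x v) ≡ s₂ xor (uv ∧ β′ v) xor (uv ∧ α (x u))
  local = begin
    uv ∧ β (x v) ≡⟨ sym unmoved ⟩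
    uv ∧ β′ v ≡⟨ truthTable 2 (λ a b → a) (λ a b → b xor a xor b) tt (uv ∧ β′ v) (uv ∧ α (x u)) ⟩
    (uv ∧ α (x u)) xor (uv ∧ β′ v) xor (uv ∧ α (x u)) ≡⟨ cong (_xor ((uv ∧ β′ v) xor (uv ∧ α (x u)))) (sym s₂≡) ⟩
    s₂ xor (uv ∧ β′ v) xor (uv ∧ α (x u)) ∎

-- Local complementation as a local permutation of the transitions

infix 4 _≼_

_≼_ : K → Transition → Set
k ≼ c = k ≡ nothing ⊎ k ≡ just c

act-≼ : ∀ {f k c} → k ≼ c → act f k ≼ f c
act-≼ (inj₁ refl) = inj₁ refl
act-≼ (inj₂ refl) = inj₂ refl

Covers : ∀ {n} → BGraph n → (Fin n → Transition) → Set
Covers {n} G c = ∀ v → Σ (Fin n → K) λ x → G ⊨ x × (∀ w → x w ≼ c w) × x v ≢ nothing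

Cover : ∀ {n} → BGraph n → (Fin n → Transition) → Set
Cover {n} G t = Σ (Fin n → Transition) λ c → (∀ v → c v ≢ t v) × Covers G c

-- The tags travel with the permutations, so covers avoiding them can be transported. `bwd` is a
-- field because deriving it from `fwd` would take a dimension count.
record LocEq {n} (G : BGraph n) (t : Fin n → Transition) (H : BGraph n) (s : Fin n → Transition) : Set where
  field
    ψ   : Fin n → Perm
    fwd : ∀ {x} → G ⊨ x → H ⊨ λ v → act (to (ψ v)) (x v)
    bwd : ∀ {y} → H ⊨ y → G ⊨ λ v → act (from (ψ v)) (y v)
    tag : ∀ v → s v ≡ to (ψ v) (t v)
open LocEq

act-∘ : ∀ {f g : Transition → Transition} k → act f (act g k) ≡ act (λ c → f (g c)) k
act-∘ nothing  = refl
act-∘ (just c) = refl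

module _ {n} {G H : BGraph n} {r s : Fin n → Transition} where

  LocEq-sym : LocEq G r H s → LocEq H s G r
  LocEq-sym e = record
    { ψ = λ v → ↔-sym (ψ e v) ; fwd = bwd e ; bwd = fwd e
    ; tag = λ v → trans (sym (from-to (ψ e v) (r v))) (cong (from (ψ e v)) (sym (tag e v))) }

  LocEq-trans : ∀ {J t} → LocEq G r H s → LocEq H s J t → LocEq G r J t
  LocEq-trans d e = record
    { ψ = λ v → ψ e v ↔-∘ ψ d v
    ; fwd = λ {x} Gx → ⊨-cong (λ _ _ → refl) (λ v → act-∘ (x v)) (fwd e (fwd d Gx))
    ; bwd = λ {x} Jx → ⊨-cong (λ _ _ → refl) (λ v → act-∘ (x v)) (bwd d (bwd e Jx))
    ; tag = λ v → trans (tag e v) (cong (to (ψ e v)) (tag d v)) }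

  ≗-LocEq : (∀ u v → adj G u v ≡ adj H u v) → (∀ v → s v ≡ r v) → LocEq G r H s
  ≗-LocEq p q = record
    { ψ = λ _ → ↔-id _
    ; fwd = λ {x} → ⊨-cong p (λ v → sym (act-id (x v)))
    ; bwd = λ {x} → ⊨-cong (λ u v → sym (p u v)) (λ v → sym (act-id (x v)))
    ; tag = q }

  Cover-LocEq : LocEq G r H s → Cover G r → Cover H s
  Cover-LocEq e (c , adm , cov) = (λ v → to (ψ e v) (c v)) ,
    (λ v p → adm v (to-injective (ψ e v) (trans p (tag e v)))) ,
    λ v → let (x , Gx , x≼c , nz) = cov v in
      _ , fwd e Gx , (λ w → act-≼ (x≼c w)) , act-nonzero (x v) nz

lc-LocEq : ∀ {n} (G : BGraph n) u t → LocEq G t (lc G u) (λ v → to (localPerm G u v) (t v))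
lc-LocEq G u t = record
  { ψ = localPerm G u
  ; fwd = ⊨-lc G u
  ; bwd = λ {y} Hy → ⊨-cong (lcAdj-involutive G u)
      (λ v → trans (cong (λ p → act (to p) (y v)) (localPerm-lc G u v)) (act-≗ (λ c → sym (localPerm-from G u v c)) (y v)))
      (⊨-lc (lc G u) u Hy)
  ; tag = λ _ → refl }
  where
  act-≗ : ∀ {f g : Transition → Transition} → (∀ c → f c ≡ g c) → ∀ k → act f k ≡ act g k
  act-≗ p nothing  = refl
  act-≗ p (just c) = cong just (p c)

-- The tag of a vertex is its forbidden transition.
code : Colour → Transition
code white = tb
code black = tc

tagOf : ∀ {n} → BGraph n → Fin n → Transition
tagOf G v = code (colour G v)

lcColour-black : ∀ {n} (G : BGraph n) u → colour G u ≡ black → ∀ v → lcColour G u v ≡ colour G v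
lcColour-black G u p v with colour G u | adj G u v
lcColour-black G u () v | white | _
... | black | true  = refl
... | black | false = refl

-- At a white `u` the tag `tb` is fixed by `swapAC`; at a neighbour `swapBC` exchanges the codes of
-- white and black, which is exactly the recolouring.
tagOf-white : ∀ {n} (G : BGraph n) u → colour G u ≡ white → ∀ v → tagOf (lc G u) v ≡ to (localPerm G u v) (tagOf G v)
tagOf-white G u p v with localView G u v
... | atCentre rewrite localPerm-centre G u | p | adj-irr G u = cong code p
... | atNeighbour _ e q rewrite q | p | e = flip-code (colour G v)
  where
  flip-code : ∀ c → code (flipC c) ≡ swapBC (code c)
  flip-code black = refl
  flip-code white = refl
... | elsewhere _ e q rewrite q | p | e = refl

lc-white-LocEq : ∀ {n} (G : BGraph n) u → colour G u ≡ white → LocEq G (tagOf G) (lc G u) (tagOf (lc G u))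
lc-white-LocEq G u p = LocEq-trans (lc-LocEq G u _) (≗-LocEq (λ _ _ → refl) (tagOf-white G u p))

pivot : ∀ {n} → BGraph n → Fin n → Fin n → BGraph n
pivot G u v = lc (lc (lc G u) v) u

adjacent-≢ : ∀ {n} (G : BGraph n) {u v} → adj G u v ≡ true → u ≢ v
adjacent-≢ G e refl = true≢false e (adj-irr G _)

-- A single complementation at a black `u` would move its tag `tc` to `ta`, which codes no colour.
-- Over the whole pivot the tag of `u` runs through `tc`, `ta`, `ta`, `tc` and that of `v` through
-- `tc`, `tb`, `tb`, `tc`. Any other vertex meets `swapBC` an even number of times.
pivot-tag : ∀ {n} (G : BGraph n) u v → colour G u ≡ black → colour G v ≡ black → adj G u v ≡ true → ∀ w →
  tagOf (pivot G u v) w ≡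
  to (localPerm (lc (lc G u) v) u w) (to (localPerm (lc G u) v w) (to (localPerm G u w) (tagOf G w)))
pivot-tag G u v bu bv e w = trans (cong code (colour-pivot w)) (sym (go w))
  where
  G₁ = lc G u
  G₂ = lc G₁ v
  colour₁ : ∀ w → colour G₁ w ≡ colour G w
  colour₁ = lcColour-black G u bu
  colour₂ : ∀ w → colour G₂ w ≡ colour G w
  colour₂ w = trans (lcColour-black G₁ v (trans (colour₁ v) bv) w) (colour₁ w)
  colour-pivot : ∀ w → colour (lc G₂ u) w ≡ colour G w
  colour-pivot w = trans (lcColour-black G₂ u (trans (colour₂ u) bu) w) (colour₂ w)
  edge₁ : adj G₁ v u ≡ true
  edge₁ = trans (adj-sym G₁ v u) (trans (lcAdj-centre G u v) e)
  edge₂ : adj G₂ u v ≡ true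
  edge₂ = trans (adj-sym G₂ u v) (trans (lcAdj-centre G₁ v u) edge₁)
  at : ∀ {n} (H : BGraph n) a {b} → b ≢ a → localPerm H a b ≡ (if adj H a b then permBC else ↔-id _)
  at H a {b} ne = cong (λ q → if q then permAC else if adj H a b then permBC else ↔-id _) (eqb-≢ ne)
  edge : ∀ {n} (H : BGraph n) a {b} → adj H a b ≡ true → localPerm H a b ≡ permBC
  edge H a {b} p = trans (at H a (λ { refl → adjacent-≢ H p refl })) (cong (λ q → if q then permBC else ↔-id _) p)
  cancel : ∀ a b c → to (if b then permBC else ↔-id _)
    (to (if b xor (true ∧ a) then permBC else ↔-id _) (to (if a then permBC else ↔-id _) c)) ≡ c
  cancel true  true  c = swapBC-involutive c
  cancel true  false c = swapBC-involutive c
  cancel false true  c = swapBC-involutive c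
  cancel false false c = refl
  go : ∀ w → to (localPerm G₂ u w) (to (localPerm G₁ v w) (to (localPerm G u w) (tagOf G w))) ≡ tagOf G w
  go w = by-cases (w ≟ u) (w ≟ v)
    where
    choose : Bool → Perm
    choose q = if q then permBC else ↔-id _
    compose : ∀ {p p′ q q′ r r′ : Perm} {c c′} → p ≡ p′ → q ≡ q′ → r ≡ r′ → c ≡ c′ → to r (to q (to p c)) ≡ to r′ (to q′ (to p′ c′))
    compose refl refl refl refl = refl
    by-cases : Dec (w ≡ u) → Dec (w ≡ v) →
      to (localPerm G₂ u w) (to (localPerm G₁ v w) (to (localPerm G u w) (tagOf G w))) ≡ tagOf G w
    by-cases (yes refl) _ = trans
      (compose (localPerm-centre G u) (edge G₁ v edge₁) (localPerm-centre G₂ u) (cong code bu)) (sym (cong code bu))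
    by-cases (no _) (yes refl) = trans
      (compose (edge G u e) (localPerm-centre G₁ v) (edge G₂ u edge₂) (cong code bv)) (sym (cong code bv))
    by-cases (no w≢u) (no w≢v) = trans
      (compose (at G u w≢u) (trans (at G₁ v w≢v) (cong choose adj₁)) (trans (at G₂ u w≢u) (cong choose adj₂)) refl)
      (cancel (adj G u w) (adj G v w) (tagOf G w))
      where
      adj₁ : adj G₁ v w ≡ adj G v w xor (true ∧ adj G u w)
      adj₁ = trans (lcAdj-off G u (w≢v ∘ sym)) (cong (λ q → adj G v w xor (q ∧ adj G u w)) e)
      adj₂ : adj G₂ u w ≡ adj G v w
      adj₂ = trans (lcAdj-off G₁ v (w≢u ∘ sym)) (trans
        (cong₂ _xor_ (lcAdj-centre G u w) (cong₂ _∧_ edge₁ adj₁))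
        (truthTable 2 (λ a b → a xor (b xor a)) (λ a b → b) tt (adj G u w) (adj G v w)))

pivot-LocEq : ∀ {n} (G : BGraph n) u v → colour G u ≡ black → colour G v ≡ black → adj G u v ≡ true →
  LocEq G (tagOf G) (pivot G u v) (tagOf (pivot G u v))
pivot-LocEq G u v bu bv e =
  LocEq-trans (lc-LocEq G u _) (LocEq-trans (lc-LocEq (lc G u) v _) (LocEq-trans (lc-LocEq (lc (lc G u) v) u _)
    (≗-LocEq (λ _ _ → refl) (pivot-tag G u v bu bv e))))

applyW-LocEq : ∀ {n} {G : BGraph n} {s} → ParityWord G s → LocEq G (tagOf G) (applyW G s) (tagOf (applyW G s))
applyW-LocEq empty = ≗-LocEq (λ _ _ → refl) (λ _ → refl)
applyW-LocEq {G = G} (whiteStep {s} u pw p) =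
  subst (λ H → LocEq G (tagOf G) H (tagOf H)) (sym (foldl-++ lc G s (u ∷ [])))
    (LocEq-trans (applyW-LocEq pw) (lc-white-LocEq (applyW G s) u p))
applyW-LocEq {G = G} (pivotUV {s} u v pw bu bv e) =
  subst (λ H → LocEq G (tagOf G) H (tagOf H)) (sym (foldl-++ lc G s (u ∷ v ∷ u ∷ [])))
    (LocEq-trans (applyW-LocEq pw) (pivot-LocEq (applyW G s) u v bu bv e))
applyW-LocEq {G = G} (pivotVU {s} u v pw bu bv e) =
  subst (λ H → LocEq G (tagOf G) H (tagOf H)) (sym (foldl-++ lc G s (v ∷ u ∷ v ∷ [])))
    (LocEq-trans (applyW-LocEq pw) (pivot-LocEq (applyW G s) v u bv bu (trans (adj-sym (applyW G s) v u) e)))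

-- Purity in terms of the isotropic system

_≟ᵗ_ : ∀ (c d : Transition) → Dec (c ≡ d)
ta ≟ᵗ ta = yes refl
ta ≟ᵗ tb = no λ ()
ta ≟ᵗ tc = no λ ()
tb ≟ᵗ ta = no λ ()
tb ≟ᵗ tb = yes refl
tb ≟ᵗ tc = no λ ()
tc ≟ᵗ ta = no λ ()
tc ≟ᵗ tb = no λ ()
tc ≟ᵗ tc = yes refl

white? : ∀ c → Dec (c ≡ white)
white? white = yes refl
white? black = no λ ()

≢white⇒black : ∀ {c} → c ≢ white → c ≡ black
≢white⇒black {white} ne = ⊥-elim (ne refl)
≢white⇒black {black} ne = refl

weight : ∀ {n} → (Fin n → Transition) → ℕ
weight {zero}  c = 0
weight {suc n} c with c zero ≟ᵗ ta
... | yes _ = weight (c ∘ suc)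
... | no  _ = suc (weight (c ∘ suc))

weight-mono : ∀ {n} {c d : Fin n → Transition} → (∀ w → c w ≡ ta → d w ≡ ta) → weight d ≤ weight c
weight-mono {zero} p = z≤n
weight-mono {suc n} {c} {d} p with c zero ≟ᵗ ta | d zero ≟ᵗ ta
... | yes _ | yes _ = weight-mono (p ∘ suc)
... | yes q | no ne = ⊥-elim (ne (p zero q))
... | no _  | yes _ = ℕ.m≤n⇒m≤1+n (weight-mono (p ∘ suc))
... | no _  | no _  = s≤s (weight-mono (p ∘ suc))

weight-< : ∀ {n} {c d : Fin n → Transition} → (∀ w → c w ≡ ta → d w ≡ ta) → ∀ u → c u ≢ ta → d u ≡ ta → weight d < weight c
weight-< {suc n} {c} {d} p zero cu du with c zero ≟ᵗ ta | d zero ≟ᵗ ta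
... | yes q | _ = ⊥-elim (cu q)
... | no _  | no ne = ⊥-elim (ne du)
... | no _  | yes _ = s≤s (weight-mono (p ∘ suc))
weight-< {suc n} {c} {d} p (suc u) cu du with c zero ≟ᵗ ta | d zero ≟ᵗ ta
... | yes _ | yes _ = weight-< (p ∘ suc) u cu du
... | yes q | no ne = ⊥-elim (ne (p zero q))
... | no _  | yes _ = ℕ.m≤n⇒m≤1+n (weight-< (p ∘ suc) u cu du)
... | no _  | no _  = s≤s (weight-< (p ∘ suc) u cu du)

localPerm-ta : ∀ {n} (G : BGraph n) u {w} → w ≢ u → to (localPerm G u w) ta ≡ ta
localPerm-ta G u {w} ne with localView G u w
... | atCentre = ⊥-elim (ne refl)
... | atNeighbour _ _ p rewrite p = refl
... | elsewhere _ _ p rewrite p = refl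

localPerm-edge : ∀ {n} (G : BGraph n) u {w} → adj G u w ≡ true → localPerm G u w ≡ permBC
localPerm-edge G u {w} e with localView G u w
... | atCentre = ⊥-elim (adjacent-≢ G e refl)
... | atNeighbour _ _ p = p
... | elsewhere _ e′ _ = ⊥-elim (true≢false e e′)

pivot-ta : ∀ {n} (G : BGraph n) u v w → w ≢ u → w ≢ v →
  to (localPerm (lc (lc G u) v) u w) (to (localPerm (lc G u) v w) (to (localPerm G u w) ta)) ≡ ta
pivot-ta G u v w w≢u w≢v = trans
  (cong (λ c → to (localPerm (lc (lc G u) v) u w) (to (localPerm (lc G u) v w) c)) (localPerm-ta G u w≢u)) (trans
  (cong (to (localPerm (lc (lc G u) v) u w)) (localPerm-ta (lc G u) v w≢v))
  (localPerm-ta (lc (lc G u) v) u w≢u))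

pivot-tb-centre : ∀ {n} (G : BGraph n) u v → adj G u v ≡ true →
  to (localPerm (lc (lc G u) v) u u) (to (localPerm (lc G u) v u) (to (localPerm G u u) tb)) ≡ ta
pivot-tb-centre G u v e
  rewrite localPerm-centre G u
        | localPerm-edge (lc G u) v {u} (trans (adj-sym (lc G u) v u) (trans (lcAdj-centre G u v) e))
        | localPerm-centre (lc (lc G u) v) u = refl

pivot-tb-neighbour : ∀ {n} (G : BGraph n) u v → adj G u v ≡ true →
  to (localPerm (lc (lc G u) v) u v) (to (localPerm (lc G u) v v) (to (localPerm G u v) tb)) ≡ ta
pivot-tb-neighbour G u v e
  rewrite localPerm-edge G u e | localPerm-centre (lc G u) v
        | localPerm-edge (lc (lc G u) v) u {v} (trans (adj-sym (lc (lc G u) v) u v) (trans (lcAdj-centre (lc G u) v u)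
            (trans (adj-sym (lc G u) v u) (trans (lcAdj-centre G u v) e)))) = refl

-- A vertex outside the set takes the value `ta` in some member, so its row sum is odd and it has a
-- neighbour where β is true. There `c` is not `ta`, so the neighbour lies in the set and the vertex
-- cannot be added.
terminal : ∀ {n} (G : BGraph n) (c : Fin n → Transition) → Covers G c → (∀ u → c u ≢ ta → c u ≡ tb) →
  (∀ u v → c u ≢ ta → c v ≢ ta → adj G u v ≡ false) → Σ (Fin n → Bool) λ S → Anticlique G S × (∀ u → S u ≡ true → c u ≢ ta)
terminal {n} G c cov isB indep = S , (ind , maximal) , λ u → S⁻ (c u ≟ᵗ ta)
  where
  S? : ∀ {d} → Dec (d ≡ ta) → Bool
  S? (yes _) = false
  S? (no _)  = true
  S : Fin n → Bool
  S u = S? (c u ≟ᵗ ta)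
  S⁻ : ∀ {d} (q : Dec (d ≡ ta)) → S? q ≡ true → d ≢ ta
  S⁻ (no ne) _ = ne
  S⁺ : ∀ {d} (q : Dec (d ≡ ta)) → d ≢ ta → S? q ≡ true
  S⁺ (yes p) ne = ⊥-elim (ne p)
  S⁺ (no _) _ = refl
  ind : Independent G S
  ind u v p q = indep u v (S⁻ (c u ≟ᵗ ta) p) (S⁻ (c v ≟ᵗ ta) q)
  maximal : ∀ T → Independent G T → (∀ u → S u ≡ true → T u ≡ true) → ∀ u → T u ≡ true → S u ≡ true
  maximal T indT S⊆T u Tu = S⁺ (c u ≟ᵗ ta) λ cu → go cu (cov u)
    where
    go : c u ≡ ta → ¬ Σ (Fin n → K) λ x → G ⊨ x × (∀ w → x w ≼ c w) × x u ≢ nothing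
    go cu (x , Gx , x≼c , nz) with x≼c u
    ... | inj₁ xu = nz xu
    ... | inj₂ xu =
      let (w , e) = sum-true⁻ _ (trans (sym (row Gx u)) (trans (cong α xu) (cong (α ∘ just) cu)))
          (uw , bw) = ∧-true⁻ e
      in true≢false uw (indT u w Tu (S⊆T w (S⁺ (c w ≟ᵗ ta) λ cw → β-ta cw (x≼c w) bw)))
      where
      β-ta : ∀ {k d} → d ≡ ta → k ≼ d → β k ≡ true → ⊥
      β-ta refl (inj₁ refl) ()
      β-ta refl (inj₂ refl) ()

module _ {n} (G : BGraph n) where

  -- A pivot at vertices with c ≢ ta makes c agree with ta there, so the weight drops; when
  -- no pivot is left, the vertices with c ≢ ta form a black anticlique.
  pure⇒¬cover : Pure G → ¬ Cover G (tagOf G)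
  pure⇒¬cover pure (c , adm , cov) = descend [] empty c adm cov (<-wellFounded _)
    where
    descend : ∀ s → ParityWord G s → ∀ c → (∀ v → c v ≢ tagOf (applyW G s) v) → Covers (applyW G s) c →
      Acc _<_ (weight c) → ⊥
    descend s pw c adm cov (acc rec) = step (any? λ u → white? (colour H u) ×-dec ¬? (c u ≟ᵗ ta))
      where
      H = applyW G s
      continue : ∀ s′ → ParityWord G (s ++ s′) → (e : LocEq H (tagOf H) (applyW H s′) (tagOf (applyW H s′))) →
        weight (λ v → to (ψ e v) (c v)) < weight c → ⊥
      continue s′ pw′ e lt = let (_ , adm′ , cov′) = Cover-LocEq e (c , adm , cov) in
        descend (s ++ s′) pw′ _
          (subst (λ J → ∀ v → to (ψ e v) (c v) ≢ tagOf J v) (sym (foldl-++ lc G s s′)) adm′)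
          (subst (λ J → Covers J (λ v → to (ψ e v) (c v))) (sym (foldl-++ lc G s s′)) cov′)
          (rec lt)
      -- White vertices are removed before edges: once none is left with `c` other than `ta`, all
      -- such vertices are black, their value is `tb`, and a pivot on an edge between them is a
      -- legal parity step.
      step : Dec (∃ λ u → colour H u ≡ white × c u ≢ ta) → ⊥
      step (yes (u , wu , cu)) = continue (u ∷ []) (whiteStep u pw wu) (lc-white-LocEq H u wu)
        (weight-< mono u cu centre)
        where
        centre : to (localPerm H u u) (c u) ≡ ta
        centre = trans (cong (λ p → to p (c u)) (localPerm-centre H u)) (only-tc (c u) cu λ p → adm u (trans p (cong code (sym wu))))
          where
          only-tc : ∀ d → d ≢ ta → d ≢ tb → swapAC d ≡ ta
          only-tc ta p _ = ⊥-elim (p refl)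
          only-tc tb _ q = ⊥-elim (q refl)
          only-tc tc _ _ = refl
        mono : ∀ w → c w ≡ ta → to (localPerm H u w) (c w) ≡ ta
        mono w cw = trans (cong (to (localPerm H u w)) cw) (localPerm-ta H u {w} λ { refl → cu cw })
      step (no allBlack) = step′ (any? λ u → any? λ v → ¬? (c u ≟ᵗ ta) ×-dec ¬? (c v ≟ᵗ ta) ×-dec (adj H u v Bool.≟ true))
        where
        isBlack : ∀ u → c u ≢ ta → colour H u ≡ black
        isBlack u cu = ≢white⇒black λ wu → allBlack (u , wu , cu)
        isB : ∀ u → c u ≢ ta → c u ≡ tb
        isB u cu = only-tb (c u) cu λ p → adm u (trans p (cong code (sym (isBlack u cu))))
          where
          only-tb : ∀ d → d ≢ ta → d ≢ tc → d ≡ tb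
          only-tb ta p _ = ⊥-elim (p refl)
          only-tb tb _ _ = refl
          only-tb tc _ q = ⊥-elim (q refl)
        step′ : Dec (∃ λ u → ∃ λ v → c u ≢ ta × c v ≢ ta × adj H u v ≡ true) → ⊥
        step′ (yes (u , v , cu , cv , e)) =
          continue (u ∷ v ∷ u ∷ []) (pivotUV u v pw (isBlack u cu) (isBlack v cv) e)
            (pivot-LocEq H u v (isBlack u cu) (isBlack v cv) e)
            (weight-< mono u cu (trans (cong perm (isB u cu)) (pivot-tb-centre H u v e)))
          where
          perm : Transition → Transition
          perm d = to (localPerm (lc (lc H u) v) u u) (to (localPerm (lc H u) v u) (to (localPerm H u u) d))
          mono : ∀ w → c w ≡ ta →
            to (localPerm (lc (lc H u) v) u w) (to (localPerm (lc H u) v w) (to (localPerm H u w) (c w))) ≡ ta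
          mono w cw = trans (cong (λ d → to (localPerm (lc (lc H u) v) u w) (to (localPerm (lc H u) v w) (to (localPerm H u w) d))) cw)
            (pivot-ta H u v w (λ { refl → cu cw }) (λ { refl → cv cw }))
        step′ (no noEdge) =
          let (S , anti , S⊆c) = terminal′ in
          pure H (s , pw , (λ _ _ → refl) , λ _ → refl) S anti λ u Su → isBlack u (S⊆c u Su)
          where
          terminal′ : Σ (Fin n → Bool) λ S → Anticlique H S × (∀ u → S u ≡ true → c u ≢ ta)
          terminal′ = terminal H c cov isB (λ u v cu cv → ≢true⇒≡false λ e → noEdge (u , v , cu , cv , e))

  -- Take `tb` on `S`, allowed there because `S` is black, and `ta` elsewhere. The basis vector of a
  -- vertex of `S` respects this choice, as its neighbours lie outside `S`. By maximality these
  -- vectors reach every vertex.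
  anticlique-cover : ∀ S → Anticlique G S → (∀ u → S u ≡ true → colour G u ≡ black) → Cover G (tagOf G)
  anticlique-cover S (ind , maximal) blackS = c , adm , cov
    where
    c : Fin n → Transition
    c v = if S v then tb else ta
    adm : ∀ v → c v ≢ tagOf G v
    adm v with S v in Sv
    ... | true  = λ p → tb≢code (blackS v Sv) p
      where
      tb≢code : ∀ {d} → d ≡ black → tb ≢ code d
      tb≢code refl ()
    ... | false = ta≢code (colour G v)
      where
      ta≢code : ∀ d → ta ≢ code d
      ta≢code white ()
      ta≢code black ()
    basis : Fin n → Fin n → K
    basis s w = fromBits (adj G w s) (eqb w s)
    basis-⊨ : ∀ s → G ⊨ basis s
    basis-⊨ s .row v = trans (α-fromBits (adj G v s) (eqb v s)) (sym (trans
      (sum-delta _ s λ w ne → trans (cong (adj G v w ∧_) (trans (β-fromBits (adj G w s) (eqb w s)) (eqb-≢ ne))) (∧-zeroʳ _))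
      (trans (cong (adj G v s ∧_) (trans (β-fromBits (adj G s s) (eqb s s)) (eqb-refl′ s))) (∧-identityʳ _))))
      where open import Data.Bool.Properties using (∧-identityʳ)
    basis-≼ : ∀ s → S s ≡ true → ∀ w → basis s w ≼ c w
    basis-≼ s Ss w with w ≟ s
    ... | yes refl rewrite adj-irr G s | Ss = inj₂ refl
    ... | no _ with S w in Sw
    ...   | true rewrite ind w s Sw Ss = inj₁ refl
    ...   | false with adj G w s
    ...     | true  = inj₂ refl
    ...     | false = inj₁ refl
    covered : ∀ v s → S s ≡ true → (eqb v s ≡ true) ⊎ (adj G v s ≡ true) →
      Σ (Fin n → K) λ x → G ⊨ x × (∀ w → x w ≼ c w) × x v ≢ nothing
    covered v s Ss p = basis s , basis-⊨ s , basis-≼ s Ss , nz p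
      where
      nz : (eqb v s ≡ true) ⊎ (adj G v s ≡ true) → basis s v ≢ nothing
      nz (inj₁ q) r = true≢false q (trans (sym (β-fromBits (adj G v s) (eqb v s))) (cong β r))
      nz (inj₂ q) r = true≢false q (trans (sym (α-fromBits (adj G v s) (eqb v s))) (cong α r))
    cov : Covers G c
    cov v with S v in Sv
    ... | true = covered v v Sv (inj₁ (eqb-refl′ v))
    ... | false with any? (λ s → (S s Bool.≟ true) ×-dec (adj G v s Bool.≟ true))
    ...   | yes (s , Ss , e) = covered v s Ss (inj₂ e)
    ...   | no none = ⊥-elim (true≢false (maximal S⁺ indep (λ u Su → ∨-true (inj₁ Su)) v (∨-true (inj₂ (eqb-refl′ v)))) Sv)
      where
      S⁺ : Fin n → Bool
      S⁺ u = S u ∨ eqb u v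
      ∨-true : ∀ {a b} → a ≡ true ⊎ b ≡ true → a ∨ b ≡ true
      ∨-true {true} _ = refl
      ∨-true {false} (inj₂ q) = q
      ∨-true⁻ : ∀ {a b} → a ∨ b ≡ true → a ≡ true ⊎ b ≡ true
      ∨-true⁻ {true} _ = inj₁ refl
      ∨-true⁻ {false} q = inj₂ q
      no-v : ∀ s → S s ≡ true → adj G v s ≡ false
      no-v s Ss = ≢true⇒≡false λ e → none (s , Ss , e)
      indep : Independent G S⁺
      indep a b Ta Tb with ∨-true⁻ {S a} Ta | ∨-true⁻ {S b} Tb
      ... | inj₁ Sa | inj₁ Sb = ind a b Sa Sb
      ... | inj₁ Sa | inj₂ q rewrite eqb-true⁻ {x = b} q = trans (adj-sym G a v) (no-v a Sa)
      ... | inj₂ p | inj₁ Sb rewrite eqb-true⁻ {x = a} p = no-v b Sb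
      ... | inj₂ p | inj₂ q rewrite eqb-true⁻ {x = a} p | eqb-true⁻ {x = b} q = adj-irr G v

¬cover⇒pure : ∀ {n} {G : BGraph n} → ¬ Cover G (tagOf G) → Pure G
¬cover⇒pure {G = G} none H (s , pw , adj≗ , colour≗) S anti blackS =
  none (Cover-LocEq (LocEq-sym (applyW-LocEq pw))
    (Cover-LocEq (≗-LocEq (λ u v → sym (adj≗ u v)) (λ v → cong code (colour≗ v)))
      (anticlique-cover H S anti blackS)))

-- Rooted graphs

-- The alternating form of the Klein group: true exactly on two distinct nonzero elements.
ω : K → K → Bool
ω k l = (α k ∧ β l) xor (β k ∧ α l)

-- Expanding α by the row equations turns the two halves of the form into the same double sum,
-- because the adjacency matrix is symmetric.
isotropic : ∀ {n} (G : BGraph n) {x y} → G ⊨ x → G ⊨ y → sum (λ v → ω (x v) (y v)) ≡ false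
isotropic {n} G {x} {y} Gx Gy = begin
  sum (λ v → ω (x v) (y v))
    ≡⟨ ∑-distrib-+ (λ v → α (x v) ∧ β (y v)) (λ v → β (x v) ∧ α (y v)) ⟩
  sum (λ v → α (x v) ∧ β (y v)) xor sum (λ v → β (x v) ∧ α (y v))
    ≡⟨ cong₂ _xor_ lhs rhs ⟩
  sum (λ v → sum (λ w → F w v)) xor sum (λ v → sum (λ w → F v w))
    ≡⟨ cong (_xor sum (λ v → sum (λ w → F v w))) (∑-comm (λ v w → F w v)) ⟩
  sum (λ v → sum (λ w → F v w)) xor sum (λ v → sum (λ w → F v w))
    ≡⟨ xor-same (sum (λ v → sum (λ w → F v w))) ⟩
  false ∎
  where
  open ≡-Reasoning
  F : Fin n → Fin n → Bool
  F v w = β (x v) ∧ (adj G v w ∧ β (y w))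
  lhs : sum (λ v → α (x v) ∧ β (y v)) ≡ sum (λ v → sum (λ w → F w v))
  lhs = sum-cong-≗ λ v → begin
    α (x v) ∧ β (y v) ≡⟨ ∧-comm (α (x v)) _ ⟩
    β (y v) ∧ α (x v) ≡⟨ cong (β (y v) ∧_) (row Gx v) ⟩
    β (y v) ∧ sum (λ w → adj G v w ∧ β (x w)) ≡⟨ *-distribˡ-sum (β (y v)) (λ w → adj G v w ∧ β (x w)) ⟩
    sum (λ w → β (y v) ∧ (adj G v w ∧ β (x w)))
      ≡⟨ sum-cong-≗ (λ w → trans (cong (λ e → β (y v) ∧ (e ∧ β (x w))) (adj-sym G v w))
           (truthTable 3 (λ a b c → a ∧ (b ∧ c)) (λ a b c → c ∧ (b ∧ a)) tt (β (y v)) (adj G w v) (β (x w)))) ⟩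
    sum (λ w → F w v) ∎
  rhs : sum (λ v → β (x v) ∧ α (y v)) ≡ sum (λ v → sum (λ w → F v w))
  rhs = sum-cong-≗ λ v → trans (cong (β (x v) ∧_) (row Gy v)) (*-distribˡ-sum (β (x v)) (λ w → adj G v w ∧ β (y w)))

ω-just : ∀ {p q} → ω (just p) (just q) ≡ false → p ≡ q
ω-just {ta} {ta} _ = refl
ω-just {tb} {tb} _ = refl
ω-just {tc} {tc} _ = refl

ω-≼ : ∀ {k l c} → k ≼ c → l ≼ c → ω k l ≡ false
ω-≼ {l = l} (inj₁ refl) _ = refl
ω-≼ {k} (inj₂ refl) (inj₁ refl) = truthTable 2 (λ a b → (a ∧ false) xor (b ∧ false)) (λ _ _ → false) tt (α k) (β k)
ω-≼ {c = c} (inj₂ refl) (inj₂ refl) = truthTable 2 (λ a b → (a ∧ b) xor (b ∧ a)) (λ _ _ → false) tt (α (just c)) (β (just c))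

-- In terms of circuit decompositions of a 4-regular graph: some partial decomposition
-- outside the root pairs the four half-edges at the root according to p ...
Through : ∀ {k} → BGraph (suc k) → (Fin k → Transition) → Transition → Set
Through {k} G t p = Σ (Fin k → Transition) λ c → (∀ v → c v ≢ t v) × Covers G (p ◂ c)

-- ... and some partial decomposition joins them by two disjoint paths.
Inside : ∀ {k} → BGraph (suc k) → (Fin k → Transition) → Set
Inside {k} G t = Σ (Fin k → Transition) λ c → (∀ v → c v ≢ t v) ×
  (∀ v → Σ (Fin (suc k) → K) λ x → G ⊨ x × x zero ≡ nothing × (∀ w → x (suc w) ≼ c w) × x (suc v) ≢ nothing)

root-ω : ∀ {k} (G : BGraph (suc k)) {x y} → G ⊨ x → G ⊨ y →
  sum (λ v → ω (x (suc v)) (y (suc v))) ≡ ω (x zero) (y zero)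
root-ω G {x} {y} Gx Gy = xor-cancel (ω (x zero) (y zero)) (sum (λ v → ω (x (suc v)) (y (suc v)))) (isotropic G Gx Gy)
  where
  xor-cancel : ∀ a b → a xor b ≡ false → b ≡ a
  xor-cancel true  true  _ = refl
  xor-cancel false false _ = refl

-- Two members with values in {0, `c`} away from the root pair to zero there, hence also at the root
-- by isotropy. So a choice `c` allows at most one nonzero value at the root.
root-≼ : ∀ {k} (G : BGraph (suc k)) {c : Fin k → Transition} {x y p} → G ⊨ x → G ⊨ y →
  (∀ w → x (suc w) ≼ c w) → (∀ w → y (suc w) ≼ c w) → x zero ≡ just p → y zero ≼ p
root-≼ G {x = x} {y} Gx Gy x≼c y≼c eq with y zero in ey
... | nothing = inj₁ refl
... | just q  = inj₂ (cong just (sym (ω-just (trans (cong₂ ω (sym eq) (sym ey))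
  (trans (sym (root-ω G Gx Gy)) (sum-false _ (λ v → ω-≼ (x≼c v) (y≼c v))))))))

from-≢ : ∀ (ψ : Perm) {c t s} → s ≡ to ψ t → c ≢ s → from ψ c ≢ t
from-≢ ψ {c} eq ne p = ne (trans (sym (to-from ψ c)) (trans (cong (to ψ) p) (sym eq)))

to-≢ : ∀ (ψ : Perm) {c t s} → s ≡ to ψ t → c ≢ t → to ψ c ≢ s
to-≢ ψ eq ne p = ne (to-injective ψ (trans p eq))

cover-root : ∀ {k} {G X : BGraph (suc k)} {t s} → LocEq G t X s → ∀ {p} → p ≢ t zero → Through G (t ∘ suc) p → Cover X s
cover-root {k} {G} {t = t} e {p} ne (c , adm , cov) = Cover-LocEq e (p ◂ c , adm′ , cov)
  where
  adm′ : ∀ v → (p ◂ c) v ≢ t v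
  adm′ zero    = ne
  adm′ (suc v) = adm v

cover-root⁻ : ∀ {k} {G X : BGraph (suc k)} {t s} → LocEq G t X s → Cover X s → ∃ λ p → p ≢ t zero × Through G (t ∘ suc) p
cover-root⁻ {k} e cX =
  let (c , adm , cov) = Cover-LocEq (LocEq-sym e) cX in
  c zero , adm zero , c ∘ suc , adm ∘ suc , λ v → let (x , Gx , x≼c , nz) = cov v in
    x , Gx , (λ { zero → x≼c zero ; (suc w) → x≼c (suc w) }) , nz

deleteRoot-⊨ : ∀ {k} (X : BGraph (suc k)) {x} → X ⊨ x → β (x zero) ≡ false → deleteRoot X ⊨ x ∘ suc
deleteRoot-⊨ X {x} Xx e .row v = trans (row Xx (suc v)) (cong (_xor sum (λ w → adj X (suc v) (suc w) ∧ β (x (suc w))))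
  (trans (cong (adj X (suc v) zero ∧_) e) (∧-zeroʳ _)))

-- A member extends over the deleted root with β false, and then the row of the root dictates α.
-- Deletion thus resolves the root by the transition `ta`.
deleteRoot-⊨⁻ : ∀ {k} (X : BGraph (suc k)) {y} → deleteRoot X ⊨ y → Σ K λ k → X ⊨ (k ◂ y) × k ≼ ta
deleteRoot-⊨⁻ {k} X {y} Xy = fromBits s false , member , small s
  where
  s : Bool
  s = sum (λ w → adj X zero (suc w) ∧ β (y w))
  small : ∀ s → fromBits s false ≼ ta
  small true  = inj₂ refl
  small false = inj₁ refl
  member : X ⊨ (fromBits s false ◂ y)
  member .row zero = trans (α-fromBits s false) (cong (λ a → (a ∧ β (fromBits s false)) xor s) (sym (adj-irr X zero)))
  member .row (suc v) = trans (row Xy v) (cong (_xor sum (λ w → adj X (suc v) (suc w) ∧ β (y w)))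
    (sym (trans (cong (adj X (suc v) zero ∧_) (β-fromBits s false)) (∧-zeroʳ _))))

module _ {k} {G X : BGraph (suc k)} {t : Fin (suc k) → Transition} (e : LocEq G t X (tagOf X))
         {u} (root : to (ψ e zero) u ≡ ta) where

  private
    βta : ∀ {k} → k ≼ ta → β k ≡ false
    βta (inj₁ refl) = refl
    βta (inj₂ refl) = refl

  through⇒cover-deleteRoot : Through G (t ∘ suc) u → Cover (deleteRoot X) (tagOf (deleteRoot X))
  through⇒cover-deleteRoot (c , adm , cov) =
    (λ v → to (ψ e (suc v)) (c v)) , (λ v → to-≢ (ψ e (suc v)) (tag e (suc v)) (adm v)) ,
    λ v → let (x , Gx , x≼c , nz) = cov (suc v) in
      _ , deleteRoot-⊨ X (fwd e Gx) (βta (subst (act (to (ψ e zero)) (x zero) ≼_) root (act-≼ (x≼c zero)))) ,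
      (λ w → act-≼ (x≼c (suc w))) , act-nonzero (x (suc v)) nz

  inside⇒cover-deleteRoot : Inside G (t ∘ suc) → Cover (deleteRoot X) (tagOf (deleteRoot X))
  inside⇒cover-deleteRoot (c , adm , cov) =
    (λ v → to (ψ e (suc v)) (c v)) , (λ v → to-≢ (ψ e (suc v)) (tag e (suc v)) (adm v)) ,
    λ v → let (x , Gx , x0 , x≼c , nz) = cov v in
      _ , deleteRoot-⊨ X (fwd e Gx) (cong (β ∘ act (to (ψ e zero))) x0) ,
      (λ w → act-≼ (x≼c w)) , act-nonzero (x (suc v)) nz

  -- Lift the members back over the root. If some vector respecting `c` has the value `ta` there,
  -- the choice goes through the root; otherwise all lifts vanish there and the choice is inside.
  ¬cover-deleteRoot : ¬ Through G (t ∘ suc) u → ¬ Inside G (t ∘ suc) → ¬ Cover (deleteRoot X) (tagOf (deleteRoot X))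
  ¬cover-deleteRoot noThrough noInside (c , adm , cov) = ¬¬-excluded-middle {A = Σ (Fin k → K) λ y → X ⊨ (just ta ◂ y) × (∀ w → y w ≼ c w)} λ
    { (yes (y , Xy , y≼c)) → noThrough (c′ , adm′ , through y Xy y≼c)
    ; (no none) → noInside (c′ , adm′ , inside none) }
    where
    c′ : Fin k → Transition
    c′ v = from (ψ e (suc v)) (c v)
    adm′ : ∀ v → c′ v ≢ t (suc v)
    adm′ v = from-≢ (ψ e (suc v)) (tag e (suc v)) (adm v)
    root′ : from (ψ e zero) ta ≡ u
    root′ = trans (cong (from (ψ e zero)) (sym root)) (from-to (ψ e zero) u)
    pull : (Fin (suc k) → K) → Fin (suc k) → K
    pull x v = act (from (ψ e v)) (x v)
    ≼-all : ∀ {x : Fin (suc k) → K} → x zero ≼ ta → (∀ w → x (suc w) ≼ c w) → ∀ w → pull x w ≼ (u ◂ c′) w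
    ≼-all {x} p q zero = subst (act (from (ψ e zero)) (x zero) ≼_) root′ (act-≼ p)
    ≼-all p q (suc w) = act-≼ (q w)
    through : ∀ y → X ⊨ (just ta ◂ y) → (∀ w → y w ≼ c w) → Covers G (u ◂ c′)
    through y Xy y≼c zero = pull (just ta ◂ y) , bwd e Xy , ≼-all (inj₂ refl) y≼c , λ ()
    through y Xy y≼c (suc v) =
      let (x , Dx , x≼c , nz) = cov v
          (k , Xx , k≼) = deleteRoot-⊨⁻ X Dx
      in pull (k ◂ x) , bwd e Xx , ≼-all k≼ x≼c , act-nonzero (x v) nz
    inside : ¬ (Σ (Fin k → K) λ y → X ⊨ (just ta ◂ y) × (∀ w → y w ≼ c w)) → ∀ v →
      Σ (Fin (suc k) → K) λ x → G ⊨ x × x zero ≡ nothing × (∀ w → x (suc w) ≼ c′ w) × x (suc v) ≢ nothing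
    inside none v with cov v
    ... | x , Dx , x≼c , nz with deleteRoot-⊨⁻ X Dx
    ...   | .nothing , Xx , inj₁ refl = pull (nothing ◂ x) , bwd e Xx , refl , (λ w → act-≼ (x≼c w)) , act-nonzero (x v) nz
    ...   | .(just ta) , Xx , inj₂ refl = ⊥-elim (none (x , Xx , x≼c))

-- The argument is the transition forbidden at the root in the coordinates of the rooted
-- graph itself, hence ta for rc, which complements at the root before colouring it.
rootPiece : Transition → ∀ {k} → BGraph (suc k) → BGraph (suc k)
rootPiece ta = rc
rootPiece tb = rw
rootPiece tc = rb

rootTag : ∀ {k} → Transition → BGraph (suc k) → Fin (suc k) → Transition
rootTag u Q = u ◂ (tagOf Q ∘ suc)

rootPiece-LocEq : ∀ u {k} (Q : BGraph (suc k)) → LocEq Q (rootTag u Q) (rootPiece u Q) (tagOf (rootPiece u Q))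
rootPiece-LocEq ta Q = LocEq-trans {H = lc (setRootColour white Q) zero}
  (LocEq-trans {H = setRootColour white Q} (≗-LocEq (λ _ _ → refl) (λ _ → refl)) (lc-LocEq (setRootColour white Q) zero (rootTag ta Q)))
  (≗-LocEq (λ _ _ → refl) λ { zero → refl ; (suc v) → tagOf-white (setRootColour white Q) zero refl (suc v) })
rootPiece-LocEq tb Q = ≗-LocEq (λ _ _ → refl) λ { zero → refl ; (suc v) → refl }
rootPiece-LocEq tc Q = ≗-LocEq (λ _ _ → refl) λ { zero → refl ; (suc v) → refl }

-- A deletion resolves the root by the `ta` of the graph that is being cut down. The second
-- component records which transition of `Q` this is: `tc` for `lb`, `tb` for `lcv`, and `ta` itself
-- for `lw`.
lb-LocEq : ∀ {k} (Q : BGraph (suc k)) →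
  let X = lc (setRootColour white Q) zero in Σ (LocEq Q (rootTag tb Q) X (tagOf X)) λ e → to (ψ e zero) tc ≡ ta
lb-LocEq Q = LocEq-trans {H = setRootColour white Q} (≗-LocEq (λ _ _ → refl) λ { zero → refl ; (suc v) → refl })
  (lc-white-LocEq (setRootColour white Q) zero refl) , refl

brace-LocEq : ∀ {k} (H : BGraph (suc k)) v → colour H zero ≡ black → adj H zero v ≡ true →
  Σ (LocEq H (tagOf H) (brace H zero v) (tagOf (brace H zero v))) λ e → to (ψ e zero) tb ≡ ta
brace-LocEq H v b e with colour H v in cv
... | white = LocEq-trans (lc-white-LocEq H v cv) (lc-white-LocEq (lc H v) zero whiteRoot) , root
  where
  e′ : adj H v zero ≡ true
  e′ = trans (adj-sym H v zero) e
  whiteRoot : colour (lc H v) zero ≡ white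
  whiteRoot rewrite cv | e′ = cong flipC b
  root : to (localPerm (lc H v) zero zero) (to (localPerm H v zero) tb) ≡ ta
  root rewrite localPerm-edge H v {zero} e′ = refl
... | black = pivot-LocEq H v zero cv b e′ , pivot-tb-neighbour H v zero e′
  where
  e′ : adj H v zero ≡ true
  e′ = trans (adj-sym H v zero) e

lcv-LocEq : ∀ {k} (Q : BGraph (suc k)) v → adj Q zero v ≡ true →
  let X = brace (setRootColour black Q) zero v in Σ (LocEq Q (rootTag tc Q) X (tagOf X)) λ e → to (ψ e zero) tb ≡ ta
lcv-LocEq Q v e = let (d , r) = brace-LocEq (setRootColour black Q) v refl e in
  LocEq-trans {H = setRootColour black Q} (≗-LocEq (λ _ _ → refl) λ { zero → refl ; (suc v) → refl }) d , r

-- Splits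

sum-++ : ∀ k {l} (h : Fin (k + l) → Bool) → sum h ≡ sum (λ a → h (a ↑ˡ l)) xor sum (λ b → h (k ↑ʳ b))
sum-++ zero    h = refl
sum-++ (suc k) {l} h = trans (cong (h zero xor_) (sum-++ k (h ∘ suc)))
  (sym (xor-assoc (h zero) (sum (λ a → h (suc a ↑ˡ l))) (sum (λ b → h (suc k ↑ʳ b)))))

swapSplit : ∀ {n} {G : BGraph n} → Split G → Split G
swapSplit {G = G} s = record
  { k₁ = k₂ s ; k₂ = k₁ s ; e₁ = e₂ s ; e₂ = e₁ s ; e₁-inj = e₂-inj s ; e₂-inj = e₁-inj s
  ; disjoint = λ a b p → disjoint s b a (sym p)
  ; cover = λ x → Sum.swap (cover s x)
  ; size₁ = size₂ s ; size₂ = size₁ s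
  ; split = λ a b p q → trans (adj-sym G _ _) (split s b a q p) }

module _ {n k l} {f : Fin k → Fin n} {g : Fin l → Fin n}
  (f-inj : Injective _≡_ _≡_ f) (g-inj : Injective _≡_ _≡_ g)
  (disj : ∀ a b → ¬ (f a ≡ g b)) (cov : ∀ x → (∃[ a ] f a ≡ x) ⊎ (∃[ b ] g b ≡ x)) where

  private
    both : Fin (k + l) → Fin n
    both i = Sum.[ f , g ] (splitAt k i)
    index : ∀ {x} → (∃[ a ] f a ≡ x) ⊎ (∃[ b ] g b ≡ x) → Fin (k + l)
    index (inj₁ (a , _)) = a ↑ˡ l
    index (inj₂ (b , _)) = k ↑ʳ b
    both-index : ∀ {x} (c : (∃[ a ] f a ≡ x) ⊎ (∃[ b ] g b ≡ x)) → both (index c) ≡ x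
    both-index (inj₁ (a , p)) rewrite splitAt-↑ˡ k a l = p
    both-index (inj₂ (b , p)) rewrite splitAt-↑ʳ k l b = p
    both-injective : ∀ i j → both i ≡ both j → i ≡ j
    both-injective i j p with splitAt k i in ei | splitAt k j in ej
    ... | inj₁ a | inj₁ b = trans (sym (splitAt⁻¹-↑ˡ ei)) (trans (cong (_↑ˡ l) (f-inj p)) (splitAt⁻¹-↑ˡ ej))
    ... | inj₁ a | inj₂ b = ⊥-elim (disj a b p)
    ... | inj₂ a | inj₁ b = ⊥-elim (disj b a (sym p))
    ... | inj₂ a | inj₂ b = trans (sym (splitAt⁻¹-↑ʳ ei)) (trans (cong (k ↑ʳ_) (g-inj p)) (splitAt⁻¹-↑ʳ ej))

  bipartition : Permutation (k + l) n
  bipartition = permutation both (λ x → index (cov x)) (λ x → both-index (cov x))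
    (λ i → both-injective _ _ (both-index (cov (both i))))

  sum-bipartition : ∀ (h : Fin n → Bool) → sum h ≡ sum (h ∘ f) xor sum (h ∘ g)
  sum-bipartition h = trans (sum-permute h bipartition) (trans (sum-++ k (h ∘ both))
    (cong₂ _xor_ (sum-cong-≗ λ a → cong h (cong Sum.[ f , g ] (splitAt-↑ˡ k a l)))
                 (sum-cong-≗ λ b → cong h (cong Sum.[ f , g ] (splitAt-↑ʳ k l b)))))

module _ {n} {G : BGraph n} (s : Split G) where

  split-order : k₁ s + k₂ s ≡ n
  split-order = ↔⇒≡ (bipartition (e₁-inj s) (e₂-inj s) (disjoint s) (cover s))

  sum-split : ∀ (h : Fin n → Bool) → sum h ≡ sum (h ∘ e₁ s) xor sum (h ∘ e₂ s)
  sum-split = sum-bipartition (e₁-inj s) (e₂-inj s) (disjoint s) (cover s)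

  side₁ : BGraph (suc (k₁ s))
  side₁ = quotient G (e₁ s) (e₂ s)
  side₂ : BGraph (suc (k₂ s))
  side₂ = quotient G (e₂ s) (e₁ s)

  -- The split condition in rank-one form; the factors are the rows of the two markers.
  adj-cross : ∀ a b → adj G (e₁ s a) (e₂ s b) ≡ adj side₁ zero (suc a) ∧ adj side₂ zero (suc b)
  adj-cross a b with adj side₁ zero (suc a) in p | adj side₂ zero (suc b) in q
  ... | true  | true  = split s a b (anyFin⁻ _ q) (anyFin⁻ _ p)
  ... | true  | false = ≢true⇒≡false λ e → true≢false (anyFin⁺ (λ a → adj G (e₂ s b) (e₁ s a)) a (trans (adj-sym G _ _) e)) q
  ... | false | _     = ≢true⇒≡false λ e → true≢false (anyFin⁺ (λ b → adj G (e₁ s a) (e₂ s b)) b e) p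

  crossing : ∀ {a} → adj side₁ zero (suc a) ≡ true → ∃ λ b → adj side₂ zero (suc b) ≡ true
  crossing {a} p = let (b , q) = anyFin⁻ _ p in b , anyFin⁺ _ a (trans (adj-sym G _ _) q)

  module _ {A : Set} (f : Fin (k₁ s) → A) (g : Fin (k₂ s) → A) where

    join : Fin n → A
    join x with cover s x
    ... | inj₁ (a , _) = f a
    ... | inj₂ (b , _) = g b

    join-e₁ : ∀ a → join (e₁ s a) ≡ f a
    join-e₁ a with cover s (e₁ s a)
    ... | inj₁ (a′ , p) = cong f (e₁-inj s p)
    ... | inj₂ (b , p)  = ⊥-elim (disjoint s a b (sym p))

    join-e₂ : ∀ b → join (e₂ s b) ≡ g b
    join-e₂ b with cover s (e₂ s b)
    ... | inj₁ (a , p)  = ⊥-elim (disjoint s a b p)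
    ... | inj₂ (b′ , p) = cong g (e₂-inj s p)

  split-elim : ∀ {P : Fin n → Set} → (∀ a → P (e₁ s a)) → (∀ b → P (e₂ s b)) → ∀ x → P x
  split-elim p q x with cover s x
  ... | inj₁ (a , refl) = p a
  ... | inj₂ (b , refl) = q b

  -- Across a rank-one cut each side sees the other through a single bit. What the first side sends
  -- is α at its marker by the marker's row, and what it receives acts as β there. From the second
  -- side the two bits are exchanged, hence `swapAB` in all gluing statements.
  flow₁ flow₂ : (Fin n → K) → Bool
  flow₁ x = sum (λ a → adj side₁ zero (suc a) ∧ β (x (e₁ s a)))
  flow₂ x = sum (λ b → adj side₂ zero (suc b) ∧ β (x (e₂ s b)))

  row-e₁ : ∀ (x : Fin n → K) a → sum (λ w → adj G (e₁ s a) w ∧ β (x w)) ≡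
    (adj side₁ zero (suc a) ∧ flow₂ x) xor sum (λ a′ → adj G (e₁ s a) (e₁ s a′) ∧ β (x (e₁ s a′)))
  row-e₁ x a = trans (sum-split _) (trans (xor-comm (sum (λ a′ → adj G (e₁ s a) (e₁ s a′) ∧ β (x (e₁ s a′)))) _)
    (cong (_xor sum (λ a′ → adj G (e₁ s a) (e₁ s a′) ∧ β (x (e₁ s a′))))
      (trans (sum-cong-≗ λ b → trans (cong (_∧ β (x (e₂ s b))) (adj-cross a b)) (∧-assoc (adj side₁ zero (suc a)) _ _))
        (sym (*-distribˡ-sum (adj side₁ zero (suc a)) (λ b → adj side₂ zero (suc b) ∧ β (x (e₂ s b))))))))

  restrict₁ : ∀ {x} → G ⊨ x → side₁ ⊨ (fromBits (flow₁ x) (flow₂ x) ◂ x ∘ e₁ s)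
  restrict₁ {x} Gx .row zero = α-fromBits (flow₁ x) (flow₂ x)
  restrict₁ {x} Gx .row (suc a) = trans (row Gx (e₁ s a)) (trans (row-e₁ x a)
    (cong (λ m → (adj side₁ zero (suc a) ∧ m) xor sum (λ a′ → adj G (e₁ s a) (e₁ s a′) ∧ β (x (e₁ s a′))))
      (sym (β-fromBits (flow₁ x) (flow₂ x)))))

module _ {n} {G : BGraph n} (s : Split G) where

  swapAB-fromBits : ∀ a b → act swapAB (fromBits a b) ≡ fromBits b a
  swapAB-fromBits false false = refl
  swapAB-fromBits true  false = refl
  swapAB-fromBits false true  = refl
  swapAB-fromBits true  true  = refl

  restrict : ∀ {x} → G ⊨ x → Σ K λ k → side₁ s ⊨ (k ◂ x ∘ e₁ s) × side₂ s ⊨ (act swapAB k ◂ x ∘ e₂ s)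
  restrict {x} Gx = fromBits (flow₁ s x) (flow₂ s x) , restrict₁ s Gx ,
    subst (λ k → side₂ s ⊨ (k ◂ x ∘ e₂ s)) (sym (swapAB-fromBits (flow₁ s x) (flow₂ s x))) (restrict₁ (swapSplit s) Gx)

  glue : ∀ {k y₁ y₂} → side₁ s ⊨ (k ◂ y₁) → side₂ s ⊨ (act swapAB k ◂ y₂) → G ⊨ join s y₁ y₂
  glue {k} {y₁} {y₂} Gy₁ Gy₂ .row = split-elim s (half s Gy₁ flow₂≡ (join-e₁ s y₁ y₂)) (half (swapSplit s) Gy₂ flow₁≡ (join-e₂ s y₁ y₂))
    where
    x = join s y₁ y₂
    half : ∀ (s : Split G) {k y} → side₁ s ⊨ (k ◂ y) → flow₂ s x ≡ β k → (∀ a → x (e₁ s a) ≡ y a) →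
      ∀ a → α (x (e₁ s a)) ≡ sum (λ w → adj G (e₁ s a) w ∧ β (x w))
    half s {k} {y} Gy m p a = trans (cong α (p a)) (trans (row Gy (suc a)) (sym (trans (row-e₁ s x a)
      (cong₂ (λ b c → (adj (side₁ s) zero (suc a) ∧ b) xor c) m
        (sum-cong-≗ λ a′ → cong (λ k → adj G (e₁ s a) (e₁ s a′) ∧ β k) (p a′))))))
    flow₂≡ : flow₂ s x ≡ β k
    flow₂≡ = trans (sum-cong-≗ λ b → cong (λ k → adj (side₂ s) zero (suc b) ∧ β k) (join-e₂ s y₁ y₂ b))
      (trans (sym (row Gy₂ zero)) (α-swapAB k))
    flow₁≡ : flow₁ s x ≡ β (act swapAB k)
    flow₁≡ = trans (sum-cong-≗ λ a → cong (λ k → adj (side₁ s) zero (suc a) ∧ β k) (join-e₁ s y₁ y₂ a))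
      (trans (sym (row Gy₁ zero)) (sym (β-swapAB k)))

module _ {n} {G : BGraph n} (s : Split G) where

  private
    t₁ = tagOf G ∘ e₁ s
    t₂ = tagOf G ∘ e₂ s

  join-≼ : ∀ {y₁ y₂ c₁ c₂} → (∀ a → y₁ a ≼ c₁ a) → (∀ b → y₂ b ≼ c₂ b) → ∀ v → join s y₁ y₂ v ≼ join s c₁ c₂ v
  join-≼ {y₁} {y₂} {c₁} {c₂} p q = split-elim s
    (λ a → subst₂ _≼_ (sym (join-e₁ s y₁ y₂ a)) (sym (join-e₁ s c₁ c₂ a)) (p a))
    (λ b → subst₂ _≼_ (sym (join-e₂ s y₁ y₂ b)) (sym (join-e₂ s c₁ c₂ b)) (q b))

  join-≢ : ∀ {c₁ c₂} → (∀ a → c₁ a ≢ t₁ a) → (∀ b → c₂ b ≢ t₂ b) → ∀ v → join s c₁ c₂ v ≢ tagOf G v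
  join-≢ {c₁} {c₂} p q = split-elim s
    (λ a r → p a (trans (sym (join-e₁ s c₁ c₂ a)) r))
    (λ b r → q b (trans (sym (join-e₂ s c₁ c₂ b)) r))

  private
    nothing≼ : ∀ {k} {c : Fin k → Transition} → ∀ v → nothing ≼ c v
    nothing≼ v = inj₁ refl

  glue₁ : ∀ {x} → side₁ s ⊨ x → x zero ≡ nothing → G ⊨ join s (x ∘ suc) (λ _ → nothing)
  glue₁ {x} Gx x0 = glue s {k = x zero} (⊨-cong (λ _ _ → refl) (λ { zero → refl ; (suc a) → refl }) Gx)
    (⊨-cong (λ _ _ → refl) (λ { zero → cong (act swapAB) (sym x0) ; (suc b) → refl }) (⊨-zero (side₂ s)))

  glue₂ : ∀ {y} → side₂ s ⊨ y → y zero ≡ nothing → G ⊨ join s (λ _ → nothing) (y ∘ suc)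
  glue₂ {y} Gy y0 = glue s {k = nothing} (⊨-cong (λ _ _ → refl) (λ { zero → refl ; (suc a) → refl }) (⊨-zero (side₁ s)))
    (⊨-cong (λ _ _ → refl) (λ { zero → y0 ; (suc b) → refl }) Gy)

  glue-same : ∀ {x y p} → side₁ s ⊨ x → side₂ s ⊨ y → x zero ≡ just p → y zero ≡ just (swapAB p) → G ⊨ join s (x ∘ suc) (y ∘ suc)
  glue-same {x} {y} {p} Gx Gy x0 y0 = glue s {k = just p}
    (⊨-cong (λ _ _ → refl) (λ { zero → x0 ; (suc a) → refl }) Gx)
    (⊨-cong (λ _ _ → refl) (λ { zero → y0 ; (suc b) → refl }) Gy)

  root-just : ∀ {k p} {H : BGraph (suc k)} {c} → Covers H (p ◂ c) →
    Σ (Fin (suc k) → K) λ x → H ⊨ x × x zero ≡ just p × (∀ w → x (suc w) ≼ c w)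
  root-just cov with cov zero
  ... | x , Hx , x≼c , nz with x≼c zero
  ...   | inj₁ e = ⊥-elim (nz e)
  ...   | inj₂ e = x , Hx , e , x≼c ∘ suc

  inside-cover : Inside (side₁ s) t₁ → Inside (side₂ s) t₂ → Cover G (tagOf G)
  inside-cover (c₁ , adm₁ , cov₁) (c₂ , adm₂ , cov₂) = join s c₁ c₂ , join-≢ adm₁ adm₂ , split-elim s
    (λ a → let (x , Gx , x0 , x≼c , nz) = cov₁ a in
      _ , glue₁ Gx x0 , join-≼ x≼c nothing≼ , nz ∘ trans (sym (join-e₁ s (x ∘ suc) _ a)))
    (λ b → let (y , Gy , y0 , y≼c , nz) = cov₂ b in
      _ , glue₂ Gy y0 , join-≼ nothing≼ y≼c , nz ∘ trans (sym (join-e₂ s _ (y ∘ suc) b)))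

  -- A member that vanishes at its marker extends by zero. One that does not is continued on the
  -- other side by a member with the matching marker value, which `Through` supplies.
  through-cover : ∀ p → Through (side₁ s) t₁ p → Through (side₂ s) t₂ (swapAB p) → Cover G (tagOf G)
  through-cover p (c₁ , adm₁ , cov₁) (c₂ , adm₂ , cov₂) = join s c₁ c₂ , join-≢ adm₁ adm₂ , split-elim s at₁ at₂
    where
    at₁ : ∀ a → Σ (Fin n → K) λ x → G ⊨ x × (∀ w → x w ≼ join s c₁ c₂ w) × x (e₁ s a) ≢ nothing
    at₁ a with cov₁ (suc a)
    ... | x , Gx , x≼c , nz with x≼c zero
    ...   | inj₁ x0 = _ , glue₁ Gx x0 , join-≼ (x≼c ∘ suc) nothing≼ , nz ∘ trans (sym (join-e₁ s (x ∘ suc) _ a))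
    ...   | inj₂ x0 = let (y , Gy , y0 , y≼c) = root-just cov₂ in
      _ , glue-same Gx Gy x0 y0 , join-≼ (x≼c ∘ suc) y≼c , nz ∘ trans (sym (join-e₁ s (x ∘ suc) (y ∘ suc) a))
    at₂ : ∀ b → Σ (Fin n → K) λ x → G ⊨ x × (∀ w → x w ≼ join s c₁ c₂ w) × x (e₂ s b) ≢ nothing
    at₂ b with cov₂ (suc b)
    ... | y , Gy , y≼c , nz with y≼c zero
    ...   | inj₁ y0 = _ , glue₂ Gy y0 , join-≼ nothing≼ (y≼c ∘ suc) , nz ∘ trans (sym (join-e₂ s _ (y ∘ suc) b))
    ...   | inj₂ y0 = let (x , Gx , x0 , x≼c) = root-just cov₁ in
      _ , glue-same Gx Gy x0 y0 , join-≼ x≼c (y≼c ∘ suc) , nz ∘ trans (sym (join-e₂ s (x ∘ suc) (y ∘ suc) b))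

  -- `Linked` says that some member respecting `c` crosses the cut. Then `root-≼` forces all members
  -- to the same transition at either marker, so both sides are `Through`. If nothing crosses, every
  -- member vanishes at both markers and both sides are `Inside`.
  ¬cover-split : (∀ p → Through (side₁ s) t₁ p → Through (side₂ s) t₂ (swapAB p) → ⊥) →
    (Inside (side₁ s) t₁ → Inside (side₂ s) t₂ → ⊥) → ¬ Cover G (tagOf G)
  ¬cover-split noThrough noInside (c , adm , cov) = ¬¬-excluded-middle {A = Linked} λ
    { (yes (p , x , Gx , x≼c , y , Gy , y≼c)) → noThrough p
        (c ∘ e₁ s , adm ∘ e₁ s , through₁ p Gx x≼c)
        (c ∘ e₂ s , adm ∘ e₂ s , through₂ p Gy y≼c)
    ; (no none) → noInside (c ∘ e₁ s , adm ∘ e₁ s , inside₁ none) (c ∘ e₂ s , adm ∘ e₂ s , inside₂ none) }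
    where
    Linked : Set
    Linked = ∃ λ p → Σ (Fin (k₁ s) → K) λ x → side₁ s ⊨ (just p ◂ x) × (∀ a → x a ≼ c (e₁ s a)) ×
             Σ (Fin (k₂ s) → K) λ y → side₂ s ⊨ (just (swapAB p) ◂ y) × (∀ b → y b ≼ c (e₂ s b))
    through₁ : ∀ p {x} → side₁ s ⊨ (just p ◂ x) → (∀ a → x a ≼ c (e₁ s a)) → Covers (side₁ s) (p ◂ c ∘ e₁ s)
    through₁ p {x} Gx x≼c zero = _ , Gx , (λ { zero → inj₂ refl ; (suc a) → x≼c a }) , λ ()
    through₁ p {x} Gx x≼c (suc a) =
      let (z , Gz , z≼c , nz) = cov (e₁ s a)
          (k , Gz₁ , _) = restrict s Gz
      in _ , Gz₁ , (λ { zero → root-≼ (side₁ s) Gx Gz₁ x≼c (z≼c ∘ e₁ s) refl ; (suc a) → z≼c (e₁ s a) }) , nz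
    through₂ : ∀ p {y} → side₂ s ⊨ (just (swapAB p) ◂ y) → (∀ b → y b ≼ c (e₂ s b)) → Covers (side₂ s) (swapAB p ◂ c ∘ e₂ s)
    through₂ p {y} Gy y≼c zero = _ , Gy , (λ { zero → inj₂ refl ; (suc b) → y≼c b }) , λ ()
    through₂ p {y} Gy y≼c (suc b) =
      let (z , Gz , z≼c , nz) = cov (e₂ s b)
          (k , _ , Gz₂) = restrict s Gz
      in _ , Gz₂ , (λ { zero → root-≼ (side₂ s) Gy Gz₂ y≼c (z≼c ∘ e₂ s) refl ; (suc b) → z≼c (e₂ s b) }) , nz
    inside₁ : ¬ Linked → ∀ a → Σ (Fin (suc (k₁ s)) → K) λ x →
      side₁ s ⊨ x × x zero ≡ nothing × (∀ w → x (suc w) ≼ c (e₁ s w)) × x (suc a) ≢ nothing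
    inside₁ none a with cov (e₁ s a)
    ... | z , Gz , z≼c , nz with restrict s Gz
    ...   | nothing , G₁ , _  = _ , G₁ , refl , z≼c ∘ e₁ s , nz
    ...   | just p  , G₁ , G₂ = ⊥-elim (none (p , _ , G₁ , z≼c ∘ e₁ s , _ , G₂ , z≼c ∘ e₂ s))
    inside₂ : ¬ Linked → ∀ b → Σ (Fin (suc (k₂ s)) → K) λ y →
      side₂ s ⊨ y × y zero ≡ nothing × (∀ w → y (suc w) ≼ c (e₂ s w)) × y (suc b) ≢ nothing
    inside₂ none b with cov (e₂ s b)
    ... | z , Gz , z≼c , nz with restrict s Gz
    ...   | nothing , _  , G₂ = _ , G₂ , refl , z≼c ∘ e₂ s , nz
    ...   | just p  , G₁ , G₂ = ⊥-elim (none (p , _ , G₁ , z≼c ∘ e₁ s , _ , G₂ , z≼c ∘ e₂ s))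

-- Alternance graphs and local complementation

not-true : ∀ {b} → not b ≡ true → b ≡ false
not-true {false} _ = refl

not-false : ∀ {b} → not b ≡ false → b ≡ true
not-false {true} _ = refl

odd : ∀ {n} → List (Fin n) → Fin n → Bool
odd []      x = false
odd (a ∷ w) x = eqb a x xor odd w x

-- The parity of the number of pairs of positions i < j with letters x and y. For a
-- double occurrence word and x ≢ y it tells whether x and y alternate.
inv : ∀ {n} → List (Fin n) → Fin n → Fin n → Bool
inv []      x y = false
inv (a ∷ w) x y = (eqb a x ∧ odd w y) xor inv w x y

occ-∷-≡ : ∀ {n} (u : Fin n) w → occurrences (u ∷ w) u ≡ suc (occurrences w u)
occ-∷-≡ u w with u ≟ u
... | yes _ = refl
... | no ne = ⊥-elim (ne refl)

occ-∷-≢ : ∀ {n} {a u : Fin n} w → a ≢ u → occurrences (a ∷ w) u ≡ occurrences w u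
occ-∷-≢ {a = a} {u} w ne with a ≟ u
... | yes p = ⊥-elim (ne p)
... | no _  = refl

parity : ℕ → Bool
parity zero    = false
parity (suc n) = not (parity n)

odd-occurrences : ∀ {n} (w : List (Fin n)) u → odd w u ≡ parity (occurrences w u)
odd-occurrences [] u = refl
odd-occurrences (a ∷ w) u with a ≟ u
... | yes _ = cong not (odd-occurrences w u)
... | no _  = odd-occurrences w u

odd-++ : ∀ {n} (w w′ : List (Fin n)) x → odd (w ++ w′) x ≡ odd w x xor odd w′ x
odd-++ []      w′ x = refl
odd-++ (a ∷ w) w′ x = trans (cong (eqb a x xor_) (odd-++ w w′ x)) (sym (xor-assoc (eqb a x) (odd w x) (odd w′ x)))

inv-++ : ∀ {n} (w w′ : List (Fin n)) x y → inv (w ++ w′) x y ≡ (inv w x y xor (odd w x ∧ odd w′ y)) xor inv w′ x y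
inv-++ []      w′ x y = refl
inv-++ (a ∷ w) w′ x y = trans (cong₂ (λ b c → (eqb a x ∧ b) xor c) (odd-++ w w′ y) (inv-++ w w′ x y))
  (truthTable 6 (λ a b c d e f → (a ∧ (b xor c)) xor ((d xor (e ∧ c)) xor f))
                (λ a b c d e f → (((a ∧ b) xor d) xor ((a xor e) ∧ c)) xor f) tt
                (eqb a x) (odd w y) (odd w′ y) (inv w x y) (odd w x) (inv w′ x y))

-- Each pair of an occurrence of `x` and one of `y` is counted in exactly one of the two orders.
inv-sym : ∀ {n} (w : List (Fin n)) {x y} → x ≢ y → inv w x y xor inv w y x ≡ odd w x ∧ odd w y
inv-sym [] ne = refl
inv-sym (a ∷ w) {x} {y} ne = trans
  (truthTable 6 (λ a b p q i j → ((a ∧ q) xor i) xor ((b ∧ p) xor j)) (λ a b p q i j → ((a ∧ q) xor (b ∧ p)) xor (i xor j)) tt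
    (eqb a x) (eqb a y) (odd w x) (odd w y) (inv w x y) (inv w y x)) (trans
  (cong (((eqb a x ∧ odd w y) xor (eqb a y ∧ odd w x)) xor_) (inv-sym w ne)) (lemma (odd w x) (odd w y)))
  where
  lemma : ∀ p q → ((eqb a x ∧ q) xor (eqb a y ∧ p)) xor (p ∧ q) ≡ (eqb a x xor p) ∧ (eqb a y xor q)
  lemma p q with a ≟ x | a ≟ y
  ... | yes refl | yes e = ⊥-elim (ne e)
  ... | yes _ | no _ = truthTable 2 (λ p q → (q xor false) xor (p ∧ q)) (λ p q → not p ∧ q) tt p q
  ... | no _ | yes _ = truthTable 2 (λ p q → p xor (p ∧ q)) (λ p q → p ∧ not q) tt p q
  ... | no _ | no _  = refl

odd-reverse : ∀ {n} (w : List (Fin n)) x → odd (reverse w) x ≡ odd w x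
odd-reverse [] x = refl
odd-reverse (a ∷ w) x = trans (cong (λ l → odd l x) (unfold-reverse a w)) (trans (odd-++ (reverse w) (a ∷ []) x)
  (trans (cong₂ _xor_ (odd-reverse w x) (xor-identityʳ (eqb a x))) (xor-comm (odd w x) (eqb a x))))

inv-reverse : ∀ {n} (w : List (Fin n)) x y → inv (reverse w) x y ≡ inv w y x
inv-reverse [] x y = refl
inv-reverse (a ∷ w) x y = trans (cong (λ l → inv l x y) (unfold-reverse a w)) (trans (inv-++ (reverse w) (a ∷ []) x y)
  (trans (cong₂ (λ i p → (i xor (p ∧ (eqb a y xor false))) xor ((eqb a x ∧ false) xor false)) (inv-reverse w x y) (odd-reverse w x))
    (truthTable 4 (λ i p b a → (i xor (p ∧ (b xor false))) xor ((a ∧ false) xor false)) (λ i p b a → (b ∧ p) xor i) tt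
      (inv w y x) (odd w x) (eqb a y) (eqb a x))))

occ-++ : ∀ {n} (w w′ : List (Fin n)) u → occurrences (w ++ w′) u ≡ occurrences w u + occurrences w′ u
occ-++ w w′ u = trans (cong length (filter-++ (_≟ u) w w′)) (length-++ (filter (_≟ u) w))

occ-reverse : ∀ {n} (w : List (Fin n)) u → occurrences (reverse w) u ≡ occurrences w u
occ-reverse [] u = refl
occ-reverse (a ∷ w) u = trans (cong (λ l → occurrences l u) (unfold-reverse a w)) (trans (occ-++ (reverse w) (a ∷ []) u)
  (trans (cong (_+ occurrences (a ∷ []) u) (occ-reverse w u)) (trans (+-comm (occurrences w u) _) (sym (occ-++ (a ∷ []) w u)))))

occ-0-odd : ∀ {n} (w : List (Fin n)) {u} → occurrences w u ≡ 0 → odd w u ≡ false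
occ-0-odd w {u} p = trans (odd-occurrences w u) (cong parity p)

occ-0-inv : ∀ {n} (w : List (Fin n)) {u} x → occurrences w u ≡ 0 → inv w u x ≡ false
occ-0-inv [] x p = refl
occ-0-inv (a ∷ w) {u} x p with a ≟ u
... | no _ = occ-0-inv w x p

occ-suc-split : ∀ {n} (w : List (Fin n)) {u k} → occurrences w u ≡ suc k →
  ∃ λ P → ∃ λ R → w ≡ P ++ u ∷ R × occurrences P u ≡ 0 × occurrences R u ≡ k
occ-suc-split (a ∷ w) {u} p with a ≟ u
... | yes refl = [] , w , refl , refl , suc-injective p
... | no ne = let (P , R , q , r , s) = occ-suc-split w p in
  a ∷ P , R , cong (a ∷_) q , trans (occ-∷-≢ P ne) r , s

subword-occ : ∀ {n} {ys w : List (Fin n)} → ys ⊆ w → ∀ u → occurrences ys u ≤ occurrences w u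
subword-occ [] u = z≤n
subword-occ (y ∷ʳ p) u with y ≟ u
... | yes _ = ℕ.m≤n⇒m≤1+n (subword-occ p u)
... | no _  = subword-occ p u
subword-occ (_∷_ {y} refl p) u with y ≟ u
... | yes _ = s≤s (subword-occ p u)
... | no _  = subword-occ p u

subword-odd : ∀ {n} {ys w : List (Fin n)} {u} → occurrences ys u ≡ occurrences w u → odd w u ≡ odd ys u
subword-odd {ys = ys} {w} {u} p = trans (odd-occurrences w u) (trans (cong parity (sym p)) (sym (odd-occurrences ys u)))

-- Other letters contribute nothing, so `inv` can be computed on any subword that keeps all
-- occurrences of `u` and `v`, in particular on four alternating letters.
subword-inv : ∀ {n} {ys w : List (Fin n)} {u v} → ys ⊆ w → occurrences ys u ≡ occurrences w u →
  occurrences ys v ≡ occurrences w v → inv w u v ≡ inv ys u v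
subword-inv [] p q = refl
subword-inv {u = u} {v} (_∷ʳ_ {ys} {w} y s) p q with y ≟ u | y ≟ v
... | yes _ | _ = ⊥-elim (ℕ.<-irrefl p (s≤s (subword-occ s u)))
... | no _ | yes _ = ⊥-elim (ℕ.<-irrefl q (s≤s (subword-occ s v)))
... | no _ | no _ = subword-inv s p q
subword-inv {u = u} {v} (_∷_ {y} {ys} {_} {w} refl s) p q = cong₂ (λ b c → (eqb y u ∧ b) xor c)
  (subword-odd {ys = ys} {w} (tail-occ v q)) (subword-inv s (tail-occ u p) (tail-occ v q))
  where
  tail-occ : ∀ x → occurrences (y ∷ ys) x ≡ occurrences (y ∷ w) x → occurrences ys x ≡ occurrences w x
  tail-occ x r with y ≟ x
  ... | yes _ = suc-injective r
  ... | no _  = r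

odd-subword : ∀ {n} (w : List (Fin n)) {v} → odd w v ≡ true → (v ∷ []) ⊆ w
odd-subword (a ∷ w) {v} p with a ≟ v
... | yes refl = refl ∷ minimum w
... | no _ = a ∷ʳ odd-subword w p

inv-subword : ∀ {n} (w : List (Fin n)) {u v} → inv w u v ≡ true → (u ∷ v ∷ []) ⊆ w
inv-subword (a ∷ w) {u} {v} p with a ≟ u
... | no _ = a ∷ʳ inv-subword w p
... | yes refl with odd w v in e
...   | true  = refl ∷ odd-subword w e
...   | false = a ∷ʳ inv-subword w p

Alternating : ∀ {n} → List (Fin n) → Fin n → Fin n → Set
Alternating w u v = (u ∷ v ∷ u ∷ v ∷ []) ⊆ w ⊎ (v ∷ u ∷ v ∷ u ∷ []) ⊆ w

-- A scan of the word whose state is the pair of parities still to come; `after-first` is the state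
-- in which one of the two letters is unmatched. Only parities are assumed, because suffixes of a
-- double occurrence word need not be of that kind.
inv-alternating : ∀ {n} (w : List (Fin n)) {u v} → u ≢ v →
  odd w u ≡ false → odd w v ≡ false → inv w u v ≡ true → Alternating w u v
after-first : ∀ {n} (w : List (Fin n)) {u v} → u ≢ v →
  odd w u ≡ true → odd w v ≡ false → inv w u v ≡ true → (v ∷ u ∷ v ∷ []) ⊆ w

inv-alternating (a ∷ w) {u} {v} ne p q i with a ≟ u | a ≟ v
... | yes refl | yes e = ⊥-elim (ne e)
... | yes refl | no _ = inj₁ (refl ∷ after-first w ne (not-false p) q (trans (cong (_xor inv w u v) (sym q)) i))
... | no _ | yes refl = inj₂ (refl ∷ after-first w (ne ∘ sym) (not-false q) p
        (flip-inv (inv w u v) (inv w v u) i (trans (inv-sym w ne) (cong (_∧ odd w v) p))))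
  where
  flip-inv : ∀ a b → a ≡ true → a xor b ≡ false → b ≡ true
  flip-inv true true _ _ = refl
... | no _ | no _ with inv-alternating w ne p q i
...   | inj₁ s = inj₁ (a ∷ʳ s)
...   | inj₂ s = inj₂ (a ∷ʳ s)

after-first (a ∷ w) {u} {v} ne p q i with a ≟ u | a ≟ v
... | yes refl | yes e = ⊥-elim (ne e)
... | no _ | yes refl = refl ∷ inv-subword w i
... | no _ | no _ = a ∷ʳ after-first w ne p q i
... | yes refl | no _ with inv-alternating w ne (not-true p) q (trans (cong (_xor inv w u v) (sym q)) i)
...   | inj₁ s = a ∷ʳ ⊆-trans (u ∷ʳ ⊆-refl) s
...   | inj₂ s = a ∷ʳ ⊆-trans (refl ∷ refl ∷ refl ∷ (u ∷ʳ [])) s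

alternating-inv : ∀ {n} (w : List (Fin n)) {u v} → u ≢ v → IsDoubleOccurrence w → Alternating w u v → inv w u v ≡ true
alternating-inv w {u} {v} ne d (inj₁ s) = trans (subword-inv s (trans (occ-u ne) (sym (d u))) (trans (occ-v ne) (sym (d v)))) (value ne)
  where
  occ-u : ∀ {u v} → u ≢ v → occurrences (u ∷ v ∷ u ∷ v ∷ []) u ≡ 2
  occ-u {u} {v} ne rewrite occ-∷-≡ u (v ∷ u ∷ v ∷ []) | occ-∷-≢ (u ∷ v ∷ []) (ne ∘ sym) | occ-∷-≡ u (v ∷ []) | occ-∷-≢ [] (ne ∘ sym) = refl
  occ-v : ∀ {u v} → u ≢ v → occurrences (u ∷ v ∷ u ∷ v ∷ []) v ≡ 2
  occ-v {u} {v} ne rewrite occ-∷-≢ (v ∷ u ∷ v ∷ []) ne | occ-∷-≡ v (u ∷ v ∷ []) | occ-∷-≢ (v ∷ []) ne | occ-∷-≡ v [] = refl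
  value : ∀ {u v} → u ≢ v → inv (u ∷ v ∷ u ∷ v ∷ []) u v ≡ true
  value {u} {v} ne rewrite eqb-refl′ u | eqb-refl′ v | eqb-≢ ne | eqb-≢ (ne ∘ sym) = refl
alternating-inv w {u} {v} ne d (inj₂ s) = xor-true (alternating-inv w (ne ∘ sym) d (inj₁ s))
  (trans (inv-sym w (ne ∘ sym)) (cong (_∧ odd w u) (trans (odd-occurrences w v) (cong parity (d v)))))
  where
  xor-true : ∀ {a b} → a ≡ true → a xor b ≡ false → b ≡ true
  xor-true {b = true} refl _ = refl

drop-lookup : ∀ {A : Set} (w : List A) i → drop (toℕ i) w ≡ lookup w i ∷ drop (suc (toℕ i)) w
drop-lookup (a ∷ w) zero    = refl
drop-lookup (a ∷ w) (suc i) = drop-lookup w i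

drop-⊆ : ∀ {A : Set} m (w : List A) → drop m w ⊆ w
drop-⊆ zero    w       = ⊆-refl
drop-⊆ (suc m) []      = []
drop-⊆ (suc m) (a ∷ w) = a ∷ʳ drop-⊆ m w

drop-mono : ∀ {A : Set} {l m} (w : List A) → l ≤ m → drop m w ⊆ drop l w
drop-mono {m = m} w z≤n = drop-⊆ m w
drop-mono []      (s≤s p) = []
drop-mono (a ∷ w) (s≤s p) = drop-mono w p

altUV-subword : ∀ {n} {w : List (Fin n)} {u v} → AltUV w u v → (u ∷ v ∷ u ∷ v ∷ []) ⊆ w
altUV-subword {w = w} (i , j , k , l , i<j , j<k , k<l , refl , refl , p , q) =
  ⊆-trans (at i refl i<j (at j refl j<k (at k p k<l (at-last l q)))) (drop-⊆ (toℕ i) w)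
  where
  at-last : ∀ i {x} → lookup w i ≡ x → (x ∷ []) ⊆ drop (toℕ i) w
  at-last i refl rewrite drop-lookup w i = refl ∷ minimum _
  at : ∀ i {j : Fin (length w)} {x ys} → lookup w i ≡ x → i Fin.< j → ys ⊆ drop (toℕ j) w → (x ∷ ys) ⊆ drop (toℕ i) w
  at i refl lt s rewrite drop-lookup w i = refl ∷ ⊆-trans s (drop-mono w lt)

position : ∀ {A : Set} {ys w : List A} → ys ⊆ w → Fin (length ys) → Fin (length w)
position (y ∷ʳ s) i       = suc (position s i)
position (_ ∷ s)  zero    = zero
position (_ ∷ s)  (suc i) = suc (position s i)

position-mono : ∀ {A : Set} {ys w : List A} (s : ys ⊆ w) {i j} → i Fin.< j → position s i Fin.< position s j
position-mono (y ∷ʳ s) lt = s≤s (position-mono s lt)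
position-mono (_ ∷ s) {zero}  {suc j} lt = s≤s z≤n
position-mono (_ ∷ s) {suc i} {suc j} (s≤s lt) = s≤s (position-mono s lt)

position-lookup : ∀ {A : Set} {ys w : List A} (s : ys ⊆ w) i → lookup w (position s i) ≡ lookup ys i
position-lookup (y ∷ʳ s)  i       = position-lookup s i
position-lookup (refl ∷ s) zero   = refl
position-lookup (refl ∷ s) (suc i) = position-lookup s i

subword-altUV : ∀ {n} {w : List (Fin n)} {u v} → (u ∷ v ∷ u ∷ v ∷ []) ⊆ w → AltUV w u v
subword-altUV s = position s zero , position s (suc zero) , position s (suc (suc zero)) , position s (suc (suc (suc zero))) ,
  position-mono s (s≤s z≤n) , position-mono s (s≤s (s≤s z≤n)) , position-mono s (s≤s (s≤s (s≤s z≤n))) ,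
  position-lookup s zero , position-lookup s (suc zero) , position-lookup s (suc (suc zero)) , position-lookup s (suc (suc (suc zero)))

-- Alternance as an algebraic condition, which makes local complementation a computation. It is
-- confined to distinct letters because a letter occurring twice forms one pair with itself, while
-- adjacency is irreflexive.
record InvWord {n} (G : BGraph n) : Set where
  constructor invWord
  field
    word   : List (Fin n)
    double : IsDoubleOccurrence word
    agrees : ∀ {u v} → u ≢ v → adj G u v ≡ inv word u v

alternance⇒invWord : ∀ {n} {G : BGraph n} → Alternance G → InvWord G
alternance⇒invWord {G = G} (w , d , alt) = invWord w d λ {u} {v} → agrees u v
  where
  even : ∀ u → odd w u ≡ false
  even u = trans (odd-occurrences w u) (cong parity (d u))
  agrees : ∀ u v → u ≢ v → adj G u v ≡ inv w u v
  agrees u v ne with inv w u v in i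
  ... | true = proj₂ (alt u v) (Sum.map subword-altUV subword-altUV (inv-alternating w ne (even u) (even v) i))
  ... | false = ≢true⇒≡false λ e → true≢false
        (alternating-inv w ne d (Sum.map altUV-subword altUV-subword (proj₁ (alt u v) e))) i

invWord⇒alternance : ∀ {n} {G : BGraph n} → InvWord G → Alternance G
invWord⇒alternance {G = G} (invWord w d agrees) = w , d , λ u v → forth u v , back u v
  where
  even : ∀ u → odd w u ≡ false
  even u = trans (odd-occurrences w u) (cong parity (d u))
  forth : ∀ u v → adj G u v ≡ true → AltUV w u v ⊎ AltUV w v u
  forth u v e = let ne = adjacent-≢ G e in
    Sum.map subword-altUV subword-altUV (inv-alternating w ne (even u) (even v) (trans (sym (agrees ne)) e))
  four : ∀ u → ¬ ((u ∷ u ∷ u ∷ u ∷ []) ⊆ w)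
  four u s = ℕ.<⇒≱ {2} {4} (s≤s (s≤s (s≤s z≤n))) (≤-trans (≤-reflexive (sym four≡)) (≤-trans (subword-occ s u) (≤-reflexive (d u))))
    where
    four≡ : occurrences (u ∷ u ∷ u ∷ u ∷ []) u ≡ 4
    four≡ rewrite occ-∷-≡ u (u ∷ u ∷ u ∷ []) | occ-∷-≡ u (u ∷ u ∷ []) | occ-∷-≡ u (u ∷ []) | occ-∷-≡ u [] = refl
  back : ∀ u v → AltUV w u v ⊎ AltUV w v u → adj G u v ≡ true
  back u v a with u ≟ v
  ... | no ne = trans (agrees ne) (alternating-inv w ne d (Sum.map altUV-subword altUV-subword a))
  back u v (inj₁ a) | yes refl = ⊥-elim (four u (altUV-subword a))
  back u v (inj₂ a) | yes refl = ⊥-elim (four u (altUV-subword a))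

invWord-≗ : ∀ {n} {G H : BGraph n} → (∀ u v → adj G u v ≡ adj H u v) → InvWord G → InvWord H
invWord-≗ p (invWord w d a) = invWord w d λ {u} {v} ne → trans (sym (p u v)) (a ne)

-- Local complementation at u reverses the segment between the two occurrences of u.
invWord-lc : ∀ {n} (G : BGraph n) u → InvWord G → InvWord (lc G u)
invWord-lc {n} G u (invWord w d agrees) with occ-suc-split w (d u)
... | P , R₀ , refl , P0 , R1 with occ-suc-split R₀ R1
...   | Q , R , refl , Q0 , R0 = invWord (word (reverse Q)) double agrees′
  where
  word : List (Fin n) → List (Fin n)
  word S = P ++ u ∷ S ++ u ∷ R
  occ-word : ∀ x → occurrences (word (reverse Q)) x ≡ occurrences (word Q) x
  occ-word x = trans (occ-++ P _ x) (trans (cong (occurrences P x +_) middle) (sym (occ-++ P _ x)))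
    where
    middle : occurrences (u ∷ reverse Q ++ u ∷ R) x ≡ occurrences (u ∷ Q ++ u ∷ R) x
    middle = trans (occ-++ (u ∷ []) (reverse Q ++ u ∷ R) x) (trans
      (cong (occurrences (u ∷ []) x +_) (trans (occ-++ (reverse Q) (u ∷ R) x) (trans
        (cong (_+ occurrences (u ∷ R) x) (occ-reverse Q x)) (sym (occ-++ Q (u ∷ R) x)))))
      (sym (occ-++ (u ∷ []) (Q ++ u ∷ R) x)))
  double : IsDoubleOccurrence (word (reverse Q))
  double x = trans (occ-word x) (d x)
  inv-word : ∀ S x y → inv (word S) x y ≡
    (inv P x y xor (odd P x ∧ (eqb u y xor (odd S y xor (eqb u y xor odd R y))))) xor
    ((eqb u x ∧ (odd S y xor (eqb u y xor odd R y))) xor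
     ((inv S x y xor (odd S x ∧ (eqb u y xor odd R y))) xor ((eqb u x ∧ odd R y) xor inv R x y)))
  inv-word S x y rewrite inv-++ P (u ∷ S ++ u ∷ R) x y | inv-++ S (u ∷ R) x y | odd-++ S (u ∷ R) y = refl
  neighbour : ∀ x → adj G u x ≡ odd Q x
  neighbour x with u ≟ x
  ... | yes refl = trans (adj-irr G u) (sym (occ-0-odd Q Q0))
  ... | no ne = trans (agrees ne) (trans (inv-word Q u x) value)
    where
    value : (inv P u x xor (odd P u ∧ (eqb u x xor (odd Q x xor (eqb u x xor odd R x))))) xor
      ((eqb u u ∧ (odd Q x xor (eqb u x xor odd R x))) xor
      ((inv Q u x xor (odd Q u ∧ (eqb u x xor odd R x))) xor ((eqb u u ∧ odd R x) xor inv R u x))) ≡ odd Q x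
    value rewrite occ-0-inv P x P0 | occ-0-odd P P0 | eqb-refl′ u | eqb-≢ ne | occ-0-inv Q x Q0 | occ-0-odd Q Q0 | occ-0-inv R x R0 =
      truthTable 2 (λ a b → (a xor b) xor (b xor false)) (λ a b → a) tt (odd Q x) (odd R x)
  -- Reversal exchanges the arguments of `inv Q`. By `inv-sym` this changes it by the product of two
  -- parities in `Q`, and odd parity in `Q` means adjacency to `u`.
  agrees′ : ∀ {x y} → x ≢ y → lcAdj G u x y ≡ inv (word (reverse Q)) x y
  agrees′ {x} {y} ne = trans (lcAdj-off G u ne) (trans
    (cong₂ _xor_ (trans (agrees ne) (inv-word Q x y)) (trans (cong₂ _∧_ (neighbour x) (neighbour y)) (sym (inv-sym Q ne)))) (trans
    (rearrange (inv P x y xor (odd P x ∧ (eqb u y xor (odd Q y xor (eqb u y xor odd R y)))))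
      (eqb u x ∧ (odd Q y xor (eqb u y xor odd R y))) (inv Q x y) (odd Q x ∧ (eqb u y xor odd R y))
      ((eqb u x ∧ odd R y) xor inv R x y) (inv Q y x))
    (sym reversed)))
    where
    rearrange : ∀ a b i c e j → (a xor (b xor ((i xor c) xor e))) xor (i xor j) ≡ a xor (b xor ((j xor c) xor e))
    rearrange = truthTable 6 (λ a b i c e j → (a xor (b xor ((i xor c) xor e))) xor (i xor j)) (λ a b i c e j → a xor (b xor ((j xor c) xor e))) tt
    reversed : inv (word (reverse Q)) x y ≡
      (inv P x y xor (odd P x ∧ (eqb u y xor (odd Q y xor (eqb u y xor odd R y))))) xor
      ((eqb u x ∧ (odd Q y xor (eqb u y xor odd R y))) xor
       ((inv Q y x xor (odd Q x ∧ (eqb u y xor odd R y))) xor ((eqb u x ∧ odd R y) xor inv R x y)))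
    reversed rewrite inv-word (reverse Q) x y | odd-reverse Q x | odd-reverse Q y | inv-reverse Q x y = refl

-- Induced subgraphs and the pieces of a split are alternance graphs

module _ {n k} (e : Fin k → Fin n) (e-inj : Injective _≡_ _≡_ e) where

  pullWord : List (Fin n) → List (Fin k)
  pullWord [] = []
  pullWord (a ∷ w) with any? (λ i → e i ≟ a)
  ... | yes (i , _) = i ∷ pullWord w
  ... | no _        = pullWord w

  eqb-inj : ∀ i j → eqb i j ≡ eqb (e i) (e j)
  eqb-inj i j with i ≟ j | e i ≟ e j
  ... | yes _ | yes _ = refl
  ... | no _  | no _  = refl
  ... | yes p | no ne = ⊥-elim (ne (cong e p))
  ... | no ne | yes p = ⊥-elim (ne (e-inj p))

  odd-pull : ∀ w j → odd (pullWord w) j ≡ odd w (e j)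
  odd-pull [] j = refl
  odd-pull (a ∷ w) j with any? (λ i → e i ≟ a)
  ... | yes (i , refl) = cong₂ _xor_ (eqb-inj i j) (odd-pull w j)
  ... | no none = trans (odd-pull w j) (cong (_xor odd w (e j)) (sym (eqb-≢ {x = a} {e j} λ p → none (j , sym p))))

  inv-pull : ∀ w i j → inv (pullWord w) i j ≡ inv w (e i) (e j)
  inv-pull [] i j = refl
  inv-pull (a ∷ w) i j with any? (λ i → e i ≟ a)
  ... | yes (h , refl) = cong₂ _xor_ (cong₂ _∧_ (eqb-inj h i) (odd-pull w j)) (inv-pull w i j)
  ... | no none = trans (inv-pull w i j) (cong (λ b → (b ∧ odd w (e j)) xor inv w (e i) (e j)) (sym (eqb-≢ {x = a} {e i} λ p → none (i , sym p))))

  occ-pull : ∀ w j → occurrences (pullWord w) j ≡ occurrences w (e j)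
  occ-pull [] j = refl
  occ-pull (a ∷ w) j with any? (λ i → e i ≟ a)
  ... | no none = trans (occ-pull w j) (sym (occ-∷-≢ w λ p → none (j , sym p)))
  ... | yes (i , refl) with i ≟ j
  ...   | yes refl = trans (cong suc (occ-pull w j)) (sym (occ-∷-≡ (e j) w))
  ...   | no ne = trans (occ-pull w j) (sym (occ-∷-≢ w (ne ∘ e-inj)))

  invWord-induced : ∀ {G : BGraph n} {H : BGraph k} → (∀ i j → adj H i j ≡ adj G (e i) (e j)) → InvWord G → InvWord H
  invWord-induced p (invWord w d a) = invWord (pullWord w) (λ j → trans (occ-pull w j) (d (e j)))
    λ {i} {j} ne → trans (p i j) (trans (a (ne ∘ e-inj)) (sym (inv-pull w i j)))

module _ {k : ℕ} where

  odd-map-suc : ∀ (w : List (Fin k)) j → odd (map suc w) (suc j) ≡ odd w j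
  odd-map-suc [] j = refl
  odd-map-suc (a ∷ w) j = cong₂ _xor_ (sym (eqb-inj suc Fin.suc-injective a j)) (odd-map-suc w j)

  inv-map-suc : ∀ (w : List (Fin k)) i j → inv (map suc w) (suc i) (suc j) ≡ inv w i j
  inv-map-suc [] i j = refl
  inv-map-suc (a ∷ w) i j = cong₂ _xor_ (cong₂ _∧_ (sym (eqb-inj suc Fin.suc-injective a i)) (odd-map-suc w j)) (inv-map-suc w i j)

  occ-map-suc : ∀ (w : List (Fin k)) j → occurrences (map suc w) (suc j) ≡ occurrences w j
  occ-map-suc [] j = refl
  occ-map-suc (a ∷ w) j with a ≟ j
  ... | yes refl = cong suc (occ-map-suc w j)
  ... | no ne = occ-map-suc w j

  occ-map-suc-zero : ∀ (w : List (Fin k)) → occurrences (map suc w) zero ≡ 0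
  occ-map-suc-zero [] = refl
  occ-map-suc-zero (a ∷ w) = occ-map-suc-zero w

  invWord-isolated : (Q : BGraph (suc k)) → (∀ v → adj Q zero (suc v) ≡ false) → InvWord (deleteRoot Q) → InvWord Q
  invWord-isolated Q isolated (invWord w d a) = invWord (zero ∷ zero ∷ map suc w) double (agrees _ _)
    where
    double : IsDoubleOccurrence (zero ∷ zero ∷ map suc w)
    double zero    = cong (2 +_) (occ-map-suc-zero w)
    double (suc j) = trans (occ-map-suc w j) (d j)
    zero-row : ∀ j → inv (zero ∷ zero ∷ map suc w) zero (suc j) ≡ false
    zero-row j = trans (cong (λ b → odd (map suc w) (suc j) xor (odd (map suc w) (suc j) xor b)) (occ-0-inv (map suc w) (suc j) (occ-map-suc-zero w)))
      (truthTable 1 (λ a → a xor (a xor false)) (λ _ → false) tt (odd (map suc w) (suc j)))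
    column : ∀ i → inv (map suc w) (suc i) zero ≡ false
    column i = trans (sym (cong (_xor inv (map suc w) (suc i) zero) (occ-0-inv (map suc w) (suc i) (occ-map-suc-zero w))))
      (trans (inv-sym (map suc w) {zero} {suc i} λ ()) (cong (_∧ odd (map suc w) (suc i)) (occ-0-odd (map suc w) (occ-map-suc-zero w))))
    agrees : ∀ u v → u ≢ v → adj Q u v ≡ inv (zero ∷ zero ∷ map suc w) u v
    agrees zero zero ne = ⊥-elim (ne refl)
    agrees zero (suc j) ne = trans (isolated j) (sym (zero-row j))
    agrees (suc i) zero ne = trans (adj-sym Q (suc i) zero) (trans (isolated i) (sym (column i)))
    agrees (suc i) (suc j) ne = trans (a (ne ∘ cong suc)) (sym (inv-map-suc w i j))

-- If an edge crosses the split, a crossing vertex of the other side can play the marker, and the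
-- rooted graph is an induced subgraph of `G`. Otherwise the marker is isolated and is added to the
-- word as two consecutive letters.
invWord-side : ∀ {n} {G : BGraph n} (s : Split G) → InvWord G → InvWord (side₁ s)
invWord-side {n} {G} s iw with any? (λ b → adj (side₂ s) zero (suc b) Bool.≟ true)
... | yes (b , gb) = invWord-induced e e-inj agrees iw
  where
  e : Fin (suc (k₁ s)) → Fin n
  e = e₂ s b ◂ e₁ s
  e-inj : Injective _≡_ _≡_ e
  e-inj {zero}  {zero}  p = refl
  e-inj {zero}  {suc a} p = ⊥-elim (disjoint s a b (sym p))
  e-inj {suc a} {zero}  p = ⊥-elim (disjoint s a b p)
  e-inj {suc a} {suc c} p = cong suc (e₁-inj s p)
  root : ∀ a → adj (side₁ s) zero (suc a) ≡ adj G (e₁ s a) (e₂ s b)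
  root a = sym (trans (adj-cross s a b) (trans (cong (adj (side₁ s) zero (suc a) ∧_) gb) (∧-identityʳ _)))
  agrees : ∀ i j → adj (side₁ s) i j ≡ adj G (e i) (e j)
  agrees zero zero = sym (adj-irr G (e₂ s b))
  agrees zero (suc a) = trans (root a) (adj-sym G _ _)
  agrees (suc a) zero = root a
  agrees (suc a) (suc c) = refl
... | no none = invWord-isolated (side₁ s)
    (λ a → ≢true⇒≡false λ e → none (crossing s e))
    (invWord-induced (e₁ s) (e₁-inj s) (λ _ _ → refl) iw)

invWord-deleteRoot : ∀ {k} (Q : BGraph (suc k)) → InvWord Q → InvWord (deleteRoot Q)
invWord-deleteRoot Q = invWord-induced suc Fin.suc-injective (λ _ _ → refl)

invWord-rootPiece : ∀ u {k} (Q : BGraph (suc k)) → InvWord Q → InvWord (rootPiece u Q)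
invWord-rootPiece ta Q iw = invWord-≗ (λ _ _ → refl) (invWord-lc (setRootColour white Q) zero (invWord-≗ (λ _ _ → refl) iw))
invWord-rootPiece tb Q iw = invWord-≗ (λ _ _ → refl) iw
invWord-rootPiece tc Q iw = invWord-≗ (λ _ _ → refl) iw

invWord-lb : ∀ {k} (Q : BGraph (suc k)) → InvWord Q → InvWord (lb Q)
invWord-lb Q iw = invWord-deleteRoot _ (invWord-lc (setRootColour white Q) zero (invWord-≗ (λ _ _ → refl) iw))

invWord-lcv : ∀ {k} (Q : BGraph (suc k)) v → InvWord Q → InvWord (lcv v Q)
invWord-lcv Q v iw = invWord-deleteRoot (brace (setRootColour black Q) zero v) braced
  where
  H = setRootColour black Q
  braced : InvWord (brace H zero v)
  braced with colour H v
  ... | white = invWord-lc (lc H v) zero (invWord-lc H v (invWord-≗ (λ _ _ → refl) iw))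
  ... | black = invWord-lc (lc (lc H v) zero) v (invWord-lc (lc H v) zero (invWord-lc H v (invWord-≗ (λ _ _ → refl) iw)))

-- Purity of the two pieces of an essential decomposition

-- With A = Th Q and I = In Q below, Only A u says that the piece rw, rb or rc of Q given
-- by u is pure; A is loose when all six pieces of Q are impure.
Only : (Transition → Set) → Transition → Set
Only A u = ∀ p → p ≢ u → ¬ A p

Tight Loose : (Transition → Set) → Set → Set
Tight A I = ∃ (Only A) × ¬ (I × ∃ A)
Loose A I = ∃ λ p → ∃ λ q → p ≢ q × A p × A q × (I ⊎ ∃ λ r → r ≢ p × r ≢ q × A r)

two-or-only : (A : Transition → Set) → ((∃ λ p → ∃ λ q → p ≢ q × A p × A q) → ⊥) → (∃ (Only A) → ⊥) → ⊥
two-or-only A noTwo noOnly = ¬¬-excluded-middle {A = ∃ A} λ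
  { (no none) → noOnly (ta , λ p _ Ap → none (p , Ap))
  ; (yes (u , Au)) → noOnly (u , λ p ne Ap → noTwo (p , u , ne , Ap , Au)) }

pigeonhole : ∀ {p q r s : Transition} → p ≢ q → r ≢ s → r ≢ p → r ≢ q → s ≢ p → s ≢ q → ⊥
pigeonhole {p} {q} {r} {s} p≢q r≢s a b c d = r≢s (trans (third p q r p≢q a b) (sym (third p q s p≢q c d)))
  where
  other : Transition → Transition → Transition
  other ta ta = ta
  other ta tb = tc
  other ta tc = tb
  other tb ta = tc
  other tb tb = tb
  other tb tc = ta
  other tc ta = tb
  other tc tb = ta
  other tc tc = tc
  third : ∀ p q r → p ≢ q → r ≢ p → r ≢ q → r ≡ other p q
  third ta ta r  x y z = ⊥-elim (x refl)
  third tb tb r  x y z = ⊥-elim (x refl)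
  third tc tc r  x y z = ⊥-elim (x refl)
  third ta tb ta x y z = ⊥-elim (y refl)
  third ta tb tb x y z = ⊥-elim (z refl)
  third ta tb tc x y z = refl
  third ta tc ta x y z = ⊥-elim (y refl)
  third ta tc tb x y z = refl
  third ta tc tc x y z = ⊥-elim (z refl)
  third tb ta ta x y z = ⊥-elim (z refl)
  third tb ta tb x y z = ⊥-elim (y refl)
  third tb ta tc x y z = refl
  third tb tc ta x y z = refl
  third tb tc tb x y z = ⊥-elim (y refl)
  third tb tc tc x y z = ⊥-elim (z refl)
  third tc ta ta x y z = ⊥-elim (z refl)
  third tc ta tb x y z = refl
  third tc ta tc x y z = ⊥-elim (y refl)
  third tc tb ta x y z = refl
  third tc tb tb x y z = ⊥-elim (z refl)
  third tc tb tc x y z = ⊥-elim (y refl)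

another : (u : Transition) → ∃ λ v → v ≢ u
another ta = tb , λ ()
another tb = ta , λ ()
another tc = ta , λ ()

module _ {A B : Transition → Set} {I J : Set}
  (disjoint : ∀ p → A p → B p → ⊥) (exclusive : I → J → ⊥)
  (good : ∀ u → Only A u → ¬ B u → ¬ J → ⊥) (good′ : ∀ u → Only B u → ¬ A u → ¬ I → ⊥)
  (bad : Tight A I → Loose B J → ⊥) where

  -- Suppose `J` fails. Any `p` with `A p` serves `good`; if there is none, `good` forces all three
  -- transitions into `B`, which is then loose. Suppose `J` holds, so that `I` fails. Either `B` has
  -- two transitions and is loose, or `B` is confined to one and `good′` applies, if need be at a
  -- transition that neither side has. Both exits to `bad` exclude having `I` together with some
  -- `A p`, as `Tight` demands.
  only-impossible : ∃ (Only A) → ⊥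
  only-impossible (t , only) = ¬¬-excluded-middle {A = J} λ
    { (no noJ) → ¬¬-excluded-middle {A = ∃ A} λ
        { (yes (p , Ap)) → good p (λ q ne Aq → unique q p ne Aq Ap) (disjoint p Ap) noJ
        ; (no none) →
          let vacuous : ∀ u → ¬ ¬ B u
              vacuous u noB = good u (λ p _ Ap → none (p , Ap)) noB noJ
          in vacuous ta λ Ba → vacuous tb λ Bb → vacuous tc λ Bc →
             bad ((t , only) , λ { (_ , p , Ap) → none (p , Ap) })
               (ta , tb , (λ ()) , Ba , Bb , inj₂ (tc , (λ ()) , (λ ()) , Bc)) }
    ; (yes J!) → let noI = λ i → exclusive i J! in
      two-or-only B
        (λ { (p , q , ne , Bp , Bq) → bad ((t , only) , noI ∘ proj₁) (p , q , ne , Bp , Bq , inj₁ J!) })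
        (λ { (t′ , onlyB) → ¬¬-excluded-middle {A = A t′} λ
          { (no noA) → good′ t′ onlyB noA noI
          ; (yes At′) → let (v , ne) = another t′ in
              good′ v (λ p _ Bp → onlyB p (λ { refl → disjoint t′ At′ Bp }) Bp)
                (λ Av → unique v t′ ne Av At′) noI } }) }
    where
    unique : ∀ p q → p ≢ q → A p → A q → ⊥
    unique p q ne Ap Aq = only p (λ { refl → only q (ne ∘ sym) Aq }) Ap

-- Two transitions on each side would have one in common among the three, so one side is confined to
-- a single transition.
dichotomy : ∀ {A B : Transition → Set} {I J : Set} →
  (∀ p → A p → B p → ⊥) → (I → J → ⊥) →
  (∀ u → Only A u → ¬ B u → ¬ J → ⊥) → (∀ u → Only B u → ¬ A u → ¬ I → ⊥) →
  (Tight A I → Loose B J → ⊥) → (Tight B J → Loose A I → ⊥) → ⊥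
dichotomy {A} {B} disj excl good good′ bad bad′ =
  two-or-only A
    (λ { (p , q , p≢q , Ap , Aq) → two-or-only B
      (λ { (r , s , r≢s , Br , Bs) → pigeonhole p≢q r≢s
        (λ { refl → disj r Ap Br }) (λ { refl → disj r Aq Br }) (λ { refl → disj s Ap Bs }) (λ { refl → disj s Aq Bs }) })
      (only-impossible (λ p Bp Ap → disj p Ap Bp) (λ j i → excl i j) good′ good bad′) })
    (only-impossible disj excl good good′ bad)

Only-swap : ∀ {A : Transition → Set} {u} → Only (A ∘ swapAB) u → Only A (swapAB u)
Only-swap {A} {u} only p ne Ap = only (swapAB p) (λ { refl → ne (sym (swapAB-involutive p)) })
  (subst A (sym (swapAB-involutive p)) Ap)

swapAB-≢ : ∀ {p q} → p ≢ q → swapAB p ≢ swapAB q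
swapAB-≢ {p} {q} ne e = ne (trans (sym (swapAB-involutive p)) (trans (cong swapAB e) (swapAB-involutive q)))

Tight-swap : ∀ {A I} → Tight (A ∘ swapAB) I → Tight A I
Tight-swap {A} ((u , only) , no-both) = (swapAB u , Only-swap only) , λ { (i , p , Ap) →
  no-both (i , swapAB p , subst A (sym (swapAB-involutive p)) Ap) }

Loose-swap : ∀ {A I} → Loose (A ∘ swapAB) I → Loose A I
Loose-swap (p , q , ne , Ap , Aq , more) = swapAB p , swapAB q , swapAB-≢ ne , Ap , Aq ,
  Sum.map₂ (λ { (r , r≢p , r≢q , Ar) → swapAB r , swapAB-≢ r≢p , swapAB-≢ r≢q , Ar }) more

Th : ∀ {k} → BGraph (suc k) → Transition → Set
Th Q = Through Q (tagOf Q ∘ suc)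

In : ∀ {k} → BGraph (suc k) → Set
In Q = Inside Q (tagOf Q ∘ suc)

Leaf : ∀ {k} → BGraph (suc k) → Transition → Set
Leaf Q u = ¬ Th Q u × ¬ In Q

pure-rootPiece⁻ : ∀ u {k} (Q : BGraph (suc k)) → Pure (rootPiece u Q) → Only (Th Q) u
pure-rootPiece⁻ u Q pure p ne th = pure⇒¬cover _ pure (cover-root (rootPiece-LocEq u Q) ne th)

pure-rootPiece : ∀ u {k} (Q : BGraph (suc k)) → Only (Th Q) u → Pure (rootPiece u Q)
pure-rootPiece u Q only = ¬cover⇒pure λ cov → let (p , ne , th) = cover-root⁻ (rootPiece-LocEq u Q) cov in only p ne th

module _ {k} {Q X : BGraph (suc k)} {t u} (e : LocEq Q (t ◂ (tagOf Q ∘ suc)) X (tagOf X)) (root : to (ψ e zero) u ≡ ta) where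

  pure-leaf⁻ : Pure (deleteRoot X) → Leaf Q u
  pure-leaf⁻ pure = (λ th → pure⇒¬cover _ pure (through⇒cover-deleteRoot e root th)) ,
                    (λ i → pure⇒¬cover _ pure (inside⇒cover-deleteRoot e root i))

  pure-leaf : Leaf Q u → Pure (deleteRoot X)
  pure-leaf (noTh , noIn) = ¬cover⇒pure (¬cover-deleteRoot e root noTh noIn)

lw-LocEq : ∀ {k} (Q : BGraph (suc k)) → Σ (LocEq Q (rootTag (tagOf Q zero) Q) Q (tagOf Q)) λ e → to (ψ e zero) ta ≡ ta
lw-LocEq Q = ≗-LocEq (λ _ _ → refl) (λ { zero → refl ; (suc v) → refl }) , refl

essPair-pure : ∀ {k l} (Qᵢ : BGraph (suc k)) (Qⱼ : BGraph (suc l)) → EssPair Pure Qᵢ Qⱼ →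
  ∃ λ u → Only (Th Qᵢ) u × Leaf Qⱼ (swapAB u)
essPair-pure Qᵢ Qⱼ (inj₁ (r , l)) = tb , pure-rootPiece⁻ tb Qᵢ r , (let (e , root) = lw-LocEq Qⱼ in pure-leaf⁻ e root l)
essPair-pure Qᵢ Qⱼ (inj₂ (inj₁ (r , l))) = tc , pure-rootPiece⁻ tc Qᵢ r , (let (e , root) = lb-LocEq Qⱼ in pure-leaf⁻ e root l)
essPair-pure Qᵢ Qⱼ (inj₂ (inj₂ (v , zv , r , l))) = ta , pure-rootPiece⁻ ta Qᵢ r , (let (e , root) = lcv-LocEq Qⱼ v zv in pure-leaf⁻ e root l)

essPair⇒pure : ∀ {n} {G : BGraph n} (s : Split G) → EssPair Pure (side₁ s) (side₂ s) → Pure G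
essPair⇒pure s pieces =
  let (u , only , noTh , noIn) = essPair-pure (side₁ s) (side₂ s) pieces in
  ¬cover⇒pure (¬cover-split s
    (λ p th₁ th₂ → only p (λ { refl → noTh th₂ }) th₁)
    (λ _ i → noIn i))

-- What the purity of a piece says about transitions, the form in which it contradicts `Loose`.
Barren : ∀ {k} → BGraph (suc k) → Set
Barren Q = ∃ λ u → Only (Th Q) u ⊎ Leaf Q u

essPair-barren : ∀ {k l} (Qᵢ : BGraph (suc k)) (Qⱼ : BGraph (suc l)) → EssPair Pure Qᵢ Qⱼ → Barren Qᵢ × Barren Qⱼ
essPair-barren Qᵢ Qⱼ p = let (u , only , leaf) = essPair-pure Qᵢ Qⱼ p in (u , inj₁ only) , (swapAB u , inj₂ leaf)

loose-¬barren : ∀ {k} {Q : BGraph (suc k)} → Loose (Th Q) (In Q) → ¬ Barren Q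
loose-¬barren (p , q , ne , Tp , Tq , _) (u , inj₁ only) = only p (λ { refl → only q (ne ∘ sym) Tq }) Tp
loose-¬barren (p , q , ne , Tp , Tq , inj₁ i) (u , inj₂ (_ , noIn)) = noIn i
loose-¬barren (p , q , ne , Tp , Tq , inj₂ (r , r≢p , r≢q , Tr)) (u , inj₂ (noTh , _)) =
  pigeonhole {p} {q} {r} {u} ne (λ { refl → noTh Tr }) r≢p r≢q (λ { refl → noTh Tp }) (λ { refl → noTh Tq })

-- Relabelling, parity classes and purity of closures

lcC : Colour → Bool → Colour → Colour
lcC white true d = flipC d
lcC white false d = d
lcC black b d = d

lcColour≡ : ∀ {n} (G : BGraph n) u x → lcColour G u x ≡ lcC (colour G u) (adj G u x) (colour G x)
lcColour≡ G u x with colour G u | adj G u x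
... | white | true  = refl
... | white | false = refl
... | black | true  = refl
... | black | false = refl

eqb-perm : ∀ {m n} (π : Permutation m n) x y → eqb x y ≡ eqb (π ⟨$⟩ˡ x) (π ⟨$⟩ˡ y)
eqb-perm π = eqb-inj (π ⟨$⟩ˡ_) λ {x} {y} p → trans (sym (inverseʳ π)) (trans (cong (π ⟨$⟩ʳ_) p) (inverseʳ π))

record _≅⟨_⟩_ {m n} (G : BGraph m) (π : Permutation m n) (H : BGraph n) : Set where
  constructor iso
  field relabelled : relabel π G ≈G H

module _ {m n} (π : Permutation m n) where

  lc-≅ : ∀ {G H} u → G ≅⟨ π ⟩ H → lc G u ≅⟨ π ⟩ lc H (π ⟨$⟩ʳ u)
  lc-≅ {G} {H} u (iso (p , q)) = iso (
    (λ x y → cong₂ (λ b c → if b then false else c) (sym (eqb-perm π x y))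
      (cong₂ _xor_ (p x y) (cong₂ _∧_ (adj-u x) (adj-u y)))) ,
    (λ x → trans (lcColour≡ G u (π ⟨$⟩ˡ x)) (trans
      (cong₂ (λ c f → f c) (trans (cong (colour G) (sym (inverseˡ π))) (q (π ⟨$⟩ʳ u)))
        (cong₂ (λ b d c → lcC c b d) (adj-u x) (q x)))
      (sym (lcColour≡ H (π ⟨$⟩ʳ u) x)))))
    where
    adj-u : ∀ x → adj G u (π ⟨$⟩ˡ x) ≡ adj H (π ⟨$⟩ʳ u) x
    adj-u x = trans (cong (λ v → adj G v (π ⟨$⟩ˡ x)) (sym (inverseˡ π))) (p (π ⟨$⟩ʳ u) x)

  applyW-≅ : ∀ {G H} s → G ≅⟨ π ⟩ H → applyW G s ≅⟨ π ⟩ applyW H (map (π ⟨$⟩ʳ_) s)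
  applyW-≅ [] p = p
  applyW-≅ (u ∷ s) p = applyW-≅ s (lc-≅ u p)

  colour-≅ : ∀ {G H} u {c} → G ≅⟨ π ⟩ H → colour G u ≡ c → colour H (π ⟨$⟩ʳ u) ≡ c
  colour-≅ {G} u (iso (_ , q)) e = trans (sym (q (π ⟨$⟩ʳ u))) (trans (cong (colour G) (inverseˡ π)) e)

  adj-≅ : ∀ {G H} u v {b} → G ≅⟨ π ⟩ H → adj G u v ≡ b → adj H (π ⟨$⟩ʳ u) (π ⟨$⟩ʳ v) ≡ b
  adj-≅ {G} u v (iso (p , _)) e = trans (sym (p (π ⟨$⟩ʳ u) (π ⟨$⟩ʳ v))) (trans (cong₂ (adj G) (inverseˡ π) (inverseˡ π)) e)

  parityWord-≅ : ∀ {G H} {s} → G ≅⟨ π ⟩ H → ParityWord G s → ParityWord H (map (π ⟨$⟩ʳ_) s)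
  parityWord-≅ p empty = empty
  parityWord-≅ {G} {H} p (whiteStep {s} u pw wu) = subst (ParityWord H) (sym (map-++ (π ⟨$⟩ʳ_) s (u ∷ [])))
    (whiteStep _ (parityWord-≅ p pw) (colour-≅ u (applyW-≅ s p) wu))
  parityWord-≅ {G} {H} p (pivotUV {s} u v pw bu bv e) = subst (ParityWord H) (sym (map-++ (π ⟨$⟩ʳ_) s (u ∷ v ∷ u ∷ [])))
    (pivotUV _ _ (parityWord-≅ p pw) (colour-≅ u (applyW-≅ s p) bu) (colour-≅ v (applyW-≅ s p) bv) (adj-≅ u v (applyW-≅ s p) e))
  parityWord-≅ {G} {H} p (pivotVU {s} u v pw bu bv e) = subst (ParityWord H) (sym (map-++ (π ⟨$⟩ʳ_) s (v ∷ u ∷ v ∷ [])))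
    (pivotVU _ _ (parityWord-≅ p pw) (colour-≅ u (applyW-≅ s p) bu) (colour-≅ v (applyW-≅ s p) bv) (adj-≅ u v (applyW-≅ s p) e))

  class-≅ : ∀ {G H} → G ≅⟨ π ⟩ H → ∀ L → L ∈[ G ] → relabel π L ∈[ H ]
  class-≅ p L (s , pw , a , c) = let iso (a′ , c′) = applyW-≅ s p in
    map (π ⟨$⟩ʳ_) s , parityWord-≅ p pw ,
    (λ x y → trans (sym (a′ x y)) (a _ _)) , (λ x → trans (sym (c′ x)) (c _))

≅-flip : ∀ {m n} {π : Permutation m n} {G H} → G ≅⟨ π ⟩ H → H ≅⟨ flip π ⟩ G
≅-flip {π = π} {G} (iso (p , q)) = iso (
  (λ x y → trans (sym (p _ _)) (cong₂ (adj G) (inverseˡ π) (inverseˡ π))) ,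
  (λ x → trans (sym (q _)) (cong (colour G) (inverseˡ π))))

sameClass-≅ : ∀ {m n} {π : Permutation m n} {G H} → G ≅⟨ π ⟩ H → SameClass G H
sameClass-≅ {π = π} p = π , class-≅ π p , class-≅ (flip π) (≅-flip p)

sameClass-refl : ∀ {n} (G : BGraph n) → SameClass G G
sameClass-refl G = sameClass-≅ {π = ↔-id _} (iso ((λ _ _ → refl) , λ _ → refl))

sameClass-trans : ∀ {l m n} {G : BGraph l} {H : BGraph m} {J : BGraph n} → SameClass G H → SameClass H J → SameClass G J
sameClass-trans (π , f , g) (ρ , f′ , g′) = (π ∘ₚ ρ) ,
  (λ L L∈ → f′ (relabel π L) (f L L∈)) , (λ L L∈ → g (relabel (flip ρ) L) (g′ L L∈))

self∈class : ∀ {n} (G : BGraph n) → G ∈[ G ]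
self∈class G = [] , empty , (λ _ _ → refl) , λ _ → refl

sameClass-pure : ∀ {m n} {G : BGraph m} {H : BGraph n} → SameClass G H → Pure H → Pure G
sameClass-pure (π , f , _) pureH L L∈ S (ind , maximal) blackS =
  pureH (relabel π L) (f L L∈) (λ i → S (π ⟨$⟩ˡ i))
    ((λ u v → ind _ _) , λ T indT S⊆T u Tu →
      maximal (λ i → T (π ⟨$⟩ʳ i))
        (λ a b Ta Tb → trans (cong₂ (adj L) (sym (inverseˡ π)) (sym (inverseˡ π))) (indT _ _ Ta Tb))
        (λ a Sa → S⊆T _ (trans (cong S (inverseˡ π)) Sa))
        (π ⟨$⟩ˡ u) (trans (cong T (inverseʳ π)) Tu))
    (λ u → blackS _)

component-pure : ∀ {n} {G : BGraph n} (c : Component G) → Pure (componentGraph c) → Pure G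
component-pure {n} {G} c pure = ¬cover⇒pure λ { (d , adm , cov) →
  pure⇒¬cover (componentGraph c) pure (d ∘ emb c , adm ∘ emb c , λ v →
    let (x , Gx , x≼d , nz) = cov (emb c v) in x ∘ emb c , restricted Gx , x≼d ∘ emb c , nz) }
  where
  restricted : ∀ {x} → G ⊨ x → componentGraph c ⊨ x ∘ emb c
  restricted {x} Gx .row i = trans (row Gx (emb c i)) (sum-image (emb c) (emb-inj c) (λ w → adj G (emb c i) w ∧ β (x w))
    λ w off → cong (_∧ β (x w)) (≢true⇒≡false λ e → let (j , p) = closed c i w e in off j p))
    where
    sum-image : ∀ {k n} (e : Fin k → Fin n) → Injective _≡_ _≡_ e → (h : Fin n → Bool) →
      (∀ w → (∀ j → e j ≢ w) → h w ≡ false) → sum h ≡ sum (h ∘ e)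
    sum-image {k} {n} e inj h off = begin
      sum h ≡⟨ sum-cong-≗ (λ w → expand w (any? λ i → e i ≟ w)) ⟩
      sum (λ w → sum (λ i → eqb w (e i) ∧ h w)) ≡⟨ ∑-comm (λ w i → eqb w (e i) ∧ h w) ⟩
      sum (λ i → sum (λ w → eqb w (e i) ∧ h w)) ≡⟨ sum-cong-≗ (λ i → trans (sum-delta _ (e i) (λ w ne → cong (_∧ h w) (eqb-≢ ne))) (cong (_∧ h (e i)) (eqb-refl′ (e i)))) ⟩
      sum (h ∘ e) ∎
      where
      open ≡-Reasoning
      expand : ∀ w → Dec (∃ λ i → e i ≡ w) → h w ≡ sum (λ i → eqb w (e i) ∧ h w)
      expand w (no none) = trans (off w λ j p → none (j , p)) (sym (sum-false _ λ i → cong (_∧ h w) (eqb-≢ {x = w} {e i} λ p → none (i , sym p))))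
      expand .(e i) (yes (i , refl)) = sym (trans
        (sum-delta _ i λ j ne → cong (_∧ h (e i)) (eqb-≢ λ p → ne (inj (sym p))))
        (cong (_∧ h (e i)) (eqb-refl′ (e i))))

-- Every closure operation preserves purity. The alternatives of `EssPair` are matched in place so
-- that the recursive calls are on visible subterms.
closure-pure : ∀ {F : Graph → Set} → (∀ H → F H → PureAlternance (proj₂ H)) → ∀ {n} {G : BGraph n} → Closure F G → Pure G
closure-pure pureF (base (H , FH , same)) = sameClass-pure same (proj₂ (pureF H FH))
closure-pure pureF (decomp _ (s , inj₁ (inj₁ (r , l)))) = essPair⇒pure s (inj₁ (closure-pure pureF r , closure-pure pureF l))
closure-pure pureF (decomp _ (s , inj₁ (inj₂ (inj₁ (r , l))))) = essPair⇒pure s (inj₂ (inj₁ (closure-pure pureF r , closure-pure pureF l)))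
closure-pure pureF (decomp _ (s , inj₁ (inj₂ (inj₂ (v , e , r , l))))) = essPair⇒pure s (inj₂ (inj₂ (v , e , closure-pure pureF r , closure-pure pureF l)))
closure-pure pureF (decomp _ (s , inj₂ (inj₁ (r , l)))) = essPair⇒pure (swapSplit s) (inj₁ (closure-pure pureF r , closure-pure pureF l))
closure-pure pureF (decomp _ (s , inj₂ (inj₂ (inj₁ (r , l))))) = essPair⇒pure (swapSplit s) (inj₂ (inj₁ (closure-pure pureF r , closure-pure pureF l)))
closure-pure pureF (decomp _ (s , inj₂ (inj₂ (inj₂ (v , e , r , l))))) = essPair⇒pure (swapSplit s) (inj₂ (inj₂ (v , e , closure-pure pureF r , closure-pure pureF l)))
closure-pure pureF (component _ c cl) = component-pure c (closure-pure pureF cl)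
closure-pure pureF (sameClass same cl) = sameClass-pure same (closure-pure pureF cl)

essDecomp-barren : ∀ {F : Graph → Set} → (∀ H → F H → PureAlternance (proj₂ H)) → ∀ {n} {X : BGraph n} (s : Split X) →
  EssPair (Closure F) (side₁ s) (side₂ s) → Barren (side₁ s) × Barren (side₂ s)
essDecomp-barren pureF s p = essPair-barren (side₁ s) (side₂ s) (map-pure p)
  where
  map-pure : EssPair (Closure _) (side₁ s) (side₂ s) → EssPair Pure (side₁ s) (side₂ s)
  map-pure (inj₁ (r , l)) = inj₁ (closure-pure pureF r , closure-pure pureF l)
  map-pure (inj₂ (inj₁ (r , l))) = inj₂ (inj₁ (closure-pure pureF r , closure-pure pureF l))
  map-pure (inj₂ (inj₂ (v , e , r , l))) = inj₂ (inj₂ (v , e , closure-pure pureF r , closure-pure pureF l))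

-- Looseness of one side of a cut

Sub : ℕ → Set₁
Sub k = (Fin k → K) → Set

Admissible : ∀ {k} → (Fin k → Transition) → Sub k → (Fin k → Transition) → Set
Admissible {k} t P c = (∀ j → c j ≢ t j) × (∀ j → Σ (Fin k → K) λ y → P y × (∀ i → y i ≼ c i) × y j ≢ nothing)

-- y is a nonzero class, modulo the vectors supported inside, of an admissible decomposition.
Arm : ∀ {k} → Sub k → (Fin k → Transition) → (Fin k → K) → Set
Arm {k} P t y = P y × Σ (Fin k → Transition) λ c → (∀ i → y i ≼ c i) × Admissible t P c

-- By `root-ω` this sum is the form of the two marker values. It expresses that two arms leave by
-- distinct transitions without mentioning a marker, and local permutations preserve it.
⟨_,_⟩ : ∀ {k} → (Fin k → K) → (Fin k → K) → Bool
⟨ y , z ⟩ = sum (λ j → ω (y j) (z j))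

-- Loose, in terms of the projection P of the isotropic system to a set of vertices and
-- of the subspace P₀ of the vectors supported on that set.
LooseOn : ∀ {k} → Sub k → Sub k → (Fin k → Transition) → Set
LooseOn {k} P P₀ t = Σ (Fin k → K) λ y → Σ (Fin k → K) λ z → Arm P t y × Arm P t z × ⟨ y , z ⟩ ≡ true ×
  ((∃ λ c → Admissible t P₀ c) ⊎ Σ (Fin k → K) λ x → Arm P t x × ⟨ x , y ⟩ ≡ true × ⟨ x , z ⟩ ≡ true)

ω-distinct : ∀ {p q} → p ≢ q → ω (just p) (just q) ≡ true
ω-distinct {ta} {ta} ne = ⊥-elim (ne refl)
ω-distinct {ta} {tb} ne = refl
ω-distinct {ta} {tc} ne = refl
ω-distinct {tb} {ta} ne = refl
ω-distinct {tb} {tb} ne = ⊥-elim (ne refl)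
ω-distinct {tb} {tc} ne = refl
ω-distinct {tc} {ta} ne = refl
ω-distinct {tc} {tb} ne = refl
ω-distinct {tc} {tc} ne = ⊥-elim (ne refl)

ω-true⁻ : ∀ k l → ω k l ≡ true → ∃ λ p → ∃ λ q → k ≡ just p × l ≡ just q × p ≢ q
ω-true⁻ (just p) (just q) e = p , q , refl , refl , λ { refl → true≢false e (ω-≼ {just p} {just p} (inj₂ refl) (inj₂ refl)) }
ω-true⁻ (just p) nothing e = ⊥-elim (true≢false e (ω-≼ {just p} {nothing} {p} (inj₂ refl) (inj₁ refl)))

ω-act : ∀ (ψ : Perm) k l → ω (act (to ψ) k) (act (to ψ) l) ≡ ω k l
ω-act ψ nothing  l = refl
ω-act ψ (just p) nothing = trans (ω-≼ {just (to ψ p)} {nothing} {to ψ p} (inj₂ refl) (inj₁ refl)) (sym (ω-≼ {just p} {nothing} {p} (inj₂ refl) (inj₁ refl)))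
ω-act ψ (just p) (just q) with p ≟ᵗ q
... | yes refl = trans (ω-≼ {just (to ψ p)} {just (to ψ p)} (inj₂ refl) (inj₂ refl)) (sym (ω-≼ {just p} {just p} (inj₂ refl) (inj₂ refl)))
... | no ne = trans (ω-distinct (ne ∘ to-injective ψ)) (sym (ω-distinct ne))

module _ {k} {P P₀ P′ P₀′ : Sub k} {t t′ : Fin k → Transition} (ψ : Fin k → Perm)
  (P⇒ : ∀ {y} → P y → P′ (λ j → act (to (ψ j)) (y j)))
  (P₀⇒ : ∀ {y} → P₀ y → P₀′ (λ j → act (to (ψ j)) (y j)))
  (t≡ : ∀ j → t′ j ≡ to (ψ j) (t j)) where

  private
    push : (Fin k → K) → Fin k → K
    push y j = act (to (ψ j)) (y j)

    admissible⇒ : ∀ {Q Q′ : Sub k} → (∀ {y} → Q y → Q′ (push y)) → ∀ {c} → Admissible t Q c → Admissible t′ Q′ (λ j → to (ψ j) (c j))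
    admissible⇒ Q⇒ (adm , cov) = (λ j → to-≢ (ψ j) (t≡ j) (adm j)) , λ j → let (y , Qy , y≼c , nz) = cov j in
      push y , Q⇒ Qy , (λ i → act-≼ (y≼c i)) , act-nonzero (y j) nz

    arm⇒ : ∀ {y} → Arm P t y → Arm P′ t′ (push y)
    arm⇒ (Py , c , y≼c , adm) = P⇒ Py , _ , (λ i → act-≼ (y≼c i)) , admissible⇒ P⇒ adm

    pairing⇒ : ∀ y z → ⟨ y , z ⟩ ≡ true → ⟨ push y , push z ⟩ ≡ true
    pairing⇒ y z e = trans (sum-cong-≗ λ j → ω-act (ψ j) (y j) (z j)) e

  looseOn⇒ : LooseOn P P₀ t → LooseOn P′ P₀′ t′
  looseOn⇒ (y , z , a , b , e , inj₁ (c , adm)) = push y , push z , arm⇒ a , arm⇒ b , pairing⇒ y z e , inj₁ (_ , admissible⇒ P₀⇒ adm)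
  looseOn⇒ (y , z , a , b , e , inj₂ (x , d , f , g)) = push y , push z , arm⇒ a , arm⇒ b , pairing⇒ y z e ,
    inj₂ (push x , arm⇒ d , pairing⇒ x y f , pairing⇒ x z g)

Seen SeenInside : ∀ {n k} → BGraph n → (Fin k → Fin n) → Sub k
Seen {n} G e y = Σ (Fin n → K) λ x → G ⊨ x × (∀ j → x (e j) ≡ y j)
SeenInside {n} G e y = Σ (Fin n → K) λ x → G ⊨ x × (∀ j → x (e j) ≡ y j) × (∀ v → (∀ j → e j ≢ v) → x v ≡ nothing)

LooseAt : ∀ {n k} → BGraph n → (Fin n → Transition) → (Fin k → Fin n) → Set
LooseAt G t e = LooseOn (Seen G e) (SeenInside G e) (t ∘ e)

looseAt-LocEq : ∀ {n k} {G H : BGraph n} {s t} (e : Fin k → Fin n) → LocEq G s H t → LooseAt G s e → LooseAt H t e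
looseAt-LocEq e l = looseOn⇒ (ψ l ∘ e)
  (λ { (x , Gx , p) → _ , fwd l Gx , λ j → cong (act (to (ψ l (e j)))) (p j) })
  (λ { (x , Gx , p , off) → _ , fwd l Gx , (λ j → cong (act (to (ψ l (e j)))) (p j)) , λ v q → cong (act (to (ψ l v))) (off v q) })
  (λ j → tag l (e j))

pairing-root : ∀ {k} (Q : BGraph (suc k)) {x y} {x′ y′ : Fin k → K} → Q ⊨ x → Q ⊨ y → (∀ j → x (suc j) ≡ x′ j) → (∀ j → y (suc j) ≡ y′ j) →
  ⟨ x′ , y′ ⟩ ≡ ω (x zero) (y zero)
pairing-root Q Qx Qy p q = trans (sum-cong-≗ λ j → sym (cong₂ ω (p j) (q j))) (root-ω Q Qx Qy)

module _ {k} (Q : BGraph (suc k)) {t : Fin (suc k) → Transition} where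

  through⇒arm : ∀ {p} → Through Q (t ∘ suc) p → Σ (Fin (suc k) → K) λ x → Q ⊨ x × x zero ≡ just p × Arm (Seen Q suc) (t ∘ suc) (x ∘ suc)
  through⇒arm (c , adm , cov) with cov zero
  ... | x , Qx , x≼c , nz with x≼c zero
  ...   | inj₁ e = ⊥-elim (nz e)
  ...   | inj₂ e = x , Qx , e , (x , Qx , λ j → refl) , c , x≼c ∘ suc , adm , λ j →
            let (y , Qy , y≼c , nzy) = cov (suc j) in y ∘ suc , (y , Qy , λ j → refl) , y≼c ∘ suc , nzy

  arm⇒through : ∀ {y x p} → Q ⊨ x → (∀ j → x (suc j) ≡ y j) → x zero ≡ just p → Arm (Seen Q suc) (t ∘ suc) y → Through Q (t ∘ suc) p
  arm⇒through {y} {x} {p} Qx xy x0 (_ , c , y≼c , adm , cov) = c , adm , covers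
    where
    x≼c : ∀ j → x (suc j) ≼ c j
    x≼c j = subst (_≼ c j) (sym (xy j)) (y≼c j)
    covers : Covers Q (p ◂ c)
    covers zero = x , Qx , (λ { zero → inj₂ x0 ; (suc j) → x≼c j }) , λ e → just≢nothing (trans (sym x0) e)
      where
      just≢nothing : just p ≢ nothing
      just≢nothing ()
    covers (suc j) with cov j
    ... | z , (w , Qw , wz) , z≼c , nz = w , Qw ,
      (λ { zero → root-≼ Q Qx Qw x≼c w≼c x0 ; (suc i) → w≼c i }) , λ e → nz (trans (sym (wz j)) e)
      where
      w≼c : ∀ i → w (suc i) ≼ c i
      w≼c i = subst (_≼ c i) (sym (wz i)) (z≼c i)

  loose⇒looseAt : Loose (Through Q (t ∘ suc)) (Inside Q (t ∘ suc)) → LooseAt Q t suc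
  loose⇒looseAt (p , q , ne , Tp , Tq , more) =
    let (x , Qx , x0 , a) = through⇒arm Tp
        (y , Qy , y0 , b) = through⇒arm Tq
    in x ∘ suc , y ∘ suc , a , b , distinct Qx Qy x0 y0 ne , extra more Qx Qy x0 y0
    where
    distinct : ∀ {x y p q} → Q ⊨ x → Q ⊨ y → x zero ≡ just p → y zero ≡ just q → p ≢ q → ⟨ x ∘ suc , y ∘ suc ⟩ ≡ true
    distinct Qx Qy x0 y0 ne = trans (pairing-root Q Qx Qy (λ _ → refl) (λ _ → refl)) (trans (cong₂ ω x0 y0) (ω-distinct ne))
    extra : Inside Q (t ∘ suc) ⊎ (∃ λ r → r ≢ p × r ≢ q × Through Q (t ∘ suc) r) → ∀ {x y} → Q ⊨ x → Q ⊨ y → x zero ≡ just p → y zero ≡ just q →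
      (∃ λ c → Admissible (t ∘ suc) (SeenInside Q suc) c) ⊎
      Σ (Fin k → K) λ z → Arm (Seen Q suc) (t ∘ suc) z × ⟨ z , x ∘ suc ⟩ ≡ true × ⟨ z , y ∘ suc ⟩ ≡ true
    extra (inj₁ (c , adm , cov)) _ _ _ _ = inj₁ (c , adm , λ j → let (z , Qz , z0 , z≼c , nz) = cov j in
      z ∘ suc , (z , Qz , (λ _ → refl) , λ { zero _ → z0 ; (suc i) off → ⊥-elim (off i refl) }) , z≼c , nz)
    extra (inj₂ (r , r≢p , r≢q , Tr)) Qx Qy x0 y0 = let (z , Qz , z0 , c) = through⇒arm Tr in
      inj₂ (z ∘ suc , c , distinct Qz Qx z0 x0 r≢p , distinct Qz Qy z0 y0 r≢q)

  looseAt⇒loose : LooseAt Q t suc → Loose (Through Q (t ∘ suc)) (Inside Q (t ∘ suc))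
  looseAt⇒loose (y , z , a , b , e , more) = assemble (proj₁ a) (proj₁ b)
    where
    assemble : Seen Q suc y → Seen Q suc z → Loose (Through Q (t ∘ suc)) (Inside Q (t ∘ suc))
    assemble (y′ , Qy , py) (z′ , Qz , pz) =
      let (p , q , y0 , z0 , ne) = ω-true⁻ (y′ zero) (z′ zero) (trans (sym (pairing-root Q Qy Qz py pz)) e)
      in p , q , ne , arm⇒through Qy py y0 a , arm⇒through Qz pz z0 b , extra y0 z0 more
      where
      extra : ∀ {p q} → y′ zero ≡ just p → z′ zero ≡ just q →
        (∃ λ c → Admissible (t ∘ suc) (SeenInside Q suc) c) ⊎
        (Σ (Fin k → K) λ x → Arm (Seen Q suc) (t ∘ suc) x × ⟨ x , y ⟩ ≡ true × ⟨ x , z ⟩ ≡ true) →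
        Inside Q (t ∘ suc) ⊎ (∃ λ r → r ≢ p × r ≢ q × Through Q (t ∘ suc) r)
      extra y0 z0 (inj₁ (c , adm , cov)) = inj₁ (c , adm , λ j → let (w , (x , Qx , px , off) , w≼c , nz) = cov j in
        x , Qx , off zero (λ i ()) , (λ i → subst (_≼ c i) (sym (px i)) (w≼c i)) , λ e → nz (trans (sym (px j)) e))
      extra {p} {q} y0 z0 (inj₂ (w , c , f , g)) = inj₂ (third (proj₁ c))
        where
        third : Seen Q suc w → ∃ λ r → r ≢ p × r ≢ q × Through Q (t ∘ suc) r
        third (x , Qx , px) =
          let (r , _ , x0 , y0′ , r≢p) = ω-true⁻ (x zero) (y′ zero) (trans (sym (pairing-root Q Qx Qy px py)) f)
              (_ , _ , x0′ , z0′ , r≢q) = ω-true⁻ (x zero) (z′ zero) (trans (sym (pairing-root Q Qx Qz px pz)) g)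
          in r ,
             (λ r≡p → r≢p (trans r≡p (just-injective (trans (sym y0) y0′)))) ,
             (λ r≡q → r≢q (trans (sym (just-injective (trans (sym x0) x0′))) (trans r≡q (just-injective (trans (sym z0) z0′))))) ,
             arm⇒through Qx px x0 c

-- The bit received from the other side is clearly zero. If the bit sent were not, the row of a
-- crossing vertex on the other side would be odd although the member vanishes there.
restrict-inside : ∀ {n} {G : BGraph n} (s : Split G) {x} → G ⊨ x → (∀ b → x (e₂ s b) ≡ nothing) → side₁ s ⊨ (nothing ◂ x ∘ e₁ s)
restrict-inside {G = G} s {x} Gx off = subst (λ k → side₁ s ⊨ (k ◂ x ∘ e₁ s)) (cong₂ fromBits flow₁≡ flow₂≡) (restrict₁ s Gx)
  where
  flow₂≡ : flow₂ s x ≡ false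
  flow₂≡ = sum-false _ λ b → trans (cong (λ k → adj (side₂ s) zero (suc b) ∧ β k) (off b)) (∧-zeroʳ _)
  flow₁≡ : flow₁ s x ≡ false
  flow₁≡ = ≢true⇒≡false λ e →
    let (a , ea) = sum-true⁻ (λ a → adj (side₁ s) zero (suc a) ∧ β (x (e₁ s a))) e
        (b , gb) = crossing s {a} (proj₁ (∧-true⁻ ea))
    in true≢false (cong₂ _∧_ gb e) (trans (sym (xor-identityʳ _)) (trans
         (cong ((adj (side₂ s) zero (suc b) ∧ flow₁ s x) xor_) (sym (sum-false _ λ b′ → trans (cong (λ k → adj G (e₂ s b) (e₂ s b′) ∧ β k) (off b′)) (∧-zeroʳ _))))
         (trans (sym (row-e₁ (swapSplit s) x b)) (trans (sym (row Gx (e₂ s b))) (cong α (off b))))))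

looseAt-side : ∀ {n k} {G : BGraph n} (s : Split G) {t} (h : Fin k → Fin (k₁ s)) → (∀ j → t (suc (h j)) ≡ tagOf G (e₁ s (h j))) →
  LooseAt G (tagOf G) (e₁ s ∘ h) → LooseAt (side₁ s) t (suc ∘ h)
looseAt-side s h t≡ = looseOn⇒ (λ _ → ↔-id _)
  (λ { {y} (x , Gx , p) → _ , restrict₁ s Gx , λ j → trans (p j) (sym (act-id (y j))) })
  (λ { {y} (x , Gx , p , off) → _ , restrict-inside s Gx (λ b → off (e₂ s b) λ j → disjoint s (h j) b) ,
      (λ j → trans (p j) (sym (act-id (y j)))) ,
      λ { zero _ → refl ; (suc a) off′ → off (e₁ s a) λ j q → off′ j (cong suc (e₁-inj s q)) } })
  t≡

-- At a marker with a neighbour every value of `K` occurs: β is chosen at the marker, and β at the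
-- neighbour then adjusts α.
span : ∀ {k} (Q : BGraph (suc k)) {b} → adj Q zero (suc b) ≡ true → ∀ κ → Σ (Fin (suc k) → K) λ x → Q ⊨ x × x zero ≡ κ
span {k} Q {b} e κ = x , member , root
  where
  Z : Fin (suc k) → Bool
  Z = β κ ◂ λ w → eqb w b ∧ α κ
  x : Fin (suc k) → K
  x v = fromBits (sum (λ w → adj Q v w ∧ Z w)) (Z v)
  member : Q ⊨ x
  member .row v = trans (α-fromBits (sum (λ w → adj Q v w ∧ Z w)) (Z v)) (sum-cong-≗ λ w → cong (adj Q v w ∧_) (sym (β-fromBits (sum (λ u → adj Q w u ∧ Z u)) (Z w))))
  root : x zero ≡ κ
  root = trans (cong (λ a → fromBits a (β κ)) root-sum) (fromBits-αβ κ)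
    where
    root-sum : sum (λ w → adj Q zero w ∧ Z w) ≡ α κ
    root-sum = trans (sum-delta _ (suc b) others) (cong₂ (λ p q → p ∧ (q ∧ α κ)) e (eqb-refl′ b))
      where
      others : ∀ w → w ≢ suc b → adj Q zero w ∧ Z w ≡ false
      others zero _ = cong (_∧ β κ) (adj-irr Q zero)
      others (suc w) ne = trans (cong (λ q → adj Q zero (suc w) ∧ (q ∧ α κ)) (eqb-≢ (λ p → ne (cong suc p)))) (∧-zeroʳ _)

-- A member of the side becomes one of `G` once the other side answers its marker value; the
-- crossing edge guarantees an answer through `span`.
looseAt-whole : ∀ {n} {G : BGraph n} (s : Split G) {t} {a} → adj (side₁ s) zero (suc a) ≡ true → (∀ j → tagOf G (e₁ s j) ≡ t (suc j)) →
  LooseAt (side₁ s) t suc → LooseAt G (tagOf G) (e₁ s)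
looseAt-whole {n} {G} s {t} {a} edge t≡ = looseOn⇒ (λ _ → ↔-id _) seen inside t≡
  where
  crossed : adj (side₂ s) zero (suc (proj₁ (crossing s edge))) ≡ true
  crossed = proj₂ (crossing s edge)
  seen : ∀ {y} → Seen (side₁ s) suc y → Seen G (e₁ s) (λ j → act (λ c → c) (y j))
  seen {y} (x , Qx , p) = let (z , Qz , z0) = span (side₂ s) crossed (act swapAB (x zero)) in
    join s (x ∘ suc) (z ∘ suc) ,
    glue s {k = x zero} (⊨-cong (λ _ _ → refl) (λ { zero → refl ; (suc _) → refl }) Qx)
      (⊨-cong (λ _ _ → refl) (λ { zero → z0 ; (suc _) → refl }) Qz) ,
    λ j → trans (join-e₁ s (x ∘ suc) (z ∘ suc) j) (trans (p j) (sym (act-id (y j))))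
  inside : ∀ {y} → SeenInside (side₁ s) suc y → SeenInside G (e₁ s) (λ j → act (λ c → c) (y j))
  inside {y} (x , Qx , p , off) = join s (x ∘ suc) (λ _ → nothing) , glue₁ s Qx (off zero λ _ ()) ,
    (λ j → trans (join-e₁ s (x ∘ suc) (λ _ → nothing) j) (trans (p j) (sym (act-id (y j))))) ,
    split-elim s (λ a off′ → ⊥-elim (off′ a refl)) (λ b _ → join-e₂ s (x ∘ suc) (λ _ → nothing) b)

-- The row of an isolated marker is empty, so α vanishes there and `tb` is the only nonzero value
-- left.
through-isolated : ∀ {k} (Q : BGraph (suc k)) {t p} → (∀ a → adj Q zero (suc a) ≡ false) → Through Q t p → p ≡ tb
through-isolated Q {p = p} isolated (c , _ , cov) with cov zero
... | x , Qx , x≼c , nz with x≼c zero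
...   | inj₁ e = ⊥-elim (nz e)
...   | inj₂ e = only-tb p (trans (cong α (sym e)) (trans (row Qx zero) (sum-false _ zero-row)))
  where
  only-tb : ∀ p → α (just p) ≡ false → p ≡ tb
  only-tb tb _ = refl
  zero-row : ∀ w → adj Q zero w ∧ β (x w) ≡ false
  zero-row zero = cong (_∧ β (x zero)) (adj-irr Q zero)
  zero-row (suc a) = cong (_∧ β (x (suc a))) (isolated a)

loose-crossing : ∀ {k} {Q : BGraph (suc k)} → Loose (Th Q) (In Q) → ∃ λ a → adj Q zero (suc a) ≡ true
loose-crossing {Q = Q} (p , q , ne , Tp , Tq , _) with any? (λ a → adj Q zero (suc a) Bool.≟ true)
... | yes found = found
... | no none = ⊥-elim (ne (trans (through-isolated Q isolated Tp) (sym (through-isolated Q isolated Tq))))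
  where
  isolated : ∀ a → adj Q zero (suc a) ≡ false
  isolated a = ≢true⇒≡false λ e → none (a , e)

-- The pentagon

-- c is admissible and x covers everything but z while vanishing there: a decomposition
-- joining the half-edges at z by disjoint paths; y records how they are joined.
record Unpinned {n} (G : BGraph n) (t : Fin n → Transition) (z : Fin n) : Set where
  field
    c   : Fin n → Transition
    x y : Fin n → K
    adm : ∀ v → v ≢ z → c v ≢ t v
    Gx  : G ⊨ x
    Gy  : G ⊨ y
    x0  : x z ≡ nothing
    y0  : y z ≢ nothing
    x≼c : ∀ v → v ≢ z → x v ≼ c v
    y≼c : ∀ v → v ≢ z → y v ≼ c v
    x≢  : ∀ v → v ≢ z → x v ≢ nothing

unpinned-LocEq : ∀ {n} {G H : BGraph n} {s t z} → LocEq G s H t → Unpinned G s z → Unpinned H t z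
unpinned-LocEq {z = z} e u = record
  { c = λ v → to (ψ e v) (c v) ; x = λ v → act (to (ψ e v)) (x v) ; y = λ v → act (to (ψ e v)) (y v)
  ; adm = λ v ne → to-≢ (ψ e v) (tag e v) (adm v ne)
  ; Gx = fwd e Gx ; Gy = fwd e Gy ; x0 = cong (act (to (ψ e z))) x0 ; y0 = act-nonzero (y z) y0
  ; x≼c = λ v ne → act-≼ (x≼c v ne) ; y≼c = λ v ne → act-≼ (y≼c v ne) ; x≢ = λ v ne → act-nonzero (x v) (x≢ v ne) }
  where open Unpinned u

⊨-relabel : ∀ {m n} (π : Permutation m n) {G : BGraph m} {x} → G ⊨ x → relabel π G ⊨ x ∘ (π ⟨$⟩ˡ_)
⊨-relabel π {G} {x} Gx .row v = trans (row Gx (π ⟨$⟩ˡ v)) (sum-permute (λ w → adj G (π ⟨$⟩ˡ v) w ∧ β (x w)) (flip π))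

unpinned-relabel : ∀ {m n} (π : Permutation m n) {G : BGraph m} {t z} → Unpinned G t (π ⟨$⟩ˡ z) → Unpinned (relabel π G) (t ∘ (π ⟨$⟩ˡ_)) z
unpinned-relabel π u = record
  { c = c ∘ (π ⟨$⟩ˡ_) ; x = x ∘ (π ⟨$⟩ˡ_) ; y = y ∘ (π ⟨$⟩ˡ_)
  ; adm = λ v ne → adm _ (off ne) ; Gx = ⊨-relabel π Gx ; Gy = ⊨-relabel π Gy ; x0 = x0 ; y0 = y0
  ; x≼c = λ v ne → x≼c _ (off ne) ; y≼c = λ v ne → y≼c _ (off ne) ; x≢ = λ v ne → x≢ _ (off ne) }
  where
  open Unpinned u
  off : ∀ {v z} → v ≢ z → π ⟨$⟩ˡ v ≢ π ⟨$⟩ˡ z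
  off ne p = ne (trans (sym (inverseʳ π)) (trans (cong (π ⟨$⟩ʳ_) p) (inverseʳ π)))

unpinned⇒ : ∀ {k} {Q : BGraph (suc k)} {t} → Unpinned Q t zero → Inside Q (t ∘ suc) × ∃ (Through Q (t ∘ suc))
unpinned⇒ {k} {Q} u = (c ∘ suc , adm′ , λ v → x , Gx , x0 , x≼c′ , x≢ (suc v) λ ()) , through (y zero) refl
  where
  open Unpinned u
  adm′ : ∀ v → c (suc v) ≢ _
  adm′ v = adm (suc v) λ ()
  x≼c′ : ∀ v → x (suc v) ≼ c (suc v)
  x≼c′ v = x≼c (suc v) λ ()
  through : ∀ κ → y zero ≡ κ → ∃ (Through Q _)
  through nothing e = ⊥-elim (y0 e)
  through (just p) e = p , c ∘ suc , adm′ , λ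
    { zero → y , Gy , (λ { zero → inj₂ e ; (suc v) → y≼c (suc v) λ () }) , y0
    ; (suc v) → x , Gx , (λ { zero → inj₁ x0 ; (suc w) → x≼c′ w }) , x≢ (suc v) λ () }

unpinned-pentagon : ∀ z → Unpinned whitePentagon (tagOf whitePentagon) z
unpinned-pentagon z = record
  { c = c z ; x = x z ; y = y z
  ; adm = λ v ne → from-yes (all? λ z → all? λ v → ¬? (c z v ≟ᵗ tb)) z v
  ; Gx = rows (from-yes (all? λ z → all? λ v → α (x z v) Bool.≟ sum (λ w → pentAdj v w ∧ β (x z w))) z)
  ; Gy = rows (from-yes (all? λ z → all? λ v → α (y z v) Bool.≟ sum (λ w → pentAdj v w ∧ β (y z w))) z)
  ; x0 = from-yes (all? λ z → x z z ≟ᴷ nothing) z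
  ; y0 = from-yes (all? λ z → ¬? (y z z ≟ᴷ nothing)) z
  ; x≼c = λ v ne → from-yes (all? λ z → all? λ v → ¬? (v ≟ z) →-dec ((x z v ≟ᴷ nothing) ⊎-dec (x z v ≟ᴷ just (c z v)))) z v ne
  ; y≼c = λ v ne → from-yes (all? λ z → all? λ v → ¬? (v ≟ z) →-dec ((y z v ≟ᴷ nothing) ⊎-dec (y z v ≟ᴷ just (c z v)))) z v ne
  ; x≢ = λ v ne → from-yes (all? λ z → all? λ v → ¬? (v ≟ z) →-dec ¬? (x z v ≟ᴷ nothing)) z v ne }
  where
  _≟ᴷ_ : ∀ (k l : K) → Dec (k ≡ l)
  _≟ᴷ_ = ≡-dec _≟ᵗ_
  offset : Fin 5 → Fin 5 → Fin 5
  offset z v = (toℕ v + (5 ∸ toℕ z)) mod 5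
  -- The case `z` = 0; the others are rotations. `x₀` is the sum of the basis vectors of the two
  -- vertices opposite to 0, and `y₀` adds the basis vector of 0, which cancels the two entries next
  -- to it.
  c₀ : Fin 5 → Transition
  c₀ = ta ◂ ta ◂ tc ◂ tc ◂ ta ◂ λ ()
  x₀ y₀ : Fin 5 → K
  x₀ = nothing ◂ just ta ◂ just tc ◂ just tc ◂ just ta ◂ λ ()
  y₀ = just tb ◂ nothing ◂ just tc ◂ just tc ◂ nothing ◂ λ ()
  c : Fin 5 → Fin 5 → Transition
  c z v = c₀ (offset z v)
  x y : Fin 5 → Fin 5 → K
  x z v = x₀ (offset z v)
  y z v = y₀ (offset z v)

-- For every `z`, since an isomorphism with a graph in the class gives no control over the place of
-- the marker.
unpinned-class : ∀ {n} {H : BGraph n} → InPentagonClass H → ∀ z → Unpinned H (tagOf H) z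
unpinned-class {H = H} (L , (s , pw , a , b) , π , a′ , b′) z =
  unpinned-LocEq (≗-LocEq a′ (λ v → cong code (sym (b′ v))))
    (unpinned-relabel π {L} {tagOf L} (unpinned-LocEq (≗-LocEq a (λ v → cong code (sym (b v))))
      (unpinned-LocEq (applyW-LocEq pw) (unpinned-pentagon (π ⟨$⟩ˡ z)))))

-- Cuts of rank at most one, and the main argument

enumerate : ∀ {n} (P : Fin n → Bool) → ∃ λ l → Σ (Fin l → Fin n) λ e →
  Injective _≡_ _≡_ e × (∀ b → P (e b) ≡ true) × (∀ x → P x ≡ true → ∃[ b ] e b ≡ x)
enumerate {zero} P = 0 , (λ ()) , (λ {}) , (λ ()) , λ ()
enumerate {suc n} P with P zero in P0 | enumerate (P ∘ suc)
... | false | l , e , inj , sound , complete = l , suc ∘ e , (λ p → inj (Fin.suc-injective p)) , sound , λ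
  { zero p → ⊥-elim (true≢false p P0) ; (suc x) p → let (b , q) = complete x p in b , cong suc q }
... | true | l , e , inj , sound , complete = suc l , zero ◂ suc ∘ e ,
  (λ { {zero} {zero} p → refl ; {suc a} {suc b} p → cong suc (inj (Fin.suc-injective p)) }) ,
  (λ { zero → P0 ; (suc b) → sound b }) , λ
  { zero p → zero , refl ; (suc x) p → let (b , q) = complete x p in suc b , cong suc q }

record Complement {k n} (e : Fin k → Fin n) : Set where
  field
    l        : ℕ
    e′       : Fin l → Fin n
    e′-inj   : Injective _≡_ _≡_ e′
    disjoint′ : ∀ a b → ¬ (e a ≡ e′ b)
    cover′   : ∀ x → (∃[ a ] e a ≡ x) ⊎ (∃[ b ] e′ b ≡ x)

complement : ∀ {k n} (e : Fin k → Fin n) → Complement e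
complement {k} {n} e =
  let (l , e′ , inj , sound , complete) = enumerate outside in record
  { l = l ; e′ = e′ ; e′-inj = inj
  ; disjoint′ = λ a b p → outside⁻ (sound b) a p
  ; cover′ = λ x → cover-at complete x (any? λ a → e a ≟ x) }
  where
  out : ∀ {x} → Dec (∃[ a ] e a ≡ x) → Bool
  out (yes _) = false
  out (no _)  = true
  outside : Fin n → Bool
  outside x = out (any? λ a → e a ≟ x)
  outside⁻ : ∀ {x} → outside x ≡ true → ∀ a → e a ≢ x
  outside⁻ {x} p a q with any? (λ a → e a ≟ x)
  ... | no none = none (a , q)
  outside⁺ : ∀ {x} → ¬ (∃[ a ] e a ≡ x) → outside x ≡ true
  outside⁺ {x} none with any? (λ a → e a ≟ x)
  ... | yes found = ⊥-elim (none found)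
  ... | no _ = refl
  cover-at : ∀ {l} {e′ : Fin l → Fin n} → (∀ x → outside x ≡ true → ∃[ b ] e′ b ≡ x) → ∀ x → Dec (∃[ a ] e a ≡ x) →
    (∃[ a ] e a ≡ x) ⊎ (∃[ b ] e′ b ≡ x)
  cover-at complete x (yes found) = inj₁ found
  cover-at complete x (no none) = inj₂ (complete x (outside⁺ none))

module _ {k n} {e : Fin k → Fin n} (e-inj : Injective _≡_ _≡_ e) (C : Complement e) where
  open Complement C

  complement-order : k + l ≡ n
  complement-order = ↔⇒≡ (bipartition e-inj e′-inj disjoint′ cover′)

-- The cut between the image of e and its complement has rank at most one, and rank zero
-- if r is false.
record Cut (r : Bool) {k n} (G : BGraph n) (e : Fin k → Fin n) : Set where
  field
    f : Fin k → Bool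
    g : Fin n → Bool
    product : ∀ j b → (∀ i → e i ≢ b) → adj G (e j) b ≡ r ∧ (f j ∧ g b)
open Cut

-- For `u` inside, its row of the cut matrix is added to the rows of its neighbours; for `u`
-- outside, its column is added to the columns of its neighbours. Neither destroys the product form.
cut-lc : ∀ {r k n} {G : BGraph n} {e : Fin k → Fin n} u → Cut r G e → Cut r (lc G u) e
cut-lc {r} {G = G} {e} u c with any? (λ i → e i ≟ u)
... | yes (i , refl) = record
  { f = λ j → f c j xor (adj G (e i) (e j) ∧ f c i) ; g = g c
  ; product = λ j b off → trans (lcAdj-off G (e i) (off j)) (trans
      (cong₂ (λ p q → p xor (adj G (e i) (e j) ∧ q)) (product c j b off) (product c i b off))
      (truthTable 5 (λ r a h d b → (r ∧ (a ∧ b)) xor (h ∧ (r ∧ (d ∧ b)))) (λ r a h d b → r ∧ ((a xor (h ∧ d)) ∧ b)) tt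
        r (f c j) (adj G (e i) (e j)) (f c i) (g c b))) }
... | no none = record
  { f = f c ; g = λ b → g c b xor (g c u ∧ adj G u b)
  ; product = λ j b off → trans (lcAdj-off G u (off j)) (trans
      (cong₂ (λ p q → p xor (q ∧ adj G u b)) (product c j b off) (trans (adj-sym G u (e j)) (product c j u λ i p → none (i , p))))
      (truthTable 5 (λ r a b d h → (r ∧ (a ∧ b)) xor ((r ∧ (a ∧ d)) ∧ h)) (λ r a b d h → r ∧ (a ∧ (b xor (d ∧ h)))) tt
        r (f c j) (g c b) (g c u) (adj G u b))) }

cut-applyW : ∀ {r k n} {G : BGraph n} {e : Fin k → Fin n} s → Cut r G e → Cut r (applyW G s) e
cut-applyW [] c = c
cut-applyW (u ∷ s) c = cut-applyW s (cut-lc u c)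

cut-≗ : ∀ {r k n} {G H : BGraph n} {e : Fin k → Fin n} → (∀ u v → adj G u v ≡ adj H u v) → Cut r G e → Cut r H e
cut-≗ p c = record { f = f c ; g = g c ; product = λ j b off → trans (sym (p _ _)) (product c j b off) }

cut-relabel : ∀ {r k m n} (π : Permutation m n) {G : BGraph m} {e : Fin k → Fin m} {e′ : Fin k → Fin n} →
  (∀ j → π ⟨$⟩ˡ e′ j ≡ e j) → Cut r (relabel π G) e′ → Cut r G e
cut-relabel π {G} {e} {e′} p c = record
  { f = f c ; g = g c ∘ (π ⟨$⟩ʳ_)
  ; product = λ j b off → trans (cong₂ (adj G) (sym (p j)) (sym (inverseˡ π)))
      (product c j (π ⟨$⟩ʳ b) λ i q → off i (trans (sym (p i)) (trans (cong (π ⟨$⟩ˡ_) q) (inverseˡ π)))) }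

cut-rootPiece : ∀ {r k m} u (Q : BGraph (suc m)) {e : Fin k → Fin (suc m)} → Cut r (rootPiece u Q) e → Cut r Q e
cut-rootPiece ta Q c = cut-≗ (lcAdj-involutive (setRootColour white Q) zero) (cut-lc zero c)
cut-rootPiece tb Q c = cut-≗ (λ _ _ → refl) c
cut-rootPiece tc Q c = cut-≗ (λ _ _ → refl) c

-- Seen from a set within one side, a vertex across the split has either the column of the marker or
-- the zero column.
cut-side : ∀ {r k n} {G : BGraph n} (s : Split G) {h : Fin k → Fin (k₁ s)} → Cut r (side₁ s) (suc ∘ h) → Cut r G (e₁ s ∘ h)
cut-side {r} {G = G} s {h} c = record
  { f = f c ; g = join s (g c ∘ suc) (λ b → g c zero ∧ adj (side₂ s) zero (suc b))
  ; product = λ j → split-elim s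
      (λ a off → trans (product c j (suc a) λ i p → off i (cong (e₁ s) (Fin.suc-injective p)))
        (cong (λ q → r ∧ (f c j ∧ q)) (sym (join-e₁ s (g c ∘ suc) _ a))))
      (λ b _ → trans (adj-cross s (h j) b) (trans
        (cong (_∧ adj (side₂ s) zero (suc b)) (trans (adj-sym (side₁ s) zero (suc (h j))) (product c j zero λ _ ())))
        (trans (truthTable 4 (λ r a b d → (r ∧ (a ∧ b)) ∧ d) (λ r a b d → r ∧ (a ∧ (b ∧ d))) tt r (f c j) (g c zero) (adj (side₂ s) zero (suc b)))
          (cong (λ q → r ∧ (f c j ∧ q)) (sym (join-e₂ s (g c ∘ suc) _ b)))))) }

cut-split : ∀ {n} {G : BGraph n} (s : Split G) → Cut true G (e₁ s)
cut-split s = record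
  { f = λ a → adj (side₁ s) zero (suc a) ; g = join s (λ _ → false) (λ b → adj (side₂ s) zero (suc b))
  ; product = λ j → split-elim s (λ a off → ⊥-elim (off a refl))
      (λ b _ → trans (adj-cross s j b) (cong (adj (side₁ s) zero (suc j) ∧_) (sym (join-e₂ s (λ _ → false) _ b)))) }

cutSplit : ∀ {r k n} {G : BGraph n} {e : Fin k → Fin n} → Injective _≡_ _≡_ e → (C : Complement e) →
  2 ≤ k → 2 ≤ Complement.l C → Cut r G e → Split G
cutSplit {r} {G = G} {e} inj C 2≤k 2≤l c = record
  { k₁ = _ ; k₂ = l ; e₁ = e ; e₂ = e′ ; e₁-inj = inj ; e₂-inj = e′-inj ; disjoint = disjoint′ ; cover = cover′
  ; size₁ = 2≤k ; size₂ = 2≤l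
  ; split = λ a b → λ { (b′ , p) (a′ , q) →
      let (r≡ , fa) = factors a a′ q
          (_ , gb) = factors b′ b (trans (adj-sym G _ _) p)
      in trans (product c a (e′ b) (λ i → disjoint′ i b)) (cong₂ _∧_ r≡ (cong₂ _∧_ (proj₁ fa) (proj₂ gb))) } }
  where
  open Complement C
  factors : ∀ a b → adj G (e a) (e′ b) ≡ true → r ≡ true × f c a ≡ true × g c (e′ b) ≡ true
  factors a b p = let (x , y) = ∧-true⁻ (trans (sym (product c a (e′ b) (λ i → disjoint′ i b))) p) in x , ∧-true⁻ y

looseAt-relabel : ∀ {m n k} (π : Permutation m n) {G : BGraph m} {t} {e : Fin k → Fin m} {e′ : Fin k → Fin n} →
  (∀ j → π ⟨$⟩ˡ e′ j ≡ e j) → LooseAt G t e → LooseAt (relabel π G) (t ∘ (π ⟨$⟩ˡ_)) e′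
looseAt-relabel π {t = t} {e} {e′} p = looseOn⇒ (λ _ → ↔-id _)
  (λ { {y} (x , Gx , q) → _ , ⊨-relabel π Gx , λ j → trans (cong x (p j)) (trans (q j) (sym (act-id (y j)))) })
  (λ { {y} (x , Gx , q , off) → _ , ⊨-relabel π Gx , (λ j → trans (cong x (p j)) (trans (q j) (sym (act-id (y j))))) ,
       λ v off′ → off _ λ j w → off′ j (trans (sym (inverseʳ π)) (trans (cong (π ⟨$⟩ʳ_) (trans (p j) w)) (inverseʳ π))) })
  (λ j → cong t (p j))

-- Irreducible graphs: connectedness and the descent

Smaller : ℕ → Graph → Set
Smaller n (m , H) = m < n × PureAlternance H

smaller : ∀ {m n} {H : BGraph m} → m < n → InvWord H → Pure H → Closure (Smaller n) H
smaller {H = H} lt iw pure = base ((_ , H) , (lt , invWord⇒alternance iw , pure) , sameClass-refl H)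

-- `irreducible` is what primitivity says for the family of all smaller pure alternance graphs.
module Irreducible {n} (G : BGraph n) (alt : Alternance G) (pure : Pure G) (irreducible : ¬ Closure (Smaller n) G) where

  word : InvWord G
  word = alternance⇒invWord alt

  -- A rooted piece has one vertex more than its side; it is still smaller than `G` because the
  -- other side has at least two.
  k₁<n : (s : Split G) → suc (k₁ s) < n
  k₁<n s = subst (suc (k₁ s) <_) (split-order s) (subst (_≤ k₁ s + k₂ s) (ℕ.+-comm (k₁ s) 2) (ℕ.+-monoʳ-≤ (k₁ s) (size₂ s)))

  good : (s : Split G) → ∀ u → Only (Th (side₁ s)) u → ¬ Th (side₂ s) (swapAB u) → ¬ In (side₂ s) → ⊥
  good s u only noTh noIn = build u only noTh
    where
    Q₁ = side₁ s
    Q₂ = side₂ s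
    w₁ : InvWord Q₁
    w₁ = invWord-side s word
    w₂ : InvWord Q₂
    w₂ = invWord-side (swapSplit s) word
    root : ∀ u → Only (Th Q₁) u → Closure (Smaller n) (rootPiece u Q₁)
    root u only = smaller (k₁<n s) (invWord-rootPiece u Q₁ w₁) (pure-rootPiece u Q₁ only)
    k₂<n : k₂ s < n
    k₂<n = ℕ.<-trans (ℕ.n<1+n _) (k₁<n (swapSplit s))
    finish : EssPair (Closure (Smaller n)) Q₁ Q₂ → ⊥
    finish p = irreducible (decomp alt (s , inj₁ p))
    build-w : Only (Th Q₁) tb → ¬ Th Q₂ ta → ⊥
    build-w only noTh = finish (inj₁ (root tb only , smaller k₂<n (invWord-deleteRoot Q₂ w₂)
      (let (e , r) = lw-LocEq Q₂ in pure-leaf e r (noTh , noIn))))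
    build : ∀ u → Only (Th Q₁) u → ¬ Th Q₂ (swapAB u) → ⊥
    build tb only noTh = build-w only noTh
    build tc only noTh = finish (inj₂ (inj₁ (root tc only , smaller k₂<n (invWord-lb Q₂ w₂)
      (let (e , r) = lb-LocEq Q₂ in pure-leaf e r (noTh , noIn)))))
    build ta only noTh with any? (λ b → adj Q₂ zero (suc b) Bool.≟ true)
    ... | yes (b , e) = finish (inj₂ (inj₂ (suc b , e , root ta only , smaller k₂<n (invWord-lcv Q₂ (suc b) w₂)
            (let (l , r) = lcv-LocEq Q₂ (suc b) e in pure-leaf l r (noTh , noIn)))))
    -- `lcv` needs a neighbour of the marker. Without one both markers are isolated and only `tb`
    -- passes, so the pair of `rw` and `lw` serves instead.
    ... | no none = build-w
            (λ p ne th → ne (through-isolated Q₁ (λ a → ≢true⇒≡false λ e → none (crossing s e)) th))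
            (λ th → ta≢tb (through-isolated Q₂ (λ b → ≢true⇒≡false λ e → none (b , e)) th))
      where
      ta≢tb : ta ≢ tb
      ta≢tb ()

  cases : (s : Split G) →
    (Tight (Th (side₁ s)) (In (side₁ s)) → Loose (Th (side₂ s)) (In (side₂ s)) → ⊥) →
    (Tight (Th (side₂ s)) (In (side₂ s)) → Loose (Th (side₁ s)) (In (side₁ s)) → ⊥) → ⊥
  cases s c₁ c₂ = dichotomy {Th (side₁ s)} {Th (side₂ s) ∘ swapAB} {In (side₁ s)} {In (side₂ s)}
    (λ p t₁ t₂ → pure⇒¬cover G pure (through-cover s p t₁ t₂))
    (λ i₁ i₂ → pure⇒¬cover G pure (inside-cover s i₁ i₂))
    (good s)
    (λ u only noTh noIn → good (swapSplit s) (swapAB u) (Only-swap {Th (side₂ s)} only)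
      (λ th → noTh (subst (Th (side₁ s)) (swapAB-involutive u) th)) noIn)
    (λ tight loose → c₁ tight (Loose-swap loose))
    (λ tight loose → c₂ (Tight-swap tight) loose)

  order≥4 : (s : Split G) → 4 ≤ n
  order≥4 s = subst (4 ≤_) (split-order s) (ℕ.+-mono-≤ (size₁ s) (size₂ s))

  white-isolated : 1 < n → ∀ y → (∀ x → adj G y x ≡ false) → colour G y ≡ white → ⊥
  white-isolated 1<n y isolated wy = irreducible (component alt c
    (smaller 1<n (invWord-induced (emb c) (λ {i} {j} → emb-inj c {i} {j}) (λ _ _ → refl) word) (¬cover⇒pure no-cover)))
    where
    c : Component G
    c = record
      { size = 0 ; emb = λ _ → y ; emb-inj = λ { {zero} {zero} _ → refl }
      ; closed = λ _ x e → ⊥-elim (true≢false e (isolated x)) ; connected = λ { zero zero → ε } }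
    no-cover : ¬ Cover (componentGraph c) (tagOf (componentGraph c))
    no-cover (d , adm , cov) with cov zero
    ... | x , Gx , x≼d , nz with x≼d zero
    ...   | inj₁ e = nz e
    ...   | inj₂ e = adm zero (trans (only-tb (d zero) (trans (cong α (sym e)) (trans (row Gx zero)
              (cong (λ a → (a ∧ β (x zero)) xor false) (adj-irr G y))))) (sym (cong code wy)))
      where
      only-tb : ∀ p → α (just p) ≡ false → p ≡ tb
      only-tb tb _ = refl

  -- White isolated vertices are pure components, so `y` is black. In an edgeless graph all vertices
  -- would then form a black anticlique. Otherwise split off `y` with an endpoint `v` of an edge:
  -- the marker sees only `v` and copies its value up to `swapAB`. Exactly two transitions pass, and
  -- no choice is inside because it could not cover `v`. Such a side is neither tight nor loose.
  no-isolated : 4 ≤ n → ∀ y → ¬ (∀ x → adj G y x ≡ false)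
  no-isolated 4≤n y isolated with any? (λ v → any? λ w → adj G v w Bool.≟ true)
  ... | no none = pure G (self∈class G) (λ _ → true)
          ((λ u v _ _ → edgeless u v) , λ _ _ _ _ _ → refl) λ u _ → isBlack u
    where
    edgeless : ∀ u v → adj G u v ≡ false
    edgeless u v = ≢true⇒≡false λ e → none (u , v , e)
    isBlack : ∀ u → colour G u ≡ black
    isBlack u = ≢white⇒black (white-isolated (≤-trans (s≤s (s≤s z≤n)) 4≤n) u (edgeless u))
  ... | yes (v , w , vw) = cases s tight₁ loose₁
    where
    by : colour G y ≡ black
    by = ≢white⇒black (white-isolated (≤-trans (s≤s (s≤s z≤n)) 4≤n) y isolated)
    y≢v : y ≢ v
    y≢v refl = true≢false vw (isolated w)
    e : Fin 2 → Fin n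
    e zero = y
    e (suc zero) = v
    inj : Injective _≡_ _≡_ e
    inj {zero} {zero} p = refl
    inj {zero} {suc zero} p = ⊥-elim (y≢v p)
    inj {suc zero} {zero} p = ⊥-elim (y≢v (sym p))
    inj {suc zero} {suc zero} p = refl
    cut : Cut true G e
    cut = record { f = λ { zero → false ; (suc zero) → true } ; g = adj G v
                 ; product = λ { zero b _ → isolated b ; (suc zero) b _ → refl } }
    C : Complement e
    C = complement e
    s : Split G
    s = cutSplit inj C ≤-refl (ℕ.+-cancelˡ-≤ 2 _ _ (subst (4 ≤_) (sym (complement-order inj C)) 4≤n)) cut
    Q : BGraph 3
    Q = side₁ s
    zy : adj Q zero (suc zero) ≡ false
    zy = ≢true⇒≡false λ p → let (b , q) = anyFin⁻ (λ b → adj G y (e₂ s b)) p in true≢false q (isolated (e₂ s b))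
    zv : adj Q zero (suc (suc zero)) ≡ true
    zv = anyFin⁺ _ (proj₁ w-outside) (trans (cong (adj G v) (proj₂ w-outside)) vw)
      where
      w-outside : ∃[ b ] e₂ s b ≡ w
      w-outside with cover s w
      ... | inj₂ found = found
      ... | inj₁ (zero , refl) = ⊥-elim (true≢false vw (trans (adj-sym G v w) (isolated v)))
      ... | inj₁ (suc zero , refl) = ⊥-elim (true≢false vw (adj-irr G v))
    yv : adj Q (suc zero) (suc (suc zero)) ≡ false
    yv = isolated v
    sum₃ : ∀ i (z : Fin 3 → Bool) {a b c} → adj Q i zero ≡ a → adj Q i (suc zero) ≡ b → adj Q i (suc (suc zero)) ≡ c →
      sum (λ w → adj Q i w ∧ z w) ≡ (a ∧ z zero) xor ((b ∧ z (suc zero)) xor ((c ∧ z (suc (suc zero))) xor false))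
    sum₃ i z refl refl refl = refl
    row-z : ∀ z → sum (λ w → adj Q zero w ∧ z w) ≡ z (suc (suc zero))
    row-z z = trans (sum₃ zero z refl zy zv) (xor-identityʳ _)
    row-y : ∀ z → sum (λ w → adj Q (suc zero) w ∧ z w) ≡ false
    row-y z = sum₃ (suc zero) z (trans (adj-sym Q (suc zero) zero) zy) (adj-irr Q (suc zero)) yv
    row-v : ∀ z → sum (λ w → adj Q (suc (suc zero)) w ∧ z w) ≡ z zero
    row-v z = trans (sum₃ (suc (suc zero)) z (trans (adj-sym Q (suc (suc zero)) zero) zv)
      (trans (adj-sym Q (suc (suc zero)) (suc zero)) yv) (adj-irr Q (suc (suc zero)))) (xor-identityʳ _)
    root≡ : ∀ {x} → Q ⊨ x → x zero ≡ act swapAB (x (suc (suc zero)))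
    root≡ {x} Qx = bits-injective
      (trans (trans (row Qx zero) (row-z (β ∘ x))) (sym (α-swapAB (x (suc (suc zero))))))
      (trans (sym (trans (row Qx (suc (suc zero))) (row-v (β ∘ x)))) (sym (β-swapAB (x (suc (suc zero))))))
    tv : Transition
    tv = tagOf G v
    through : ∀ p → p ≢ tv → Th Q (swapAB p)
    through p ne = c , adm , λ
      { zero → link , link-⊨ , link≼ , (λ ())
      ; (suc zero) → loop , loop-⊨ , loop≼ , (λ ())
      ; (suc (suc zero)) → link , link-⊨ , link≼ , (λ ()) }
      where
      c : Fin 2 → Transition
      c zero = tb
      c (suc zero) = p
      adm : ∀ i → c i ≢ tagOf Q (suc i)
      adm zero q = tb≢tc (trans q (cong code by))
        where
        tb≢tc : tb ≢ tc
        tb≢tc ()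
      adm (suc zero) = ne
      link loop : Fin 3 → K
      link zero = just (swapAB p)
      link (suc zero) = nothing
      link (suc (suc zero)) = just p
      loop zero = nothing
      loop (suc zero) = just tb
      loop (suc (suc zero)) = nothing
      link-⊨ : Q ⊨ link
      link-⊨ .row zero = trans (α-swapAB (just p)) (sym (row-z (β ∘ link)))
      link-⊨ .row (suc zero) = sym (row-y (β ∘ link))
      link-⊨ .row (suc (suc zero)) = trans (sym (β-swapAB (just p))) (sym (row-v (β ∘ link)))
      loop-⊨ : Q ⊨ loop
      loop-⊨ .row zero = sym (row-z (β ∘ loop))
      loop-⊨ .row (suc zero) = sym (row-y (β ∘ loop))
      loop-⊨ .row (suc (suc zero)) = sym (row-v (β ∘ loop))
      link≼ : ∀ i → link i ≼ (swapAB p ◂ c) i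
      link≼ zero = inj₂ refl
      link≼ (suc zero) = inj₁ refl
      link≼ (suc (suc zero)) = inj₂ refl
      loop≼ : ∀ i → loop i ≼ (swapAB p ◂ c) i
      loop≼ zero = inj₁ refl
      loop≼ (suc zero) = inj₂ refl
      loop≼ (suc (suc zero)) = inj₁ refl
    through⁻ : ∀ {p} → Th Q p → p ≢ swapAB tv
    through⁻ (c , adm , cov) refl with cov zero
    ... | x , Qx , x≼c , nz with x≼c zero | x≼c (suc (suc zero))
    ...   | inj₁ x0 | _ = nz x0
    ...   | _ | inj₁ xv = nz (trans (root≡ Qx) (cong (act swapAB) xv))
    ...   | inj₂ x0 | inj₂ xv = adm (suc zero) (trans (sym (swapAB-involutive _)) (trans
              (cong swapAB (just-injective (trans (sym (trans (root≡ Qx) (cong (act swapAB) xv))) x0))) (swapAB-involutive tv)))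
    inside⁻ : ¬ In Q
    inside⁻ (c , adm , cov) with cov (suc zero)
    ... | x , Qx , x0 , x≼c , nz = nz (vanish (x (suc (suc zero))) (trans (sym (root≡ Qx)) x0))
      where
      vanish : ∀ k → act swapAB k ≡ nothing → k ≡ nothing
      vanish nothing _ = refl
    tight₁ : Tight (Th Q) (In Q) → Loose (Th (side₂ s)) (In (side₂ s)) → ⊥
    tight₁ ((u , only) , _) _ =
      let (p , p≢) = another tv
          (q , q≢tv , q≢p) = third tv p
      in only (swapAB p) (λ eq → only (swapAB q) (λ eq′ → swapAB-≢ q≢p (trans eq′ (sym eq))) (through q q≢tv)) (through p p≢)
      where
      third : ∀ a b → ∃ λ c → c ≢ a × c ≢ b
      third ta ta = tb , (λ ()) , (λ ())
      third ta tb = tc , (λ ()) , (λ ())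
      third ta tc = tb , (λ ()) , (λ ())
      third tb ta = tc , (λ ()) , (λ ())
      third tb tb = ta , (λ ()) , (λ ())
      third tb tc = ta , (λ ()) , (λ ())
      third tc ta = tb , (λ ()) , (λ ())
      third tc tb = ta , (λ ()) , (λ ())
      third tc tc = ta , (λ ()) , (λ ())
    loose₁ : Tight (Th (side₂ s)) (In (side₂ s)) → Loose (Th Q) (In Q) → ⊥
    loose₁ _ (p , q , ne , Tp , Tq , inj₁ i) = inside⁻ i
    loose₁ _ (p , q , ne , Tp , Tq , inj₂ (r , r≢p , r≢q , Tr)) =
      pigeonhole {p} {q} {r} {swapAB tv} ne (through⁻ Tr) r≢p r≢q (λ e → through⁻ Tp (sym e)) (λ e → through⁻ Tq (sym e))

  -- Connectedness of `G`. A part with a single vertex would be isolated; two larger parts form a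
  -- split, one of whose sides is loose, but by `loose-crossing` a loose side has a crossing edge.
  no-zero-cut : 4 ≤ n → ∀ {k} {e : Fin (suc k) → Fin n} → Injective _≡_ _≡_ e → ∀ {b} → (∀ i → e i ≢ b) → ¬ Cut false G e
  no-zero-cut 4≤n {k} {e} inj {b} off c = go k e inj off c (complement e) refl
    where
    go : ∀ k (e : Fin (suc k) → Fin n) → Injective _≡_ _≡_ e → ∀ {b} → (∀ i → e i ≢ b) → Cut false G e →
      (C : Complement e) → ∀ {l} → Complement.l C ≡ l → ⊥
    go zero e inj {b} off c C _ = no-isolated 4≤n (e zero) isolated
      where
      isolated : ∀ x → adj G (e zero) x ≡ false
      isolated x with e zero ≟ x
      ... | yes refl = adj-irr G x
      ... | no ne = product c zero x λ { zero → ne }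
    go (suc k) e inj {b} off c C {l} eq with Complement.cover′ C b
    ... | inj₁ (a , p) = off a p
    ... | inj₂ (b′ , p) = by-size l eq
      where
      open Complement C using (e′; disjoint′; cover′)
      by-size : ∀ l → Complement.l C ≡ l → ⊥
      by-size zero eq = Fin.¬Fin0 (subst Fin eq b′)
      by-size (suc zero) eq = no-isolated 4≤n b isolated
        where
        unique : ∀ b″ → b″ ≡ b′
        unique b″ = only-one eq b″ b′
          where
          only-one : ∀ {l} → l ≡ 1 → (x y : Fin l) → x ≡ y
          only-one refl zero zero = refl
        isolated : ∀ x → adj G b x ≡ false
        isolated x with cover′ x
        ... | inj₁ (a , refl) = trans (adj-sym G b (e a)) (product c a b off)
        ... | inj₂ (b″ , refl) = trans (cong (λ v → adj G v (e′ b″)) (sym p)) (trans (cong (λ v → adj G (e′ b′) (e′ v)) (unique b″)) (adj-irr G (e′ b′)))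
      by-size (suc (suc l)) eq = cases s (λ _ → uncrossed (swapSplit s) λ a b → trans (adj-sym G _ _) (product c b (e′ a) λ i → disjoint′ i a))
                                         (λ _ → uncrossed s λ a b → product c a (e′ b) λ i → disjoint′ i b)
        where
        s : Split G
        s = cutSplit inj C (s≤s (s≤s z≤n)) (subst (2 ≤_) (sym eq) (s≤s (s≤s z≤n))) c
        uncrossed : (s : Split G) → (∀ a b → adj G (e₁ s a) (e₂ s b) ≡ false) → ¬ Loose (Th (side₁ s)) (In (side₁ s))
        uncrossed s zero-cut loose = let (a , edge) = loose-crossing {Q = side₁ s} loose
                                         (b , ab) = anyFin⁻ _ edge
                                     in true≢false ab (zero-cut a b)

  module Descent (s : Split G) (tight : Tight (Th (side₁ s)) (In (side₁ s))) (loose : Loose (Th (side₂ s)) (In (side₂ s)))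
    (IH : ∀ (s′ : Split G) → k₁ s′ < k₁ s → Tight (Th (side₁ s′)) (In (side₁ s′)) → Loose (Th (side₂ s′)) (In (side₂ s′)) → ⊥) where

    u : Transition
    u = proj₁ (proj₁ tight)

    Q : BGraph (suc (k₁ s))
    Q = side₁ s

    H : BGraph (suc (k₁ s))
    H = rootPiece u Q

    pureH : PureAlternance H
    pureH = invWord⇒alternance (invWord-rootPiece u Q (invWord-side s word)) , pure-rootPiece u Q (proj₂ (proj₁ tight))

    module _ {m} {X : BGraph m} (same : SameClass H X) where

      π : Permutation (suc (k₁ s)) m
      π = proj₁ same

      relabelled : relabel π H ∈[ X ]
      relabelled = proj₁ (proj₂ same) H (self∈class H)

      module _ {k} {e : Fin k → Fin m} (e-inj : Injective _≡_ _≡_ e) (z∉e : ∀ j → e j ≢ π ⟨$⟩ʳ zero) where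

        private
          predecessor : ∀ j → ∃ λ a → π ⟨$⟩ˡ e j ≡ suc a
          predecessor j with π ⟨$⟩ˡ e j in p
          ... | zero  = ⊥-elim (z∉e j (trans (sym (inverseʳ π)) (cong (π ⟨$⟩ʳ_) p)))
          ... | suc a = a , refl

        h : Fin k → Fin (k₁ s)
        h j = proj₁ (predecessor j)

        h≡ : ∀ j → π ⟨$⟩ˡ e j ≡ suc (h j)
        h≡ j = proj₂ (predecessor j)

        h-inj : Injective _≡_ _≡_ h
        h-inj {i} {j} p = e-inj (trans (sym (inverseʳ π)) (trans (cong (π ⟨$⟩ʳ_)
          (trans (h≡ i) (trans (cong suc p) (sym (h≡ j))))) (inverseʳ π)))

        eG-inj : Injective _≡_ _≡_ (e₁ s ∘ h)
        eG-inj p = h-inj (e₁-inj s p)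

        cut-transfer : ∀ {r} → Cut r X e → Cut r G (e₁ s ∘ h)
        cut-transfer c = let (w , _ , a , _) = relabelled in
          cut-side s (cut-rootPiece u Q (cut-relabel π h≡ (cut-≗ a (cut-applyW w c))))

        loose-transfer : LooseAt G (tagOf G) (e₁ s ∘ h) → LooseAt X (tagOf X) e
        loose-transfer l = let (w , pw , a , b) = relabelled in
          looseAt-LocEq e (LocEq-sym (applyW-LocEq pw))
            (looseAt-LocEq e (≗-LocEq (λ u v → sym (a u v)) (λ v → cong code (b v)))
              (looseAt-relabel π {t = tagOf H} h≡
                (looseAt-LocEq (suc ∘ h) (rootPiece-LocEq u Q) (looseAt-side s {rootTag u Q} h (λ _ → refl) l))))

      -- The side of `s′` without the marker is pulled back to the first side of a split of `G`. If
      -- it is tight, `IH` applies. If it is loose, looseness transfers back to `X` and contradicts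
      -- the pure piece there.
      z-side : (s′ : Split X) → (∃ λ a → e₁ s′ a ≡ π ⟨$⟩ʳ zero) → Barren (side₂ s′) → ⊥
      z-side s′ (a₀ , z≡) barren = cases sG
        (λ t l → IH sG smaller-side t l)
        (λ _ l → let (_ , edge) = loose-crossing {Q = side₁ sG} l in
          loose-¬barren (looseAt⇒loose (side₂ s′) {tagOf (side₂ s′)}
            (looseAt-side (swapSplit s′) {tagOf (side₂ s′)} (λ b → b) (λ _ → refl)
              (loose-transfer (e₂-inj s′) z∉ (looseAt-whole sG {tagOf (side₁ sG)} edge (λ _ → refl) (loose⇒looseAt (side₁ sG) {tagOf (side₁ sG)} l))))) barren)
        where
        z∉ : ∀ b → e₂ s′ b ≢ π ⟨$⟩ʳ zero
        z∉ b p = disjoint s′ a₀ b (trans z≡ (sym p))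
        -- Besides the first side of `s`, `X` contains only the marker, and the marker's side of
        -- `s′` takes at least two vertices.
        smaller-side : k₂ s′ < k₁ s
        smaller-side = ℕ.≤-pred (≤-trans (ℕ.+-monoˡ-≤ (k₂ s′) (size₁ s′)) (≤-reflexive (trans (split-order s′) (sym (↔⇒≡ π)))))
        inj = eG-inj (e₂-inj s′) z∉
        C : Complement (e₁ s ∘ h (e₂-inj s′) z∉)
        C = complement (e₁ s ∘ h (e₂-inj s′) z∉)
        2≤l : 2 ≤ Complement.l C
        2≤l = ≤-trans (size₂ s) (ℕ.+-cancelˡ-≤ (k₂ s′) _ _ (≤-trans (ℕ.+-monoˡ-≤ (k₂ s) (ℕ.<⇒≤ smaller-side))
          (≤-reflexive (trans (split-order s) (sym (complement-order inj C))))))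
        sG : Split G
        sG = cutSplit inj C (size₂ s′) 2≤l (cut-transfer (e₂-inj s′) z∉ (cut-split (swapSplit s′)))

      no-decomposition : (s′ : Split X) → Barren (side₁ s′) → Barren (side₂ s′) → ⊥
      no-decomposition s′ b₁ b₂ with cover s′ (π ⟨$⟩ʳ zero)
      ... | inj₁ found = z-side s′ found b₂
      ... | inj₂ found = z-side (swapSplit s′) found b₁

      no-zero-cut-in-class : ∀ {k} {e : Fin (suc k) → Fin m} → Injective _≡_ _≡_ e → (∀ j → e j ≢ π ⟨$⟩ʳ zero) → ¬ Cut false X e
      no-zero-cut-in-class e-inj z∉ c = no-zero-cut (order≥4 s) (eG-inj e-inj z∉) {e₂ s (some (size₂ s))}
        (λ i → disjoint s (h e-inj z∉ i) (some (size₂ s))) (cut-transfer e-inj z∉ c)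
        where
        some : ∀ {k} → 2 ≤ k → Fin k
        some (s≤s _) = zero

    -- Stated for all `X` in the class because closures may change the representative.
    -- Decompositions of `X` are refuted by the descent. A component is either all of `X`, hence a
    -- relabelling of it, or it gives a cut of rank zero.
    primitive-in-class : ∀ (F : Graph → Set) → (∀ J → F J → PureAlternance (proj₂ J)) →
      ∀ {m} {X : BGraph m} → Closure F X → SameClass H X → H ∈Fam F
    primitive-in-class F pureF (base (J , FJ , same′)) same = J , FJ , sameClass-trans same same′
    primitive-in-class F pureF (decomp _ (s′ , inj₁ p)) same =
      let (b₁ , b₂) = essDecomp-barren pureF s′ p in ⊥-elim (no-decomposition same s′ b₁ b₂)
    primitive-in-class F pureF (decomp _ (s′ , inj₂ p)) same =
      let (b₁ , b₂) = essDecomp-barren pureF (swapSplit s′) p in ⊥-elim (no-decomposition same (swapSplit s′) b₁ b₂)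
    primitive-in-class F pureF (sameClass same′ cl) same = primitive-in-class F pureF cl (sameClass-trans same same′)
    primitive-in-class F pureF {X = X} (component _ c cl) same with all? (λ x → any? λ i → emb c i ≟ x)
    ... | yes onto = primitive-in-class F pureF cl (sameClass-trans same (sameClass-≅ {π = ρ} (iso ((λ _ _ → refl) , λ _ → refl))))
      where
      ρ : Permutation _ (suc (size c))
      ρ = permutation (λ x → proj₁ (onto x)) (emb c) (λ i → emb-inj c (proj₂ (onto (emb c i)))) (λ x → proj₂ (onto x))
    ... | no ¬onto = ⊥-elim (proper (any? λ i → emb c i ≟ z))
      where
      z = π same ⟨$⟩ʳ zero
      component-cut : Cut false X (emb c)
      component-cut = record { f = λ _ → false ; g = λ _ → false
        ; product = λ j b off → ≢true⇒≡false λ e → let (i , p) = closed c j b e in off i p }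
      C : Complement (emb c)
      C = complement (emb c)
      open Complement C
      -- The empty cut is read from the component or from its complement, whichever avoids the
      -- marker and so pulls back to `G`.
      proper : Dec (∃ λ i → emb c i ≡ z) → ⊥
      proper (no none) = no-zero-cut-in-class same (λ {i} {j} → emb-inj c {i} {j}) (λ j p → none (j , p)) component-cut
      proper (yes (i , p)) with ¬∀⟶∃¬ _ _ (λ x → any? λ i → emb c i ≟ x) ¬onto
      ... | x , x∉ with cover′ x
      ...   | inj₁ found = x∉ found
      ...   | inj₂ (b , _) = uncut e′-inj (λ j q → disjoint′ i j (trans p (sym q))) b
        (record { f = λ _ → false ; g = λ _ → false ; product = λ j b off → ≢true⇒≡false λ e → outside j b off e (cover′ b) })
        where
        uncut : ∀ {l} {e : Fin l → Fin _} → Injective _≡_ _≡_ e → (∀ j → e j ≢ z) → Fin l → ¬ Cut false X e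
        uncut {suc l} inj z∉ _ = no-zero-cut-in-class same inj z∉
        outside : ∀ j b → (∀ i → e′ i ≢ b) → adj X (e′ j) b ≡ true → (∃[ a ] emb c a ≡ b) ⊎ (∃[ d ] e′ d ≡ b) → ⊥
        outside j b off e (inj₂ (d , q)) = off d q
        outside j b off e (inj₁ (a , refl)) = let (a′ , q) = closed c a (e′ j) (trans (adj-sym X _ _) e) in disjoint′ a′ j q

    candidate : Candidate H
    candidate = (pureH , λ F pureF cl → primitive-in-class F pureF cl (sameClass-refl H)) ,
      (λ { (one , _) → ℕ.<⇒≱ (size₁ s) (ℕ.m≤n⇒m≤1+n (≤-reflexive (ℕ.suc-injective one))) }) ,
      λ pent → proj₂ tight (unpinned⇒ (unpinned-LocEq (LocEq-sym (rootPiece-LocEq u Q)) (unpinned-class pent zero)))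

  descent : (∀ {m} (H : BGraph m) → Candidate H → n ≤ m) → ∀ (s : Split G) → Acc _<_ (k₁ s) →
    Tight (Th (side₁ s)) (In (side₁ s)) → Loose (Th (side₂ s)) (In (side₂ s)) → ⊥
  descent minimal s (acc rec) tight loose = ℕ.<⇒≱ (k₁<n s) (minimal _ (Descent.candidate s tight loose
    λ s′ lt → descent minimal s′ (rec lt)))

theorem2p7p12 : ∀ {n} (G : BGraph n) → Candidate G
    → (∀ {m} (H : BGraph m) → Candidate H → n ≤ m)
    → Prime G
theorem2p7p12 {n} G (((alt , pure) , primitive′) , _) minimal s =
  cases s (descent minimal s (<-wellFounded _)) (descent minimal (swapSplit s) (<-wellFounded _))
  where
  irreducible : ¬ Closure (Smaller n) G
  -- A smaller graph with the same class as `G` is impossible, since the permutation between their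
  -- vertices equates the orders.
  irreducible cl = let ((m , H) , (m<n , _) , π , _) = primitive′ (Smaller n) (λ _ → proj₂) cl in
    <-irrefl (sym (↔⇒≡ π)) m<n
  open Irreducible G alt pure irreducible
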